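{- Let $|t|$ be the size of the initial term $t$ of a derivation $d$ (a closed term without explicit substitutions), and let $|d|$ be the number of steps of $d$. (1) (Low-level bilinear implementation) Every derivation $d:t\multimap_{\mathtt{of}}^*u$ of the Unchaining Fireball Calculus is implementable on RAM in $O((1+|d|)\cdot|t|)$ steps. (2) (Low + high bilinear implementation) Every derivation $d:t\to_{\mathtt f}^*u$ of the Fireball Calculus is implementable on RAM in $O((1+|d|)\cdot|t|)$ steps.
   Context: **Fireball Calculus (FBC).** Terms: $t,u ::= x\mid a\mid\lambda x.t\mid tu$, where $x$ ranges over variables and $a$ over a separate set of symbols (constants, never bound nor substituted). Terms are taken up to $\alpha$-equivalence; $t\{x\leftarrow u\}$ is capture-avoiding substitution; a term is closed if it has no free variables (symbols are allowed). Values $v::=\lambda x.t$; fireballs $f::=v\mid A$; inerts $A::=a\mid Af$. Evaluation contexts $F::=\langle\cdot\rangle\mid tF\mid Ff$. The rule is $F\langle(\lambda x.t)f\rangle\to_{\mathtt f}F\langle t\{x\leftarrow f\}\rangle$. Size: $|x|=|a|=1$, $|\lambda x.t|=|t|+1$, $|tu|=|t|+|u|+1$. **Explicit substitutions (ES).** Terms with ES add the construct $t[x\leftarrow u]$, binding $x$ in $t$. Values are still the abstractions $v$. Unfolding: $x{\downarrow}=x$, $a{\downarrow}=a$, $(tu){\downarrow}=t{\downarrow}\,u{\downarrow}$, $(\lambda x.t){\downarrow}=\lambda x.t{\downarrow}$, $t[x\leftarrow u]{\downarrow}=t{\downarrow}\{x\leftarrow u{\downarrow}\}$. Plugging a term in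 a context may capture variables. Substitution contexts $L::=\langle\cdot\rangle\mid L[x\leftarrow t]$. Shallow contexts $S::=\langle\cdot\rangle\mid St\mid tS\mid S[x\leftarrow t]$. Weak contexts $W::=\langle\cdot\rangle\mid tW\mid Wt\mid W[x\leftarrow t]\mid t[x\leftarrow W]$. An initial term is a closed term without ES. **Structural equivalence** $\equiv$ is the least equivalence closed under weak contexts containing: $t[x\leftarrow u][y\leftarrow w]\equiv t[y\leftarrow w][x\leftarrow u]$ if $y\notin fv(u)$, $x\notin fv(w)$; $(tw)[x\leftarrow u]\equiv t\,(w[x\leftarrow u])$ if $x\notin fv(t)$; $(tw)[x\leftarrow u]\equiv (t[x\leftarrow u])\,w$ if $x\notin fv(w)$; $t[x\leftarrow u][y\leftarrow w]\equiv t[x\leftarrow u[y\leftarrow w]]$ if $y\notin fv(t)$. **Useful contexts.** Evaluable shallow contexts are defined inductively: $\langle\cdot\rangle$ is evaluable; $St$ is evaluable if $S$ is and $t{\downarrow}$ is a fireball; $tS$ is evaluable if $S$ is; $S[x\leftarrow t]$ is evaluable if $t{\downarrow}$ is a fireball and $S\{x\leftarrow t{\downarrow}\}$ is evaluable. $S$ is applicative if $S=S'\langle L\,u\rangle$ for some $S',L,u$ (the hole of $S$ being the hole of $L$); $S$ is useful if it is evaluable and applicative. **Chain contexts.** Identity contexts $I,I'::=\langle\cdot\rangle\mid I\langle x\rangle[x\leftarrow I']\mid I[x\leftarrow t]$; chain contexts $C::=S\langle x\rangle[x\leftarrow I]\mid C\langle x\rangle[x\leftarrow I]\mid S\langle C\rangle$.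 The chain-starting context $\overleftarrow{C}^{x}$ (a shallow context) is: $\overleftarrow{S\langle y\rangle[y\leftarrow I]}^{x}=S[y\leftarrow I\langle x\rangle]$; $\overleftarrow{C\langle y\rangle[y\leftarrow I]}^{x}=\overleftarrow{C}^{y}[y\leftarrow I\langle x\rangle]$; $\overleftarrow{S\langle C\rangle}^{x}=S\langle\overleftarrow{C}^{x}\rangle$. **Unchaining FBC.** $\multimap_{\mathtt{of}}$ is the union of the following rules (up to $\alpha$; the displayed occurrence of $x$ is bound by the displayed ES on $x$, and moving $L$ outwards captures no variable): - $S\langle L\langle\lambda x.t\rangle u\rangle\multimap_{\mathtt{om}}S\langle L\langle t[x\leftarrow u]\rangle\rangle$ if $S\langle\langle\cdot\rangle u\rangle$ is useful; - $S\langle S'\langle x\rangle[x\leftarrow L\langle v\rangle]\rangle\multimap_{\mathtt{oes}}S\langle L\langle S'\langle v\rangle[x\leftarrow v]\rangle\rangle$ if $S\langle S'[x\leftarrow L\langle v\rangle]\rangle$ is useful; - $S\langle C\langle x\rangle[x\leftarrow L\langle v\rangle]\rangle\multimap_{\mathtt{oec}}S\langle L\langle C\langle v\rangle[x\leftarrow v]\rangle\rangle$ if $S\langle\overleftarrow{C}^{x}[x\leftarrow L\langle v\rangle]\rangle$ is useful. **Implementability.** The RAM is a standard random access machine with unit-cost pointer operations; terms are represented by linked structures. The output of a computation is given in shared form, i.e. as a term with ES. "Derivations are implementable on RAM in $O(g)$ steps" means that there is one RAM algorithm which, given an initial term $t$ and the length $n$ of a derivation $d$ of the considered kind from $t$ to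 $u$, performs $O(g)$ steps and produces (a representation of) a term with ES $w$ such that: $w\equiv u$, for derivations of a calculus with ES; $w{\downarrow}=u$ up to $\alpha$, for $\to_{\mathtt f}$-derivations. -}

module Defs where

open import Data.Bool.Base using (if_then_else_)
open import Data.Fin.Base using (Fin; zero; suc)
open import Data.List.Base using (List; []; _∷_; _++_; drop; head)
open import Data.List.Relation.Unary.All using (All)
open import Data.List.Relation.Unary.Unique.Propositional using (Unique)
open import Data.Maybe.Base using (Maybe; just; nothing)
open import Data.Nat.Base using (ℕ; zero; suc; _+_; _∸_; _*_; _≤_; _<_; _≡ᵇ_)
open import Data.Product.Base using (Σ; ∃; ∃-syntax; _×_; _,_; proj₂)
open import Data.Vec.Base using (Vec; []; _∷_; lookup)
open import Function.Base using (_∘_)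
open import Level using (0ℓ)
open import Relation.Binary.Construct.Closure.Equivalence using (EqClosure)
open import Relation.Binary.Construct.Closure.ReflexiveTransitive using (Star; ε; _◅_)
open import Relation.Binary.Core using (Rel)
open import Relation.Binary.PropositionalEquality.Core using (_≡_)

infixl 7 _·_ _·ˡ_
infixr 7 _·ʳ_
infixl 8 _[←_] _[←_]ʳ _⟨x⟩[←_] _⟨x⟩[←_]ˢ _↓
infixr 9 _∘ˢ_ _∘ʷ_ _∘ᶜ_
infix  6 _⟨_⟩ _⟨_⟩ᶠ
infix  6 ƛ_
infix  4 _→f_ _⋈_ _⋈ʷ_ _≅_ _⊸of_

------------------------------------------------------------------------
-- Terms

-- Well-scoped de Bruijn terms, so that α-equivalence is _≡_.  Only terms of
-- kind `shared` may contain explicit substitutions; `plain` terms are the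
-- terms of the Fireball Calculus, and `Term plain 0` the initial terms.

data Kind : Set where
  plain shared : Kind

data Term : Kind → ℕ → Set where
  var   : ∀ {k n} → Fin n → Term k n
  con   : ∀ {k n} → ℕ → Term k n
  ƛ_    : ∀ {k n} → Term k (suc n) → Term k n
  _·_   : ∀ {k n} → Term k n → Term k n → Term k n
  _[←_] : ∀ {n} → Term shared (suc n) → Term shared n → Term shared n

∣_∣ : ∀ {n} → Term plain n → ℕ
∣ var _ ∣ = 1
∣ con _ ∣ = 1
∣ ƛ t   ∣ = ∣ t ∣ + 1
∣ t · u ∣ = ∣ t ∣ + ∣ u ∣ + 1

ext : ∀ {n m} → (Fin n → Fin m) → Fin (suc n) → Fin (suc m)
ext ρ zero    = zero
ext ρ (suc i) = suc (ρ i)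

rename : ∀ {k n m} → (Fin n → Fin m) → Term k n → Term k m
rename ρ (var i)    = var (ρ i)
rename ρ (con a)    = con a
rename ρ (ƛ t)      = ƛ rename (ext ρ) t
rename ρ (t · u)    = rename ρ t · rename ρ u
rename ρ (t [← u ]) = rename (ext ρ) t [← rename ρ u ]

exts : ∀ {k n m} → (Fin n → Term k m) → Fin (suc n) → Term k (suc m)
exts σ zero    = var zero
exts σ (suc i) = rename suc (σ i)

subst : ∀ {k n m} → (Fin n → Term k m) → Term k n → Term k m
subst σ (var i)    = σ i
subst σ (con a)    = con a
subst σ (ƛ t)      = ƛ subst (exts σ) t
subst σ (t · u)    = subst σ t · subst σ u
subst σ (t [← u ]) = subst (exts σ) t [← subst σ u ]

zero↦ : ∀ {k n} → Term k n → Fin (suc n) → Term k n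
zero↦ u zero    = u
zero↦ u (suc i) = var i

_↓ : ∀ {k n} → Term k n → Term plain n
var i ↓      = var i
con a ↓      = con a
(ƛ t) ↓      = ƛ (t ↓)
(t · u) ↓    = t ↓ · u ↓
(t [← u ]) ↓ = subst (zero↦ (u ↓)) (t ↓)

embed : ∀ {n} → Term plain n → Term shared n
embed (var i) = var i
embed (con a) = con a
embed (ƛ t)   = ƛ embed t
embed (t · u) = embed t · embed u

------------------------------------------------------------------------
-- The Fireball Calculus

mutual
  data Fireball {n} : Term plain n → Set where
    value : ∀ {t} → Fireball (ƛ t)
    inert : ∀ {t} → Inert t → Fireball t

  data Inert {n} : Term plain n → Set where
    con : ∀ {a} → Inert (con a)
    _·_ : ∀ {t u} → Inert t → Fireball u → Inert (t · u)

data Evaluation (n : ℕ) : Set where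
  □    : Evaluation n
  _·ʳ_ : Term plain n → Evaluation n → Evaluation n
  _·ˡ_ : Evaluation n → ∃ (Fireball {n}) → Evaluation n

_⟨_⟩ᶠ : ∀ {n} → Evaluation n → Term plain n → Term plain n
□              ⟨ t ⟩ᶠ = t
(u ·ʳ F)       ⟨ t ⟩ᶠ = u · (F ⟨ t ⟩ᶠ)
(F ·ˡ (f , _)) ⟨ t ⟩ᶠ = (F ⟨ t ⟩ᶠ) · f

data _→f_ {n} : Rel (Term plain n) 0ℓ where
  β : ∀ (F : Evaluation n) {t f} → Fireball f →
      F ⟨ (ƛ t) · f ⟩ᶠ →f F ⟨ subst (zero↦ f) t ⟩ᶠ

------------------------------------------------------------------------
-- Contexts with explicit substitutions

-- In every family of contexts the first index is the scope outside the
-- context and the second one the scope of its hole.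

data Weak : ℕ → ℕ → Set where
  □      : ∀ {n} → Weak n n
  _·ʳ_   : ∀ {n m} → Term shared n → Weak n m → Weak n m
  _·ˡ_   : ∀ {n m} → Weak n m → Term shared n → Weak n m
  _[←_]  : ∀ {n m} → Weak (suc n) m → Term shared n → Weak n m
  _[←_]ʳ : ∀ {n m} → Term shared (suc n) → Weak n m → Weak n m

_⟨_⟩ : ∀ {n m} → Weak n m → Term shared m → Term shared n
□            ⟨ t ⟩ = t
(u ·ʳ W)     ⟨ t ⟩ = u · (W ⟨ t ⟩)
(W ·ˡ u)     ⟨ t ⟩ = (W ⟨ t ⟩) · u
(W [← u ])   ⟨ t ⟩ = (W ⟨ t ⟩) [← u ]
(u [← W ]ʳ)  ⟨ t ⟩ = u [← W ⟨ t ⟩ ]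

_∘ʷ_ : ∀ {n m l} → Weak n m → Weak m l → Weak n l
□           ∘ʷ V = V
(u ·ʳ W)    ∘ʷ V = u ·ʳ (W ∘ʷ V)
(W ·ˡ u)    ∘ʷ V = (W ∘ʷ V) ·ˡ u
(W [← u ])  ∘ʷ V = (W ∘ʷ V) [← u ]
(u [← W ]ʳ) ∘ʷ V = u [← W ∘ʷ V ]ʳ

-- How a variable from outside the context is named at its hole.
inside : ∀ {n m} → Weak n m → Fin n → Fin m
inside □           = λ i → i
inside (_ ·ʳ W)    = inside W
inside (W ·ˡ _)    = inside W
inside (W [← _ ])  = inside W ∘ suc
inside (_ [← W ]ʳ) = inside W

renameʷ : ∀ {n m n′} → (Fin n → Fin n′) → Weak n m → ∃ (Weak n′)
renameʷ ρ □           = _ , □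
renameʷ ρ (u ·ʳ W)    = let _ , W′ = renameʷ ρ W in _ , rename ρ u ·ʳ W′
renameʷ ρ (W ·ˡ u)    = let _ , W′ = renameʷ ρ W in _ , W′ ·ˡ rename ρ u
renameʷ ρ (W [← u ])  = let _ , W′ = renameʷ (ext ρ) W in _ , W′ [← rename ρ u ]
renameʷ ρ (u [← W ]ʳ) = let _ , W′ = renameʷ ρ W in _ , rename (ext ρ) u [← W′ ]ʳ

data Shallow : ℕ → ℕ → Set where
  □     : ∀ {n} → Shallow n n
  _·ˡ_  : ∀ {n m} → Shallow n m → Term shared n → Shallow n m
  _·ʳ_  : ∀ {n m} → Term shared n → Shallow n m → Shallow n m
  _[←_] : ∀ {n m} → Shallow (suc n) m → Term shared n → Shallow n m

_∘ˢ_ : ∀ {n m l} → Shallow n m → Shallow m l → Shallow n l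
□          ∘ˢ T = T
(S ·ˡ u)   ∘ˢ T = (S ∘ˢ T) ·ˡ u
(u ·ʳ S)   ∘ˢ T = u ·ʳ (S ∘ˢ T)
(S [← u ]) ∘ˢ T = (S ∘ˢ T) [← u ]

substˢ : ∀ {n m n′} → (Fin n → Term shared n′) → Shallow n m → ∃ (Shallow n′)
substˢ σ □          = _ , □
substˢ σ (S ·ˡ u)   = let _ , S′ = substˢ σ S in _ , S′ ·ˡ subst σ u
substˢ σ (u ·ʳ S)   = let _ , S′ = substˢ σ S in _ , subst σ u ·ʳ S′
substˢ σ (S [← u ]) = let _ , S′ = substˢ (exts σ) S in _ , S′ [← subst σ u ]

data Substitution : ℕ → ℕ → Set where
  □     : ∀ {n} → Substitution n n
  _[←_] : ∀ {n m} → Substitution (suc n) m → Term shared n → Substitution n m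

data Identity : ℕ → ℕ → Set where
  □        : ∀ {n} → Identity n n
  _⟨x⟩[←_] : ∀ {n m l} → Identity (suc n) m → Identity n l → Identity n l
  _[←_]    : ∀ {n m} → Identity (suc n) m → Term shared n → Identity n m

data Chain : ℕ → ℕ → Set where
  _⟨x⟩[←_]ˢ : ∀ {n m l} → Shallow (suc n) m → Identity n l → Chain n l
  _⟨x⟩[←_]  : ∀ {n m l} → Chain (suc n) m → Identity n l → Chain n l
  _∘ᶜ_      : ∀ {n m l} → Shallow n m → Chain m l → Chain n l

⌊_⌋ : ∀ {n m} → Shallow n m → Weak n m
⌊ □ ⌋        = □
⌊ S ·ˡ t ⌋   = ⌊ S ⌋ ·ˡ t
⌊ t ·ʳ S ⌋   = t ·ʳ ⌊ S ⌋
⌊ S [← t ] ⌋ = ⌊ S ⌋ [← t ]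

shallow : ∀ {n m} → Substitution n m → Shallow n m
shallow □          = □
shallow (L [← t ]) = shallow L [← t ]

⌊_⌋ˡ : ∀ {n m} → Substitution n m → Weak n m
⌊ L ⌋ˡ = ⌊ shallow L ⌋

-- W⟨x⟩, where x is the variable that an explicit substitution placed around
-- W binds.
_⟨x⟩ : ∀ {n m} → Weak (suc n) m → Term shared (suc n)
W ⟨x⟩ = W ⟨ var (inside W zero) ⟩

⌊_⌋ⁱ : ∀ {n m} → Identity n m → Weak n m
⌊ □ ⌋ⁱ             = □
⌊ I ⟨x⟩[← I′ ] ⌋ⁱ  = ⌊ I ⌋ⁱ ⟨x⟩ [← ⌊ I′ ⌋ⁱ ]ʳ
⌊ I [← t ] ⌋ⁱ      = ⌊ I ⌋ⁱ [← t ]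

⌊_⌋ᶜ : ∀ {n m} → Chain n m → Weak n m
⌊ S ⟨x⟩[← I ]ˢ ⌋ᶜ = ⌊ S ⌋ ⟨x⟩ [← ⌊ I ⌋ⁱ ]ʳ
⌊ C ⟨x⟩[← I ] ⌋ᶜ  = ⌊ C ⌋ᶜ ⟨x⟩ [← ⌊ I ⌋ⁱ ]ʳ
⌊ S ∘ᶜ C ⌋ᶜ       = ⌊ S ⌋ ∘ʷ ⌊ C ⌋ᶜ

start : ∀ {n m} → Chain n m → Fin m → ∃ (Shallow n)
start (S ⟨x⟩[← I ]ˢ) x = _ , S [← ⌊ I ⌋ⁱ ⟨ var x ⟩ ]
start (C ⟨x⟩[← I ])  x =
  let _ , S = start C (inside ⌊ C ⌋ᶜ zero) in _ , S [← ⌊ I ⌋ⁱ ⟨ var x ⟩ ]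
start (S ∘ᶜ C)       x = let _ , T = start C x in _ , S ∘ˢ T

------------------------------------------------------------------------
-- Structural equivalence

swap : ∀ {n} → Fin (suc (suc n)) → Fin (suc (suc n))
swap zero          = suc zero
swap (suc zero)    = zero
swap (suc (suc i)) = suc (suc i)

-- The freshness conditions are expressed by renamings.
data _⋈_ {n} : Rel (Term shared n) 0ℓ where
  com  : ∀ {t u w} →
        t [← rename suc u ] [← w ] ⋈ rename swap t [← rename suc w ] [← u ]
  ·r   : ∀ {t w u} → (rename suc t · w) [← u ] ⋈ t · (w [← u ])
  ·l   : ∀ {t w u} → (t · rename suc w) [← u ] ⋈ (t [← u ]) · w
  nest : ∀ {t u w} → rename (ext suc) t [← u ] [← w ] ⋈ t [← u [← w ] ]

data _⋈ʷ_ {n} : Rel (Term shared n) 0ℓ where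
  ctx : ∀ {m} (W : Weak n m) {t u} → t ⋈ u → W ⟨ t ⟩ ⋈ʷ W ⟨ u ⟩

_≅_ : ∀ {n} → Rel (Term shared n) 0ℓ
_≅_ = EqClosure _⋈ʷ_

------------------------------------------------------------------------
-- Useful contexts

data Evaluable : ∀ {n m} → Shallow n m → Set where
  □     : ∀ {n} → Evaluable (□ {n})
  _·ˡ_  : ∀ {n m} {S : Shallow n m} {t} →
          Evaluable S → Fireball (t ↓) → Evaluable (S ·ˡ t)
  ·ʳ_   : ∀ {n m} {S : Shallow n m} {t} → Evaluable S → Evaluable (t ·ʳ S)
  _[←_] : ∀ {n m} {S : Shallow (suc n) m} {t} →
          Evaluable (proj₂ (substˢ (zero↦ (embed (t ↓))) S)) →
          Fireball (t ↓) → Evaluable (S [← t ])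

Applicative : ∀ {n m} → Shallow n m → Set
Applicative {n} {m} S =
  ∃[ l ] Σ (Shallow n l) λ S′ → Σ (Substitution l m) λ L → Σ (Term shared l) λ u →
  S ≡ S′ ∘ˢ (shallow L ·ˡ u)

Useful : ∀ {n m} → Shallow n m → Set
Useful S = Evaluable S × Applicative S

------------------------------------------------------------------------
-- The Unchaining Fireball Calculus

-- Given W⟨x⟩[x←L⟨v⟩], the term W⟨v⟩[x←v] lying under L: W is moved into the
-- scope of L, and v into the scope of the hole of W.
replace : ∀ {n m l} → Weak (suc n) m → Substitution n l → Term shared l → Term shared l
replace W L v =
  let _ , W′ = renameʷ (ext (inside ⌊ L ⌋ˡ)) W
  in (W′ ⟨ rename (inside W′ ∘ suc) v ⟩) [← v ]

data _⊸of_ {n} : Rel (Term shared n) 0ℓ where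
  om  : ∀ {m l} (S : Shallow n m) (L : Substitution m l) {t u} →
        Useful (S ∘ˢ (□ ·ˡ u)) →
        ⌊ S ⌋ ⟨ (⌊ L ⌋ˡ ⟨ ƛ t ⟩) · u ⟩
          ⊸of ⌊ S ⌋ ⟨ ⌊ L ⌋ˡ ⟨ t [← rename (inside ⌊ L ⌋ˡ) u ] ⟩ ⟩
  oes : ∀ {m k l} (S : Shallow n m) (S′ : Shallow (suc m) k) (L : Substitution m l) {t} →
        let v = ƛ t in
        Useful (S ∘ˢ (S′ [← ⌊ L ⌋ˡ ⟨ v ⟩ ])) →
        ⌊ S ⌋ ⟨ ⌊ S′ ⌋ ⟨x⟩ [← ⌊ L ⌋ˡ ⟨ v ⟩ ] ⟩
          ⊸of ⌊ S ⌋ ⟨ ⌊ L ⌋ˡ ⟨ replace ⌊ S′ ⌋ L v ⟩ ⟩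
  oec : ∀ {m k l} (S : Shallow n m) (C : Chain (suc m) k) (L : Substitution m l) {t} →
        let v = ƛ t in
        Useful (S ∘ˢ (proj₂ (start C (inside ⌊ C ⌋ᶜ zero)) [← ⌊ L ⌋ˡ ⟨ v ⟩ ])) →
        ⌊ S ⌋ ⟨ ⌊ C ⌋ᶜ ⟨x⟩ [← ⌊ L ⌋ˡ ⟨ v ⟩ ] ⟩
          ⊸of ⌊ S ⌋ ⟨ ⌊ L ⌋ˡ ⟨ replace ⌊ C ⌋ᶜ L v ⟩ ⟩

------------------------------------------------------------------------
-- Random access machines

-- The uniform-cost machine of Cook and Reckhow, except that directly addressed
-- registers and indirectly addressed memory are kept apart (so that the input
-- may lie anywhere in memory) and that subtraction is truncated.

data Instruction : Set where
  const     : (r c : ℕ) → Instruction      -- r ≔ c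
  add sub   : (r s t : ℕ) → Instruction    -- r ≔ s ± t
  load      : (r s : ℕ) → Instruction      -- r ≔ mem[s]
  store     : (r s : ℕ) → Instruction      -- mem[r] ≔ s
  jump-zero : (r l : ℕ) → Instruction      -- if r = 0 go to l

Program : Set
Program = List Instruction

record State : Set where
  constructor ⟪_,_,_⟫
  field
    pc  : ℕ
    reg : ℕ → ℕ
    mem : ℕ → ℕ

_[_≔_] : (ℕ → ℕ) → ℕ → ℕ → (ℕ → ℕ)
(f [ i ≔ x ]) j = if i ≡ᵇ j then x else f j

execute : Instruction → State → State
execute (const r c)     ⟪ pc , R , M ⟫ = ⟪ suc pc , R [ r ≔ c ] , M ⟫
execute (add r s t)     ⟪ pc , R , M ⟫ = ⟪ suc pc , R [ r ≔ R s + R t ] , M ⟫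
execute (sub r s t)     ⟪ pc , R , M ⟫ = ⟪ suc pc , R [ r ≔ R s ∸ R t ] , M ⟫
execute (load r s)      ⟪ pc , R , M ⟫ = ⟪ suc pc , R [ r ≔ M (R s) ] , M ⟫
execute (store r s)     ⟪ pc , R , M ⟫ = ⟪ suc pc , R , M [ R r ≔ R s ] ⟫
execute (jump-zero r l) ⟪ pc , R , M ⟫ = ⟪ (if R r ≡ᵇ 0 then l else suc pc) , R , M ⟫

fetch : Program → State → Maybe Instruction
fetch P s = head (drop (State.pc s) P)

-- The machine halts when the program counter leaves the program.
data _⊢_⇓⟨_⟩_ (P : Program) : State → ℕ → State → Set where
  halt : ∀ {s} → fetch P s ≡ nothing → P ⊢ s ⇓⟨ 0 ⟩ s
  step : ∀ {s i k s′} → fetch P s ≡ just i → P ⊢ execute i s ⇓⟨ k ⟩ s′ →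
         P ⊢ s ⇓⟨ suc k ⟩ s′

-- Linked representation of terms.  A node consists of three consecutive cells:
-- a tag followed by pointers to the immediate subterms (or, for a symbol, its
-- index), the remaining cells having arbitrary contents.  A variable points to
-- its binder, that is, to the node of an abstraction or explicit substitution.
-- In `Rep M ρ p t A`, p is the root of t, ρ lists the binders in scope, and
-- A lists the cells occupied by t.

node : ℕ → List ℕ
node p = p ∷ 1 + p ∷ 2 + p ∷ []

data Rep (M : ℕ → ℕ) : ∀ {k n} → Vec ℕ n → ℕ → Term k n → List ℕ → Set where
  var   : ∀ {k n} {ρ : Vec ℕ n} {p i} →
          M p ≡ 0 → M (1 + p) ≡ lookup ρ i → Rep M ρ p (var {k} i) (node p)
  con   : ∀ {k n} {ρ : Vec ℕ n} {p a} →
          M p ≡ 1 → M (1 + p) ≡ a → Rep M ρ p (con {k} a) (node p)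
  ƛ_    : ∀ {k n} {ρ : Vec ℕ n} {p} {t : Term k (suc n)} {A} →
          M p ≡ 2 → Rep M (p ∷ ρ) (M (1 + p)) t A →
          Rep M ρ p (ƛ t) (node p ++ A)
  _·_   : ∀ {k n} {ρ : Vec ℕ n} {p} {t u : Term k n} {A B} →
          M p ≡ 3 → Rep M ρ (M (1 + p)) t A → Rep M ρ (M (2 + p)) u B →
          Rep M ρ p (t · u) (node p ++ A ++ B)
  _[←_] : ∀ {n} {ρ : Vec ℕ n} {p t u A B} →
          M p ≡ 4 → Rep M (p ∷ ρ) (M (1 + p)) t A → Rep M ρ (M (2 + p)) u B →
          Rep M ρ p (t [← u ]) (node p ++ A ++ B)

-- Uniqueness of the cells excludes sharing other than by explicit
-- substitutions.
Represents : ∀ {k} → (ℕ → ℕ) → ℕ → Term k 0 → List ℕ → Set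
Represents M p t A = Rep M [] p t A × Unique A

-- The input of the machine: the root of the initial term, the length of the
-- derivation and the beginning of the free memory.
registers : ℕ → ℕ → ℕ → (ℕ → ℕ)
registers root len free 0 = root
registers root len free 1 = len
registers root len free 2 = free
registers root len free _ = 0

Input : Term plain 0 → ℕ → State → Set
Input t len s =
  ∃[ root ] ∃[ free ] ∃[ M ] ∃[ A ]
  s ≡ ⟪ 0 , registers root len free , M ⟫ ×
  Represents M root t A × All (_< free) A × (∀ p → free ≤ p → M p ≡ 0)

Output : State → Term shared 0 → Set
Output ⟪ _ , R , M ⟫ w = ∃[ A ] Represents M (R 0) w A

------------------------------------------------------------------------
-- Implementability of derivations

length : ∀ {X : Set} {_⟶_ : Rel X 0ℓ} {x y} → Star _⟶_ x y → ℕ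
length ε       = 0
length (_ ◅ d) = suc (length d)

-- `Implementable initial _⟶_ _∼_ g`: the derivations of _⟶_ from initial
-- terms are implementable in O(g(|t|, |d|)) steps, an output w being correct
-- for a derivation with target u when w ∼ u.
Implementable : {X : Set} (initial : Term plain 0 → X) (_⟶_ : Rel X 0ℓ)
                (_∼_ : Term shared 0 → X → Set) (g : ℕ → ℕ → ℕ) → Set
Implementable initial _⟶_ _∼_ g =
  Σ Program λ P → Σ ℕ λ c →
  ∀ t u (d : Star _⟶_ (initial t) u) s → Input t (length d) s →
  ∃[ k ] ∃[ s′ ] ∃[ w ]
  P ⊢ s ⇓⟨ k ⟩ s′ × k ≤ c * g ∣ t ∣ (length d) × Output s′ w × w ∼ u

{-# OPTIONS --safe #-}
{-
Structural equivalence floats all explicit substitutions to the top.  Both calculi are therefore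
simulated on flat states: a plain term in a telescope of substitutions with plain contents.  On
flat states evaluation goes from right to left and contracts either (λt)f, which moves f into the
telescope, or x f for a variable x that a chain of substitutions leads to a value, in which case
the last variable of the chain is replaced by a copy of the value.  The redex of a closed state is
unique, so every step of either calculus forces the step of the flat state.

The machine runs a stack of tasks.  The node of an abstraction becomes the node of the
substitution that its contraction creates, so that no variable is renamed.  Substitution nodes
record whether their content unfolds to a value, so that only those chains are followed whose
variables are going to be replaced.  The content of a substitution is replaced at most once, and a
replacement in head position is followed by a contraction; the number of copies is thus linear in
the number of contractions.  A copied value comes from a subterm of the initial term t, so a copy
costs O(|t|), as does the evaluation of the body of a contracted abstraction.

A flat state determines a term with explicit substitutions up to structural equivalence, because
substitutions with independent contents commute; it determines the unfolding by composition.
-}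

module Submission where

open import Defs
open import Data.Nat.Base using (_+_; _*_)
open import Data.Product.Base using (_×_)
open import Function.Base using (id)
open import Relation.Binary.PropositionalEquality.Core using (_≡_)
import Algebra.Solver.CommutativeMonoid as CommutativeMonoidSolver
open import Data.Bool.Base using (Bool; true; false; if_then_else_; T; _∧_)
open import Data.Bool.Properties using (T-∧)
open import Data.Empty using (⊥; ⊥-elim)
open import Data.Fin.Base using (Fin; zero; suc)
open import Data.Fin.Properties using () renaming (suc-injective to sucᶠ-injective)
open import Data.List.Base using (List; []; _∷_; _++_; map)
open import Data.List.Properties using (++-assoc; ++-identityʳ; map-++)
open import Data.List.Relation.Binary.Permutation.Propositional as Perm
  using (_↭_; ↭-refl; ↭-sym; ↭-trans; ↭-reflexive; prep)
open import Data.List.Relation.Binary.Permutation.Propositional.Properties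
  using (++-commutativeMonoid; ++-comm; ++⁺ʳ; ++⁺ˡ; All-resp-↭) renaming (++⁺ to ↭-++)
open import Data.List.Relation.Unary.All using (All; []; _∷_)
open import Data.List.Relation.Unary.All.Properties using (++⁺; ++⁻ˡ; ++⁻ʳ)
open import Data.List.Relation.Unary.AllPairs using ([]; _∷_)
open import Data.List.Relation.Unary.Unique.Propositional using (Unique)
open import Data.Maybe.Base using (Maybe; just; nothing)
open import Data.Nat.Base hiding (less; equal; greater)
open import Data.Nat.Properties
open import Data.Nat.Solver using (module +-*-Solver)
open import Data.Product.Base using (Σ; ∃; ∃-syntax; _,_; proj₁; proj₂)
open import Data.Sum.Base using (_⊎_; inj₁; inj₂)
open import Data.Unit.Base using (⊤; tt)
open import Data.Vec.Base using (Vec; []; _∷_; lookup)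
open import Function.Base using (_∘_; _$_)
open import Function.Bundles using (Equivalence)
import Relation.Binary.Construct.Closure.Equivalence as Eq
open import Relation.Binary.Construct.Closure.ReflexiveTransitive using (Star; ε; _◅_)
open import Relation.Binary.PropositionalEquality.Core
  using (_≢_; _≗_; refl; sym; trans; cong; cong₂; subst₂) renaming (subst to transport)
open import Relation.Nullary using (yes; no)

-- Substitution

-- One program serves both calculi: only `charge` differs, the amount that a replacement takes from
-- the budget. It is 1 where replacements are steps and 0 where they are invisible. `Invariant`
-- collects what a calculus must provide, so the machine is verified once.
--
-- Two obstacles shape the machine part. Aliasing: data structures are separated by adding the
-- multiplicities of their cells and bounding the sum pointwise by the indicator of the memory in
-- use; disjointness, absence of repetitions and freshness become inequalities between sums. Early
-- stops: the budget may run out in the middle of a chain, so statements about the machine say that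
-- it halts correctly from here on, and a procedure takes its continuation as a hypothesis.
--
-- The time bound is a potential. It prepays the substitutions whose content is still a variable and
-- the contractions left in the budget, and also serves as termination measure of the evaluation.
--
-- On the side of the calculi, no rule acts under an abstraction, so the bodies of abstractions stay
-- free of explicit substitutions and flattening never enters them.

ext-cong : ∀ {n m} {ρ ρ′ : Fin n → Fin m} → ρ ≗ ρ′ → ext ρ ≗ ext ρ′
ext-cong e zero    = refl
ext-cong e (suc i) = cong suc (e i)

rename-cong : ∀ {k n m} {ρ ρ′ : Fin n → Fin m} → ρ ≗ ρ′ → (t : Term k n) → rename ρ t ≡ rename ρ′ t
rename-cong e (var i)    = cong var (e i)
rename-cong e (con a)    = refl
rename-cong e (ƛ t)      = cong ƛ_ (rename-cong (ext-cong e) t)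
rename-cong e (t · u)    = cong₂ _·_ (rename-cong e t) (rename-cong e u)
rename-cong e (t [← u ]) = cong₂ _[←_] (rename-cong (ext-cong e) t) (rename-cong e u)

exts-cong : ∀ {k n m} {σ σ′ : Fin n → Term k m} → σ ≗ σ′ → exts σ ≗ exts σ′
exts-cong e zero    = refl
exts-cong e (suc i) = cong (rename suc) (e i)

subst-cong : ∀ {k n m} {σ σ′ : Fin n → Term k m} → σ ≗ σ′ → (t : Term k n) → subst σ t ≡ subst σ′ t
subst-cong e (var i)    = e i
subst-cong e (con a)    = refl
subst-cong e (ƛ t)      = cong ƛ_ (subst-cong (exts-cong e) t)
subst-cong e (t · u)    = cong₂ _·_ (subst-cong e t) (subst-cong e u)
subst-cong e (t [← u ]) = cong₂ _[←_] (subst-cong (exts-cong e) t) (subst-cong e u)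

ext-∘ : ∀ {n m l} (ρ′ : Fin m → Fin l) (ρ : Fin n → Fin m) → ext ρ′ ∘ ext ρ ≗ ext (ρ′ ∘ ρ)
ext-∘ ρ′ ρ zero    = refl
ext-∘ ρ′ ρ (suc i) = refl

rename-rename : ∀ {k n m l} (ρ′ : Fin m → Fin l) (ρ : Fin n → Fin m) (t : Term k n) →
                rename ρ′ (rename ρ t) ≡ rename (ρ′ ∘ ρ) t
rename-rename ρ′ ρ (var i)    = refl
rename-rename ρ′ ρ (con a)    = refl
rename-rename ρ′ ρ (ƛ t)      =
  cong ƛ_ (trans (rename-rename (ext ρ′) (ext ρ) t) (rename-cong (ext-∘ ρ′ ρ) t))
rename-rename ρ′ ρ (t · u)    = cong₂ _·_ (rename-rename ρ′ ρ t) (rename-rename ρ′ ρ u)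
rename-rename ρ′ ρ (t [← u ]) =
  cong₂ _[←_] (trans (rename-rename (ext ρ′) (ext ρ) t) (rename-cong (ext-∘ ρ′ ρ) t))
              (rename-rename ρ′ ρ u)

ext-id : ∀ {n} → ext {n} id ≗ id
ext-id zero    = refl
ext-id (suc i) = refl

rename-id : ∀ {k n} (t : Term k n) → rename id t ≡ t
rename-id (var i)    = refl
rename-id (con a)    = refl
rename-id (ƛ t)      = cong ƛ_ (trans (rename-cong ext-id t) (rename-id t))
rename-id (t · u)    = cong₂ _·_ (rename-id t) (rename-id u)
rename-id (t [← u ]) = cong₂ _[←_] (trans (rename-cong ext-id t) (rename-id t)) (rename-id u)

rename-suc-comm : ∀ {k n m} (ρ : Fin n → Fin m) (t : Term k n) →
                  rename (ext ρ) (rename suc t) ≡ rename suc (rename ρ t)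
rename-suc-comm ρ t = trans (rename-rename (ext ρ) suc t) (sym (rename-rename suc ρ t))

exts-ext : ∀ {k n m l} (σ : Fin m → Term k l) (ρ : Fin n → Fin m) → exts σ ∘ ext ρ ≗ exts (σ ∘ ρ)
exts-ext σ ρ zero    = refl
exts-ext σ ρ (suc i) = refl

subst-rename : ∀ {k n m l} (σ : Fin m → Term k l) (ρ : Fin n → Fin m) (t : Term k n) →
               subst σ (rename ρ t) ≡ subst (σ ∘ ρ) t
subst-rename σ ρ (var i)    = refl
subst-rename σ ρ (con a)    = refl
subst-rename σ ρ (ƛ t)      =
  cong ƛ_ (trans (subst-rename (exts σ) (ext ρ) t) (subst-cong (exts-ext σ ρ) t))
subst-rename σ ρ (t · u)    = cong₂ _·_ (subst-rename σ ρ t) (subst-rename σ ρ u)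
subst-rename σ ρ (t [← u ]) =
  cong₂ _[←_] (trans (subst-rename (exts σ) (ext ρ) t) (subst-cong (exts-ext σ ρ) t))
              (subst-rename σ ρ u)

ext-exts : ∀ {k n m l} (ρ : Fin m → Fin l) (σ : Fin n → Term k m) →
           rename (ext ρ) ∘ exts σ ≗ exts (rename ρ ∘ σ)
ext-exts ρ σ zero    = refl
ext-exts ρ σ (suc i) = rename-suc-comm ρ (σ i)

rename-subst : ∀ {k n m l} (ρ : Fin m → Fin l) (σ : Fin n → Term k m) (t : Term k n) →
               rename ρ (subst σ t) ≡ subst (rename ρ ∘ σ) t
rename-subst ρ σ (var i)    = refl
rename-subst ρ σ (con a)    = refl
rename-subst ρ σ (ƛ t)      =
  cong ƛ_ (trans (rename-subst (ext ρ) (exts σ) t) (subst-cong (ext-exts ρ σ) t))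
rename-subst ρ σ (t · u)    = cong₂ _·_ (rename-subst ρ σ t) (rename-subst ρ σ u)
rename-subst ρ σ (t [← u ]) =
  cong₂ _[←_] (trans (rename-subst (ext ρ) (exts σ) t) (subst-cong (ext-exts ρ σ) t))
              (rename-subst ρ σ u)

exts-exts : ∀ {k n m l} (τ : Fin m → Term k l) (σ : Fin n → Term k m) →
            subst (exts τ) ∘ exts σ ≗ exts (subst τ ∘ σ)
exts-exts τ σ zero    = refl
exts-exts τ σ (suc i) = trans (subst-rename (exts τ) suc (σ i)) (sym (rename-subst suc τ (σ i)))

subst-subst : ∀ {k n m l} (τ : Fin m → Term k l) (σ : Fin n → Term k m) (t : Term k n) →
              subst τ (subst σ t) ≡ subst (subst τ ∘ σ) t
subst-subst τ σ (var i)    = refl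
subst-subst τ σ (con a)    = refl
subst-subst τ σ (ƛ t)      =
  cong ƛ_ (trans (subst-subst (exts τ) (exts σ) t) (subst-cong (exts-exts τ σ) t))
subst-subst τ σ (t · u)    = cong₂ _·_ (subst-subst τ σ t) (subst-subst τ σ u)
subst-subst τ σ (t [← u ]) =
  cong₂ _[←_] (trans (subst-subst (exts τ) (exts σ) t) (subst-cong (exts-exts τ σ) t))
              (subst-subst τ σ u)

exts-var : ∀ {k n} → exts {k} {n} var ≗ var
exts-var zero    = refl
exts-var (suc i) = refl

subst-var : ∀ {k n} (t : Term k n) → subst var t ≡ t
subst-var (var i)    = refl
subst-var (con a)    = refl
subst-var (ƛ t)      = cong ƛ_ (trans (subst-cong exts-var t) (subst-var t))
subst-var (t · u)    = cong₂ _·_ (subst-var t) (subst-var u)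
subst-var (t [← u ]) = cong₂ _[←_] (trans (subst-cong exts-var t) (subst-var t)) (subst-var u)

infixr 5 _◂_
_◂_ : ∀ {A : Set} {n} → A → (Fin n → A) → Fin (suc n) → A
(x ◂ f) zero    = x
(x ◂ f) (suc i) = f i

-- Instantiating the variable zero after `σ`, here, and before `σ`, in the next lemma, both lead to
-- the parallel substitution `subst σ u ◂ σ`, through which they are compared.
subst-zero↦ : ∀ {k n m} (σ : Fin n → Term k m) (t : Term k (suc n)) (u : Term k n) →
              subst (zero↦ (subst σ u)) (subst (exts σ) t) ≡ subst (subst σ u ◂ σ) t
subst-zero↦ σ t u = trans (subst-subst _ _ t) (subst-cong lem t)
  where
  lem : subst (zero↦ (subst σ u)) ∘ exts σ ≗ (subst σ u ◂ σ)
  lem zero    = refl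
  lem (suc i) = trans (subst-rename _ suc (σ i)) (subst-var (σ i))

subst-∘-zero↦ : ∀ {k n m} (σ : Fin n → Term k m) (t : Term k (suc n)) (u : Term k n) →
                subst σ (subst (zero↦ u) t) ≡ subst (subst σ u ◂ σ) t
subst-∘-zero↦ σ t u = trans (subst-subst _ _ t) (subst-cong lem t)
  where
  lem : subst σ ∘ zero↦ u ≗ (subst σ u ◂ σ)
  lem zero    = refl
  lem (suc i) = refl

rename-↓ : ∀ {k n m} (ρ : Fin n → Fin m) (t : Term k n) → rename ρ t ↓ ≡ rename ρ (t ↓)
rename-↓ ρ (var i)    = refl
rename-↓ ρ (con a)    = refl
rename-↓ ρ (ƛ t)      = cong ƛ_ (rename-↓ (ext ρ) t)
rename-↓ ρ (t · u)    = cong₂ _·_ (rename-↓ ρ t) (rename-↓ ρ u)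
rename-↓ ρ (t [← u ]) rewrite rename-↓ (ext ρ) t | rename-↓ ρ u =
  trans (subst-rename _ (ext ρ) (t ↓))
        (trans (subst-cong lem (t ↓)) (sym (rename-subst ρ _ (t ↓))))
  where
  lem : zero↦ (rename ρ (u ↓)) ∘ ext ρ ≗ rename ρ ∘ zero↦ (u ↓)
  lem zero    = refl
  lem (suc i) = refl

subst-↓ : ∀ {k n m} (σ : Fin n → Term k m) (t : Term k n) → subst σ t ↓ ≡ subst (_↓ ∘ σ) (t ↓)
exts-↓ : ∀ {k n m} (σ : Fin n → Term k m) → _↓ ∘ exts σ ≗ exts (_↓ ∘ σ)
exts-↓ σ zero    = refl
exts-↓ σ (suc i) = rename-↓ suc (σ i)
subst-↓ σ (var i)    = refl
subst-↓ σ (con a)    = refl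
subst-↓ σ (ƛ t)      = cong ƛ_ (trans (subst-↓ (exts σ) t) (subst-cong (exts-↓ σ) (t ↓)))
subst-↓ σ (t · u)    = cong₂ _·_ (subst-↓ σ t) (subst-↓ σ u)
subst-↓ σ (t [← u ]) rewrite subst-↓ (exts σ) t | subst-↓ σ u | subst-cong (exts-↓ σ) (t ↓) =
  trans (subst-zero↦ (_↓ ∘ σ) (t ↓) (u ↓)) (sym (subst-∘-zero↦ (_↓ ∘ σ) (t ↓) (u ↓)))

embed-↓ : ∀ {n} (t : Term plain n) → embed t ↓ ≡ t
embed-↓ (var i) = refl
embed-↓ (con a) = refl
embed-↓ (ƛ t)   = cong ƛ_ (embed-↓ t)
embed-↓ (t · u) = cong₂ _·_ (embed-↓ t) (embed-↓ u)

rename-embed : ∀ {n m} (ρ : Fin n → Fin m) (t : Term plain n) → rename ρ (embed t) ≡ embed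
    (rename ρ t)
rename-embed ρ (var i) = refl
rename-embed ρ (con a) = refl
rename-embed ρ (ƛ t)   = cong ƛ_ (rename-embed (ext ρ) t)
rename-embed ρ (t · u) = cong₂ _·_ (rename-embed ρ t) (rename-embed ρ u)

-- Flat states: a plain term in a telescope of explicit substitutions with plain contents

infixl 5 _▷_
data Env : ℕ → Set where
  []  : Env 0
  _▷_ : ∀ {n} → Env n → Term plain n → Env (suc n)

unfold : ∀ {n} → Env n → Fin n → Term plain 0
unfold (E ▷ c) = subst (unfold E) c ◂ unfold E

-- The newest binding is the innermost substitution. A contraction thus only appends to the
-- telescope, and contents refer to older bindings, which makes the recursion along chains
-- structural.
wrap : ∀ {n} → Env n → Term shared n → Term shared 0
wrap []      b = b
wrap (E ▷ c) b = wrap E (b [← embed c ])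

wrap-↓ : ∀ {n} (E : Env n) (b : Term shared n) → wrap E b ↓ ≡ subst (unfold E) (b ↓)
wrap-↓ []      b = sym (trans (subst-cong (λ ()) (b ↓)) (subst-var (b ↓)))
wrap-↓ (E ▷ c) b = trans (wrap-↓ E (b [← embed c ]))
  (trans (cong (λ d → subst (unfold E) (subst (zero↦ d) (b ↓))) (embed-↓ c))
         (subst-∘-zero↦ (unfold E) (b ↓) c))

-- Contents are weakened to the scope of the whole telescope, so that bindings can be compared
-- without regard to their position in it.
entry : ∀ {n} → Env n → Fin n → Term plain n
entry (E ▷ c) zero    = rename suc c
entry (E ▷ c) (suc i) = rename suc (entry E i)

subst-▷ : ∀ {n} (E : Env n) (c : Term plain n) (t : Term plain n) →
          subst (unfold (E ▷ c)) (rename suc t) ≡ subst (unfold E) t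
subst-▷ E c t = subst-rename _ suc t

unfold-entry : ∀ {n} (E : Env n) (i : Fin n) → unfold E i ≡ subst (unfold E) (entry E i)
unfold-entry (E ▷ c) zero    = sym (subst-▷ E c c)
unfold-entry (E ▷ c) (suc i) = trans (unfold-entry E i) (sym (subst-▷ E c (entry E i)))

-- The effect of one substitution step on the chain that starts at a variable: `head v` when the
-- variable is bound to the value v, and otherwise `env E′`, where the last variable of the
-- chain has been replaced.
data Hop (n : ℕ) : Set where
  head  : Term plain (suc n) → Hop n
  env   : Env n → Hop n
  stuck : Hop n

weaken : ∀ {n} → Term plain n → Hop n → Hop (suc n)
weaken c (head v) = head (rename (ext suc) v)
weaken c (env E)  = env (E ▷ c)
weaken c stuck    = stuck

hop : ∀ {n} → Env n → Fin n → Hop n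
hop (E ▷ c)       (suc i) = weaken c (hop E i)
hop (E ▷ (ƛ v))   zero    = head (rename (ext suc) v)
hop (E ▷ con _)   zero    = stuck
hop (E ▷ (_ · _)) zero    = stuck
hop (E ▷ var y)   zero with hop E y
... | head v = env (E ▷ (ƛ v))
... | env E′ = env (E′ ▷ var y)
... | stuck  = stuck

hop-head : ∀ {n} (E : Env n) x {v} → hop E x ≡ head v → entry E x ≡ ƛ v
hop-head (E ▷ c) (suc i) eq with hop E i in eq′
hop-head (E ▷ c) (suc i) refl | head v = cong (rename suc) (hop-head E i eq′)
hop-head (E ▷ (ƛ v)) zero refl = refl
hop-head (E ▷ var y) zero eq with hop E y
hop-head (E ▷ var y) zero () | head _
hop-head (E ▷ var y) zero () | env _
hop-head (E ▷ var y) zero () | stuck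

◂-cong : ∀ {A : Set} {n} {x x′ : A} {f f′ : Fin n → A} → x ≡ x′ → f ≗ f′ → (x ◂ f) ≗ (x′ ◂ f′)
◂-cong p q zero    = p
◂-cong p q (suc i) = q i

unfold-head : ∀ {n} (E : Env n) x {v} → hop E x ≡ head v → unfold E x ≡ subst (unfold E) (ƛ v)
unfold-head E x eq = trans (unfold-entry E x) (cong (subst (unfold E)) (hop-head E x eq))

-- A variable is replaced by the value that it is bound to, which has the same unfolding. Evaluated
-- frames and the flags of substitutions therefore survive a replacement.
unfold-env : ∀ {n} (E : Env n) x {E′} → hop E x ≡ env E′ → unfold E′ ≗ unfold E
unfold-env (E ▷ c) (suc i) eq with hop E i in eq′
unfold-env (E ▷ c) (suc i) refl | env E′ =
  ◂-cong (subst-cong (unfold-env E i eq′) c) (unfold-env E i eq′)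
unfold-env (E ▷ var y) zero eq with hop E y in eq′
unfold-env (E ▷ var y) zero refl | head v = ◂-cong (sym (unfold-head E y eq′)) λ _ → refl
unfold-env (E ▷ var y) zero refl | env E′ = ◂-cong (unfold-env E y eq′ y) (unfold-env E y eq′)

-- Evaluation contexts as stacks of frames, innermost frame first

data Frame (n : ℕ) : Set where
  right left : Term plain n → Frame n

Frames : ℕ → Set
Frames n = List (Frame n)

plug : ∀ {n} → Frames n → Term plain n → Term plain n
plug []            t = t
plug (right u ∷ F) t = plug F (u · t)
plug (left u ∷ F)  t = plug F (t · u)

mapᶠ : ∀ {n m} → (Term plain n → Term plain m) → Frames n → Frames m
mapᶠ g []            = []
mapᶠ g (right u ∷ F) = right (g u) ∷ mapᶠ g F
mapᶠ g (left u ∷ F)  = left (g u) ∷ mapᶠ g F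

plug-rename : ∀ {n m} (ρ : Fin n → Fin m) F t → rename ρ (plug F t) ≡ plug (mapᶠ (rename ρ) F)
    (rename ρ t)
plug-rename ρ []            t = refl
plug-rename ρ (right u ∷ F) t = plug-rename ρ F _
plug-rename ρ (left u ∷ F)  t = plug-rename ρ F _

plug-subst : ∀ {n m} (σ : Fin n → Term plain m) F t →
             subst σ (plug F t) ≡ plug (mapᶠ (subst σ) F) (subst σ t)
plug-subst σ []            t = refl
plug-subst σ (right u ∷ F) t = plug-subst σ F _
plug-subst σ (left u ∷ F)  t = plug-subst σ F _

plug-++ : ∀ {n} (F G : Frames n) t → plug (F ++ G) t ≡ plug G (plug F t)
plug-++ []            G t = refl
plug-++ (right u ∷ F) G t = plug-++ F G _
plug-++ (left u ∷ F)  G t = plug-++ F G _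

data Evald {n} (σ : Fin n → Term plain 0) : Frames n → Set where
  []    : Evald σ []
  right : ∀ {F u} → Evald σ F → Evald σ (right u ∷ F)
  left  : ∀ {F f} → Fireball (subst σ f) → Evald σ F → Evald σ (left f ∷ F)

Evald-cong : ∀ {n} {σ σ′ : Fin n → Term plain 0} {F} → σ′ ≗ σ → Evald σ F → Evald σ′ F
Evald-cong e []        = []
Evald-cong e (right p) = right (Evald-cong e p)
Evald-cong e (left {f = f} x p) rewrite sym (subst-cong e f) = left x (Evald-cong e p)

Evald-rename : ∀ {n m} {ρ : Fin n → Fin m} {σ : Fin m → Term plain 0} {F} →
               Evald (σ ∘ ρ) F → Evald σ (mapᶠ (rename ρ) F)
Evald-rename []        = []
Evald-rename (right p) = right (Evald-rename p)
Evald-rename {ρ = ρ} {σ} (left {f = f} x p) rewrite sym (subst-rename σ ρ f) = left x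
    (Evald-rename p)

isƛ : ∀ {n} → Term plain n → Bool
isƛ (ƛ _) = true
isƛ _     = false

-- The redex that right-to-left evaluation selects.
Redex : ℕ → Set
Redex n = Frames n × Term plain n

redex-at : ∀ {n} → Bool → Redex n → Maybe (Redex n)
redex-at true  r = just r
redex-at false _ = nothing

orElse : ∀ {A : Set} → Maybe A → Maybe A → Maybe A
orElse (just x) _ = just x
orElse nothing  y = y

-- Testing whether the function unfolds to an abstraction, not whether it is one, covers both kinds
-- of redex: those to be contracted and those whose head variable must first be replaced.
find : ∀ {n} → (Fin n → Term plain 0) → Term plain n → Frames n → Maybe (Redex n)
find σ (t · u) F =
  orElse (find σ u (right t ∷ F))
    (orElse (find σ t (left u ∷ F)) (redex-at (isƛ (subst σ t)) (left u ∷ F , t)))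
find σ _       F = nothing

inert-not-ƛ : ∀ {n} {t : Term plain n} → Inert t → isƛ t ≡ false
inert-not-ƛ con     = refl
inert-not-ƛ (_ · _) = refl

find-fireball : ∀ {n} (σ : Fin n → Term plain 0) t F → Fireball (subst σ t) → find σ t F ≡ nothing
find-fireball σ (var i) F _ = refl
find-fireball σ (con a) F _ = refl
find-fireball σ (ƛ t)   F _ = refl
find-fireball σ (t · u) F (inert (i · f))
  rewrite find-fireball σ u (right t ∷ F) f | find-fireball σ t (left u ∷ F) (inert i)
        | inert-not-ƛ i = refl

orElse-just : ∀ {A : Set} {x y : Maybe A} {r} → x ≡ just r → orElse x y ≡ just r
orElse-just refl = refl

orElse-nothing : ∀ {A : Set} {x y : Maybe A} → x ≡ nothing → orElse x y ≡ y
orElse-nothing refl = refl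

find-plug : ∀ {n} (σ : Fin n → Term plain 0) t F {r} → Evald σ F → find σ t F ≡ just r →
            find σ (plug F t) [] ≡ just r
find-plug σ t []            p         eq = eq
find-plug σ t (right u ∷ F) (right p) eq = find-plug σ (u · t) F p (orElse-just eq)
find-plug σ t (left u ∷ F)  (left f p) eq =
  find-plug σ (t · u) F p
    (trans (orElse-nothing (find-fireball σ u (right t ∷ F) f)) (orElse-just eq))

data Head {n} : Term plain n → Set where
  ƛ_  : ∀ t → Head (ƛ t)
  var : ∀ i → Head (var i)

find-redex : ∀ {n} (σ : Fin n → Term plain 0) {F f h} → Evald σ (left f ∷ F) → Head h →
             isƛ (subst σ h) ≡ true → find σ (plug F (h · f)) [] ≡ just (left f ∷ F , h)
find-redex σ {F} {f} {h} (left x p) hd eq = find-plug σ (h · f) F p (lem hd)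
  where
  lem : Head h → find σ (h · f) F ≡ just (left f ∷ F , h)
  lem (ƛ t) rewrite find-fireball σ f (right (ƛ t) ∷ F) x = refl
  lem (var i) rewrite find-fireball σ f (right (var i) ∷ F) x | eq = refl

-- Each of the two decompositions is what `find` returns on the plugged term, and `find` is a
-- function.
redex-unique : ∀ {n} {σ : Fin n → Term plain 0} {F f h F′ f′ h′} →
               Evald σ (left f ∷ F) → Head h → isƛ (subst σ h) ≡ true →
               Evald σ (left f′ ∷ F′) → Head h′ → isƛ (subst σ h′) ≡ true →
               plug F (h · f) ≡ plug F′ (h′ · f′) →
               _≡_ {A = Redex n} (left f ∷ F , h) (left f′ ∷ F′ , h′)
redex-unique {σ = σ} p a e p′ a′ e′ eq
  with trans (sym (find-redex σ p a e)) (trans (cong (λ t → find σ t []) eq)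
      (find-redex σ p′ a′ e′))
... | refl = refl

fireball-normal : ∀ {n} {σ : Fin n → Term plain 0} {F f h t} →
                  Evald σ (left f ∷ F) → Head h → isƛ (subst σ h) ≡ true →
                  t ≡ plug F (h · f) → Fireball (subst σ t) → ⊥
fireball-normal {σ = σ} {t = t} p a e refl fb
  with trans (sym (find-redex σ p a e)) (find-fireball σ t [] fb)
... | ()

-- Comparison of sums

infixr 6 _⊕_
data Sum : Set where
  #_  : ℕ → Sum
  _⊕_ : Sum → Sum → Sum

-- An index out of range denotes 0. Indices such as `# 9` and `# 99` below stand for the final 0 of
-- `occ (node p) a` or of a multiple like `5 * N`.
atom : List ℕ → ℕ → ℕ
atom []       i       = 0
atom (x ∷ xs) zero    = x
atom (x ∷ xs) (suc i) = atom xs i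

⟦_⟧ : Sum → List ℕ → ℕ
⟦ # i ⟧   xs = atom xs i
⟦ e ⊕ f ⟧ xs = ⟦ e ⟧ xs + ⟦ f ⟧ xs

count : ℕ → Sum → ℕ
count i (# j)   = if i ≡ᵇ j then 1 else 0
count i (e ⊕ f) = count i e + count i f

tail : ℕ → Sum → List ℕ → ℕ
tail i e []       = 0
tail i e (x ∷ xs) = count i e * x + tail (suc i) e xs

+-interchange : ∀ a b c d → (a + b) + (c + d) ≡ (a + c) + (b + d)
+-interchange a b c d rewrite +-assoc a b (c + d) | +-assoc a c (b + d)
  | sym (+-assoc b c d) | +-comm b c | +-assoc c b d = refl

tail-⊕ : ∀ i e f xs → tail i (e ⊕ f) xs ≡ tail i e xs + tail i f xs
tail-⊕ i e f []       = refl
tail-⊕ i e f (x ∷ xs) rewrite tail-⊕ (suc i) e f xs | *-distribʳ-+ x (count i e) (count i f) =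
  +-interchange (count i e * x) (count i f * x) _ _

≡ᵇ-refl : ∀ n → (n ≡ᵇ n) ≡ true
≡ᵇ-refl zero    = refl
≡ᵇ-refl (suc n) = ≡ᵇ-refl n

<⇒≢ᵇ : ∀ {i j} → i < j → (j ≡ᵇ i) ≡ false
<⇒≢ᵇ {zero}  (s≤s p) = refl
<⇒≢ᵇ {suc i} (s≤s p) = <⇒≢ᵇ p

tail-beyond : ∀ i j xs → j < i → tail i (# j) xs ≡ 0
tail-beyond i j []       p = refl
tail-beyond i j (x ∷ xs) p rewrite <⇒≢ᵇ p = tail-beyond (suc i) j xs (m≤n⇒m≤1+n p)

≢ᵇ-+ : ∀ i j → (i ≡ᵇ i + suc j) ≡ false
≢ᵇ-+ zero    j = refl
≢ᵇ-+ (suc i) j = ≢ᵇ-+ i j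

tail-# : ∀ i j xs → tail i (# (i + j)) xs ≡ atom xs j
tail-# i j       []       = refl
tail-# i zero    (x ∷ xs) rewrite +-identityʳ i | ≡ᵇ-refl i | tail-beyond (suc i) i xs ≤-refl =
  trans (+-identityʳ _) (+-identityʳ _)
tail-# i (suc j) (x ∷ xs) rewrite ≢ᵇ-+ i j = trans (cong (λ k → tail (suc i) (# k) xs) (+-suc i j))
    (tail-# (suc i) j xs)

⟦⟧-tail : ∀ e xs → ⟦ e ⟧ xs ≡ tail 0 e xs
⟦⟧-tail (# i)   xs = sym (tail-# 0 i xs)
⟦⟧-tail (e ⊕ f) xs = trans (cong₂ _+_ (⟦⟧-tail e xs) (⟦⟧-tail f xs)) (sym (tail-⊕ 0 e f xs))

dominated : ℕ → Sum → Sum → List ℕ → Bool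
dominated i e f []       = true
dominated i e f (x ∷ xs) = (count i e ≤ᵇ count i f) ∧ dominated (suc i) e f xs

tail-≤ : ∀ i e f xs → T (dominated i e f xs) → tail i e xs ≤ tail i f xs
tail-≤ i e f []       p = z≤n
tail-≤ i e f (x ∷ xs) p with Equivalence.to T-∧ p
... | q , r = +-mono-≤ (*-monoˡ-≤ x (≤ᵇ⇒≤ (count i e) (count i f) q)) (tail-≤ (suc i) e f xs r)

-- Sums are compared by counting the occurrences of their atoms.
sum≤ : ∀ xs e f {_ : T (dominated 0 e f xs)} → ⟦ e ⟧ xs ≤ ⟦ f ⟧ xs
sum≤ xs e f {p} = subst₂ _≤_ (sym (⟦⟧-tail e xs)) (sym (⟦⟧-tail f xs)) (tail-≤ 0 e f xs p)

-- Footprints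

abstract
  -- Opaque, so that it does not reduce on successors and sums of footprints keep the shape that
  -- `sum≤` compares.
  δ : ℕ → ℕ → ℕ
  δ x a = if x ≡ᵇ a then 1 else 0

  δ-refl : ∀ a → δ a a ≡ 1
  δ-refl a rewrite ≡ᵇ-refl a = refl

  δ-≢ : ∀ {a b} → a ≢ b → δ a b ≡ 0
  δ-≢ {a} {b} p with a ≡ᵇ b in eq
  ... | false = refl
  ... | true  = ⊥-elim (p (≡ᵇ⇒≡ a b (transport T (sym eq) tt)))

occ : List ℕ → ℕ → ℕ
occ []       a = 0
occ (x ∷ xs) a = δ x a + occ xs a

-- The indicator of the cells below `f`. A sum of multiplicities bounded by `ι f` at every address
-- has disjoint summands without repetitions, all of them below the free memory: addition plays the
-- role of separating conjunction.
ι : ℕ → ℕ → ℕ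
ι zero    a = 0
ι (suc f) a = δ f a + ι f a

occ-++ : ∀ xs ys a → occ (xs ++ ys) a ≡ occ xs a + occ ys a
occ-++ []       ys a = refl
occ-++ (x ∷ xs) ys a = trans (cong (δ x a +_) (occ-++ xs ys a)) (sym (+-assoc (δ x a) _ _))

ι-beyond : ∀ f a → f ≤ a → ι f a ≡ 0
ι-beyond zero    a p = refl
ι-beyond (suc f) a p rewrite δ-≢ {f} {a} (<⇒≢ p) = ι-beyond f a (≤-trans (n≤1+n f) p)

ι-below : ∀ f a → a < f → 1 ≤ ι f a
ι-below (suc f) a (s≤s p) with m≤n⇒m<n∨m≡n p
... | inj₁ q = ≤-trans (ι-below f a q) (m≤n+m _ _)
... | inj₂ refl rewrite δ-refl f = s≤s z≤n

ι≤1 : ∀ f a → ι f a ≤ 1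
ι≤1 zero    a = z≤n
ι≤1 (suc f) a with f ≟ a
... | no p    rewrite δ-≢ p = ι≤1 f a
... | yes refl rewrite δ-refl f | ι-beyond f f ≤-refl = ≤-refl

-- Memory

infix 4 _≈[_]_
_≈[_]_ : (ℕ → ℕ) → (ℕ → ℕ) → (ℕ → ℕ) → Set
M ≈[ κ ] M′ = ∀ a → 1 ≤ κ a → M′ a ≡ M a

≈-trans : ∀ {κ M M′ M″} → M ≈[ κ ] M′ → M′ ≈[ κ ] M″ → M ≈[ κ ] M″
≈-trans p q a κa = trans (q a κa) (p a κa)

≈-mono : ∀ {κ κ′ M M′} → (∀ a → κ′ a ≤ κ a) → M ≈[ κ ] M′ → M ≈[ κ′ ] M′
≈-mono p q a κa = q a (≤-trans κa (p a))

hit : ∀ M a x → (M [ a ≔ x ]) a ≡ x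
hit M a x rewrite ≡ᵇ-refl a = refl

miss : ∀ M a b x → a ≢ b → (M [ a ≔ x ]) b ≡ M b
miss M a b x p with a ≡ᵇ b in eq
... | false = refl
... | true  = ⊥-elim (p (≡ᵇ⇒≡ a b (transport T (sym eq) tt)))

1≰0 : ∀ {n} → 1 ≤ n → n ≢ 0
1≰0 (s≤s _) ()

≔-≈ : ∀ {κ} M a x → κ a ≡ 0 → M ≈[ κ ] M [ a ≔ x ]
≔-≈ M a x p b κb = miss M a b x λ { refl → 1≰0 κb p }

alloc : (ℕ → ℕ) → ℕ → ℕ → ℕ → ℕ → (ℕ → ℕ)
alloc M f x y z = ((M [ f ≔ x ]) [ 1 + f ≔ y ]) [ 2 + f ≔ z ]

alloc₀ : ∀ M f x y z → alloc M f x y z f ≡ x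
alloc₀ M f x y z =
  trans (miss ((M [ f ≔ x ]) [ 1 + f ≔ y ]) (2 + f) f z (>⇒≢ (m≤n+m _ 1)))
    (trans (miss (M [ f ≔ x ]) (1 + f) f y (>⇒≢ ≤-refl)) (hit M f x))

alloc₁ : ∀ M f x y z → alloc M f x y z (1 + f) ≡ y
alloc₁ M f x y z =
  trans (miss ((M [ f ≔ x ]) [ 1 + f ≔ y ]) (2 + f) (1 + f) z (>⇒≢ ≤-refl))
      (hit (M [ f ≔ x ]) (1 + f) y)

alloc₂ : ∀ M f x y z → alloc M f x y z (2 + f) ≡ z
alloc₂ M f x y z = hit ((M [ f ≔ x ]) [ 1 + f ≔ y ]) (2 + f) z

alloc-≈ : ∀ {κ} M f x y z → (∀ a → κ a ≤ ι f a) → M ≈[ κ ] alloc M f x y z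
alloc-≈ {κ} M f x y z p =
  ≈-trans (≔-≈ {κ} M f x (fresh f ≤-refl))
    (≈-trans (≔-≈ {κ} (M [ f ≔ x ]) (1 + f) y (fresh (1 + f) (m≤n+m f 1)))
        (≔-≈ {κ} ((M [ f ≔ x ]) [ 1 + f ≔ y ]) (2 + f) z (fresh (2 + f) (m≤n+m f 2))))
  where
  fresh : ∀ a → f ≤ a → κ a ≡ 0
  fresh a q = n≤0⇒n≡0 (≤-trans (p a) (≤-reflexive (ι-beyond f a q)))

alloc-below : ∀ M f x y z a → a < f → alloc M f x y z a ≡ M a
alloc-below M f x y z a p = alloc-≈ {ι f} M f x y z (λ _ → ≤-refl) a (ι-below f a p)

excl : ∀ {x y} → 1 ≤ x → x + y ≤ 1 → y ≡ 0
excl {suc x} {y} p (s≤s q) = n≤0⇒n≡0 (≤-trans (m≤n+m y x) q)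

δ-excl : ∀ {a y} → δ a a + y ≤ 1 → y ≡ 0
δ-excl {a} = excl (≤-reflexive (sym (δ-refl a)))

occ-⊆ʳ : ∀ xs ys a → occ ys a ≤ occ (xs ++ ys) a
occ-⊆ʳ xs ys a = ≤-trans (m≤n+m _ (occ xs a)) (≤-reflexive (sym (occ-++ xs ys a)))

occ-⊆ˡ : ∀ xs ys a → occ xs a ≤ occ (xs ++ ys) a
occ-⊆ˡ xs ys a = ≤-trans (m≤m+n _ (occ ys a)) (≤-reflexive (sym (occ-++ xs ys a)))

at₀ : ∀ p A → 1 ≤ occ (node p ++ A) p
at₀ p A rewrite δ-refl p = s≤s z≤n

at₁ : ∀ p A → 1 ≤ occ (node p ++ A) (1 + p)
at₁ p A rewrite δ-refl (1 + p) = ≤-trans (s≤s z≤n) (m≤n+m _ (δ p (1 + p)))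

at₂ : ∀ p A → 1 ≤ occ (node p ++ A) (2 + p)
at₂ p A rewrite δ-refl (2 + p) =
  ≤-trans (s≤s z≤n) (≤-trans (m≤n+m _ (δ (1 + p) (2 + p))) (m≤n+m _ (δ p (2 + p))))

Rep-≈ : ∀ {M M′ k n} {ρ : Vec ℕ n} {p} {t : Term k n} {A} →
        Rep M ρ p t A → M ≈[ occ A ] M′ → Rep M′ ρ p t A
Rep-≈ {p = p} (var e₀ e₁) q = var (trans (q _ (at₀ p [])) e₀) (trans (q _ (at₁ p [])) e₁)
Rep-≈ {p = p} (con e₀ e₁) q = con (trans (q _ (at₀ p [])) e₀) (trans (q _ (at₁ p [])) e₁)
Rep-≈ {M} {M′} {p = p} (ƛ_ {ρ = ρ} {t = t} {A} e₀ r) q =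
  (ƛ trans (q _ (at₀ p A)) e₀)
    (transport (λ c → Rep M′ (p ∷ ρ) c t A) (sym (q _ (at₁ p A)))
        (Rep-≈ r (≈-mono (occ-⊆ʳ (node p) A) q)))
Rep-≈ {M} {M′} {ρ = ρ} {p} (_·_ {t = t} {u} {A} {B} e₀ r s) q =
  _·_ (trans (q _ (at₀ p (A ++ B))) e₀)
    (transport (λ c → Rep M′ ρ c t A) (sym (q _ (at₁ p (A ++ B))))
      (Rep-≈ r (≈-mono (λ a → ≤-trans (occ-⊆ˡ A B a) (occ-⊆ʳ (node p) (A ++ B) a)) q)))
    (transport (λ c → Rep M′ ρ c u B) (sym (q _ (at₂ p (A ++ B))))
      (Rep-≈ s (≈-mono (λ a → ≤-trans (occ-⊆ʳ A B a) (occ-⊆ʳ (node p) (A ++ B) a)) q)))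
Rep-≈ {M} {M′} {ρ = ρ} {p} (_[←_] {t = t} {u} {A} {B} e₀ r s) q =
  _[←_] (trans (q _ (at₀ p (A ++ B))) e₀)
    (transport (λ c → Rep M′ (p ∷ ρ) c t A) (sym (q _ (at₁ p (A ++ B))))
      (Rep-≈ r (≈-mono (λ a → ≤-trans (occ-⊆ˡ A B a) (occ-⊆ʳ (node p) (A ++ B) a)) q)))
    (transport (λ c → Rep M′ ρ c u B) (sym (q _ (at₂ p (A ++ B))))
      (Rep-≈ s (≈-mono (λ a → ≤-trans (occ-⊆ʳ A B a) (occ-⊆ʳ (node p) (A ++ B) a)) q)))

lookup-ext : ∀ {n m} {ρ : Vec ℕ n} {ρ′ : Vec ℕ m} {r : Fin n → Fin m} p →
             lookup ρ′ ∘ r ≗ lookup ρ → lookup (p ∷ ρ′) ∘ ext r ≗ lookup (p ∷ ρ)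
lookup-ext p e zero    = refl
lookup-ext p e (suc i) = e i

-- Variables are stored as addresses of binders, so a renaming that respects the addresses costs no
-- write. Growth of the scope is invisible in memory.
Rep-rename : ∀ {M k n m} {ρ : Vec ℕ n} {ρ′ : Vec ℕ m} (r : Fin n → Fin m) {p} {t : Term k n} {A} →
             lookup ρ′ ∘ r ≗ lookup ρ → Rep M ρ p t A → Rep M ρ′ p (rename r t) A
Rep-rename r e (var {i = i} x y) = var x (trans y (sym (e i)))
Rep-rename r e (con x y)   = con x y
Rep-rename {ρ = ρ} {ρ′} r {p} e (ƛ_ x s) = (ƛ x) (Rep-rename (ext r)
    (lookup-ext {ρ = ρ} {ρ′} {r} p e) s)
Rep-rename r e (_·_ x s s′) = _·_ x (Rep-rename r e s) (Rep-rename r e s′)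
Rep-rename {ρ = ρ} {ρ′} r {p} e (_[←_] x s s′) = _[←_] x
    (Rep-rename (ext r) (lookup-ext {ρ = ρ} {ρ′} {r} p e) s) (Rep-rename r e s′)

Rep-embed : ∀ {M n} {ρ : Vec ℕ n} {p} {t : Term plain n} {A} → Rep M ρ p t A → Rep M ρ p (embed t) A
Rep-embed (var x y)   = var x y
Rep-embed (con x y)   = con x y
Rep-embed (ƛ_ x s)    = (ƛ x) (Rep-embed s)
Rep-embed (_·_ x s u) = _·_ x (Rep-embed s) (Rep-embed u)

absent : ∀ {x A} → All (x ≢_) A → occ A x ≡ 0
absent [] = refl
absent (r ∷ rs) rewrite δ-≢ (λ e → r (sym e)) = absent rs

Unique⇒occ : ∀ {A f} → Unique A → All (_< f) A → ∀ a → occ A a ≤ ι f a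
Unique⇒occ [] [] a = z≤n
Unique⇒occ {x ∷ A} {f} (p ∷ u) (x<f ∷ q) a with x ≟ a
... | no x≢a rewrite δ-≢ x≢a = Unique⇒occ u q a
... | yes refl rewrite δ-refl x | absent p = ι-below f x x<f

occ⇒Unique : ∀ A → (∀ a → occ A a ≤ 1) → Unique A
occ⇒Unique []      p = []
occ⇒Unique (x ∷ A) p =
  present A (δ-excl {x} (p x)) ∷ occ⇒Unique A λ a → ≤-trans (m≤n+m _ _) (p a)
  where
  present : ∀ A → occ A x ≡ 0 → All (x ≢_) A
  present []      e = []
  present (y ∷ A) e =
    (λ { refl → 1≰0 (≤-trans (≤-reflexive (sym (δ-refl x))) (m≤m+n _ (occ A x))) e })
    ∷ present A (m+n≡0⇒n≡0 (δ y x) e)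

-- Registers: 1 budget, 2 beginning of the free memory, 3 top of the task stack, 4 newest explicit
-- substitution, 5 = 1, 6 = 2, 7 cost of a substitution step, 12 cell that points to the term, 13 = 0.
-- A task consists of a tag, the cell that it works on and the next task.  Tag 0 evaluates the term
-- to which the cell points, 1 contracts an application whose subterms have been evaluated, 2 fills
-- a cell that holds a variable with the value that the chain of the variable leads to, 3 replaces
-- the term to which the cell points by a copy, and 4 halts.

allocate : (x y z : ℕ) → Program
allocate x y z = store 2 x ∷ add 2 5 2 ∷ store 2 y ∷ add 2 5 2 ∷ store 2 z ∷ add 2 5 2 ∷ []

push : (tag cell : ℕ) → Program
push tag cell = add 11 13 2 ∷ allocate tag cell 3 ++ add 3 13 11 ∷ []

move : (r s : ℕ) → Instruction
move r s = add r 13 s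

goto : ℕ → Instruction
goto l = jump-zero 13 l

-- Absolute positions of the blocks of `program`, the same for every `charge` because it occurs only
-- as an operand. The symbolic runs check them by computation.
at-loop at-eval at-pop at-apply at-variable at-demand at-beta at-beta-variable at-beta-value
  at-beta-inert at-bind at-fill at-follow at-replace at-copy at-copy-ƛ at-copy-variable
  at-copy-bound at-copy-node at-final at-collect at-end : ℕ
at-loop = 25
at-eval = 48
at-pop = 70
at-apply = 72
at-variable = 79
at-demand = 86
at-beta = 96
at-beta-variable = 108
at-beta-value = 112
at-beta-inert = 114
at-bind = 115
at-fill = 122
at-follow = 129
at-replace = 138
at-copy = 143
at-copy-ƛ = 176
at-copy-variable = 195
at-copy-bound = 199
at-copy-node = 201
at-final = 209
at-collect = 214
at-end = 223

-- The triple allocated first has two uses: its first cell points to the whole term, and its second,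
-- which holds 0, ends the list of substitutions. The loop reloads its constants, so that only the
-- registers of `Main` matter between iterations. Evaluating an application turns the task into a
-- contraction and pushes the argument last, whence the order from right to left. A replacement
-- first lets the cell share the value and turns its task into a copying one, which ends the
-- sharing. A variable met while copying is bound by a substitution or by an abstraction inside the
-- copied value, so the tag of the binder decides whether it is forwarded.
program : ℕ → Program
program charge =
  -- init
  const 5 1 ∷ move 12 2 ∷ allocate 0 13 13 ++ add 4 5 12 ∷ const 8 4 ∷ move 3 2 ∷
  allocate 8 13 13 ++ push 13 12 ++
  -- loop
  const 5 1 ∷ const 6 2 ∷ const 7 charge ∷ const 13 0 ∷ load 8 3 ∷ add 9 5 3 ∷ load 9 9 ∷
  add 10 6 3 ∷ load 10 10 ∷ load 14 9 ∷ load 15 14 ∷ add 16 5 14 ∷ load 16 16 ∷ add 17 6 14 ∷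
  load 17 17 ∷ jump-zero 8 at-eval ∷ sub 8 8 5 ∷ jump-zero 8 at-apply ∷ sub 8 8 5 ∷
  jump-zero 8 at-fill ∷ sub 8 8 5 ∷ jump-zero 8 at-copy ∷ goto at-final ∷
  -- eval
  sub 15 15 6 ∷ jump-zero 15 at-pop ∷ store 3 5 ∷ add 18 5 14 ∷ add 19 6 14 ∷ push 13 18 ++
  push 13 19 ++ goto at-loop ∷
  -- pop
  move 3 10 ∷ goto at-loop ∷
  -- apply
  load 15 16 ∷ jump-zero 15 at-variable ∷ sub 15 15 5 ∷ jump-zero 15 at-pop ∷ sub 15 15 5 ∷
  jump-zero 15 at-beta ∷ goto at-pop ∷
  -- variable
  add 18 5 16 ∷ load 18 18 ∷ load 18 18 ∷ const 19 4 ∷ sub 18 18 19 ∷ jump-zero 18 at-demand ∷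
  goto at-pop ∷
  -- demand
  add 18 5 14 ∷ push 6 18 ++ goto at-loop ∷
  -- beta
  jump-zero 1 at-final ∷ sub 1 1 5 ∷ add 19 5 16 ∷ load 20 19 ∷ add 21 6 16 ∷ load 15 17 ∷
  jump-zero 15 at-beta-variable ∷ sub 15 15 5 ∷ jump-zero 15 at-beta-inert ∷ sub 15 15 5 ∷
  jump-zero 15 at-beta-value ∷ goto at-beta-inert ∷
  -- beta-variable
  add 18 5 17 ∷ load 18 18 ∷ load 18 18 ∷ goto at-bind ∷
  -- beta-value
  const 18 4 ∷ goto at-bind ∷
  -- beta-inert
  const 18 5 ∷
  -- bind
  store 16 18 ∷ store 19 4 ∷ store 21 17 ∷ store 9 20 ∷ store 3 13 ∷ move 4 16 ∷ goto at-loop ∷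
  -- fill
  add 18 6 16 ∷ load 19 18 ∷ load 20 19 ∷ jump-zero 20 at-follow ∷ sub 21 7 1 ∷
  jump-zero 21 at-replace ∷ goto at-final ∷
  -- follow
  push 6 18 ++ goto at-loop ∷
  -- replace
  sub 1 1 7 ∷ store 9 19 ∷ const 21 3 ∷ store 3 21 ∷ goto at-loop ∷
  -- copy
  const 20 3 ∷ add 18 5 2 ∷ add 19 6 2 ∷ jump-zero 15 at-copy-variable ∷ sub 11 15 5 ∷
  jump-zero 11 at-copy-node ∷ sub 11 11 5 ∷ jump-zero 11 at-copy-ƛ ∷ store 9 2 ∷ move 3 10 ∷
  allocate 15 16 17 ++ push 20 18 ++ push 20 19 ++ goto at-loop ∷
  -- copy-ƛ
  store 9 2 ∷ add 21 6 14 ∷ store 21 2 ∷ move 3 10 ∷ allocate 15 16 17 ++ push 20 18 ++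
  goto at-loop ∷
  -- copy-variable
  load 11 16 ∷ sub 11 11 6 ∷ jump-zero 11 at-copy-bound ∷ goto at-copy-node ∷
  -- copy-bound
  add 21 6 16 ∷ load 16 21 ∷
  -- copy-node
  store 9 2 ∷ allocate 15 16 17 ++ goto at-pop ∷
  -- final
  const 13 0 ∷ const 5 1 ∷ const 6 2 ∷ const 11 4 ∷ load 0 12 ∷
  -- collect
  load 8 4 ∷ jump-zero 8 at-end ∷ add 9 5 4 ∷ load 10 9 ∷ store 9 0 ∷ store 4 11 ∷ move 0 4 ∷
  move 4 10 ∷ goto at-collect ∷
  []

-- Symbolic execution of the program

module Execution (charge : ℕ) where

  P : Program
  P = program charge

  next : Maybe Instruction → State → State
  next (just i) s = execute i s
  next nothing  s = s

  exec : ℕ → State → State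
  exec zero    s = s
  exec (suc k) s = exec k (next (fetch P s) s)

  jump : ℕ → State → State
  jump l s = ⟪ l , State.reg s , State.mem s ⟫

  skip : State → State
  skip s = jump (suc (State.pc s)) s

  -- `go j` lets normalisation execute `j` instructions. Only the jumps whose test does not compute
  -- need a proof of the tested value.
  data Run : State → ℕ → State → Set where
    stop    : ∀ {s} → Run s 0 s
    go      : ∀ j {k s s′} → Run (exec j s) k s′ → Run s (j + k) s′
    taken   : ∀ {r l k s s′} → fetch P s ≡ just (jump-zero r l) → State.reg s r ≡ 0 →
              Run (jump l s) k s′ → Run s (suc k) s′
    untaken : ∀ {r l m k s s′} → fetch P s ≡ just (jump-zero r l) → State.reg s r ≡ suc m →
              Run (skip s) k s′ → Run s (suc k) s′

  exec-+ : ∀ j k s → exec (j + k) s ≡ exec k (exec j s)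
  exec-+ zero    k s = refl
  exec-+ (suc j) k s = exec-+ j k _

  exec-taken : ∀ {r l} s → fetch P s ≡ just (jump-zero r l) → State.reg s r ≡ 0 → exec 1 s ≡ jump l
      s
  exec-taken s f e rewrite f | e = refl

  exec-untaken : ∀ {r l m} s → fetch P s ≡ just (jump-zero r l) → State.reg s r ≡ suc m →
                 exec 1 s ≡ skip s
  exec-untaken s f e rewrite f | e = refl

  Run⇒exec : ∀ {s k s′} → Run s k s′ → exec k s ≡ s′
  Run⇒exec stop = refl
  Run⇒exec {s} (go j {k} r) = trans (exec-+ j k s) (Run⇒exec r)
  Run⇒exec {s} (taken {k = k} f e r) = trans (cong (exec k) (exec-taken s f e)) (Run⇒exec r)
  Run⇒exec {s} (untaken {k = k} f e r) = trans (cong (exec k) (exec-untaken s f e)) (Run⇒exec r)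

  idle : ∀ k s → fetch P s ≡ nothing → exec k s ≡ s
  idle zero    s e = refl
  idle (suc k) s e rewrite e = idle k s e

  -- `exec` idles once the machine has halted, so an upper bound on the number of steps suffices
  -- everywhere else; the exact number is recovered here.
  exec⇒⇓ : ∀ k s → fetch P (exec k s) ≡ nothing → ∃[ j ] j ≤ k × P ⊢ s ⇓⟨ j ⟩ exec k s
  exec⇒⇓ zero    s e = 0 , z≤n , halt e
  exec⇒⇓ (suc k) s e with fetch P s in eq
  ... | just i = let j , p , d = exec⇒⇓ k (execute i s) e in suc j , s≤s p , step eq d
  ... | nothing rewrite idle k s eq = 0 , z≤n , halt eq

  infix 4 _⟶⟨_⟩_
  _⟶⟨_⟩_ : State → ℕ → State → Set
  s ⟶⟨ b ⟩ s′ = ∃[ k ] Run s k s′ × k ≤ b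

  quick : ∀ {s k s′ b} {_ : T (k ≤ᵇ b)} → Run s k s′ → s ⟶⟨ b ⟩ s′
  quick {k = k} {b = b} {p} r = k , r , ≤ᵇ⇒≤ k b p

  -- The five registers that survive an iteration of the main loop.
  record Main (R : ℕ → ℕ) (b f sp e h : ℕ) : Set where
    constructor main
    field
      budget : R 1 ≡ b
      free   : R 2 ≡ f
      top    : R 3 ≡ sp
      newest : R 4 ≡ e
      root   : R 12 ≡ h

  -- The constant 64 is a round bound for the longest path through the loop, the copying of an
  -- application; `quick` checks it by evaluation.
  record Iteration (R M : ℕ → ℕ) (l : ℕ) (M′ : ℕ → ℕ) (b f sp e : ℕ) : Set where
    constructor iteration
    field
      {target} : State
      run      : ⟪ at-loop , R , M ⟫ ⟶⟨ 64 ⟩ target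
      counter  : State.pc target ≡ l
      memory   : State.mem target ≡ M′
      survive  : Main (State.reg target) b f sp e (R 12)

  module _ (R M : ℕ → ℕ) where
    private
      f  = R 2
      sp = R 3
      h  = M (1 + sp)
      p  = M h
      q  = M (1 + p)
      r  = M (2 + p)

    to-eval : ∀ {k s′} → M sp ≡ 0 → Run (jump at-eval (exec 15 ⟪ at-loop , R , M ⟫)) k s′ →
              Run ⟪ at-loop , R , M ⟫ (15 + suc k) s′
    to-eval e x = go 15 (taken refl e x)

    to-apply : ∀ {k s′} → M sp ≡ 1 →
               Run (jump at-apply (exec 1 (skip (exec 15 ⟪ at-loop , R , M ⟫)))) k s′ →
               Run ⟪ at-loop , R , M ⟫ (15 + suc (1 + suc k)) s′
    to-apply e x = go 15 (untaken refl e (go 1 (taken refl (cong (_∸ 1) e) x)))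

    to-fill : ∀ {k s′} → M sp ≡ 2 →
              Run (jump at-fill (exec 1 (skip (exec 1 (skip (exec 15 ⟪ at-loop , R , M ⟫)))))) k s′
                  →
              Run ⟪ at-loop , R , M ⟫ (15 + suc (1 + suc (1 + suc k))) s′
    to-fill e x =
      go 15 (untaken refl e (go 1 (untaken refl (cong (_∸ 1) e)
        (go 1 (taken refl (cong (λ n → n ∸ 1 ∸ 1) e) x)))))

    to-copy : ∀ {k s′} → M sp ≡ 3 →
              Run (jump at-copy (exec 1 (skip (exec 1 (skip
                  (exec 1 (skip (exec 15 ⟪ at-loop , R , M ⟫)))))))) k s′ →
              Run ⟪ at-loop , R , M ⟫ (15 + suc (1 + suc (1 + suc (1 + suc k)))) s′
    to-copy e x =
      go 15 (untaken refl e (go 1 (untaken refl (cong (_∸ 1) e)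
        (go 1 (untaken refl (cong (λ n → n ∸ 1 ∸ 1) e)
          (go 1 (taken refl (cong (λ n → n ∸ 1 ∸ 1 ∸ 1) e) x)))))))

    to-halt : ∀ {k s′} → M sp ≡ 4 →
              Run (skip (exec 1 (skip (exec 1 (skip (exec 1
                  (skip (exec 15 ⟪ at-loop , R , M ⟫)))))))) k s′ →
              Run ⟪ at-loop , R , M ⟫ (15 + suc (1 + suc (1 + suc (1 + suc k)))) s′
    to-halt e x =
      go 15 (untaken refl e (go 1 (untaken refl (cong (_∸ 1) e)
        (go 1 (untaken refl (cong (λ n → n ∸ 1 ∸ 1) e)
          (go 1 (untaken refl (cong (λ n → n ∸ 1 ∸ 1 ∸ 1) e) x)))))))

    to-beta : ∀ {b k s′} → M sp ≡ 1 → M q ≡ 2 → R 1 ≡ suc b →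
              Run (skip (jump at-beta (exec 1 (skip (exec 1 (skip (exec 1
                (jump at-apply (exec 1 (skip (exec 15 ⟪ at-loop , R , M ⟫))))))))))) k s′ →
              Run ⟪ at-loop , R , M ⟫ (15 + suc (1 + suc (1 + suc (1 + suc (1 + suc (suc k)))))) s′
    to-beta e e′ e″ x =
      to-apply e (go 1 (untaken refl e′ (go 1 (untaken refl (cong (_∸ 1) e′)
        (go 1 (taken refl (cong (λ n → n ∸ 1 ∸ 1) e′) (untaken refl e″ x)))))))

    iter-eval-leaf : M sp ≡ 0 → M p ∸ 2 ≡ 0 → Iteration R M at-loop M (R 1) f (M (2 + sp)) (R 4)
    iter-eval-leaf e e′ =
      iteration (quick $ to-eval e $ go 1 $ taken refl e′ $ go 2 stop)
        refl refl (main refl refl refl refl refl)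

    iter-eval-app : M sp ≡ 0 → M p ≡ 3 →
      Iteration R M at-loop (alloc (alloc (M [ sp ≔ 1 ]) f 0 (1 + p) sp) (3 + f) 0 (2 + p) f)
        (R 1) (6 + f) (3 + f) (R 4)
    iter-eval-app e e′ =
      iteration (quick $ to-eval e $ go 1 $ untaken refl (cong (_∸ 2) e′) $ go 20 stop)
        refl refl (main refl refl refl refl refl)

    iter-halt : M sp ≡ 4 → Iteration R M at-final M (R 1) f sp (R 4)
    iter-halt e =
      iteration (quick $ to-halt e $ go 1 stop)
        refl refl (main refl refl refl refl refl)

    data Inert-tag : Set where
      con : M q ≡ 1 → Inert-tag
      app : M q ≡ 3 → Inert-tag
      var : M q ≡ 0 → M (M (1 + q)) ≡ 5 → Inert-tag

    iter-apply-inert : M sp ≡ 1 → Inert-tag → Iteration R M at-loop M (R 1) f (M (2 + sp)) (R 4)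
    iter-apply-inert e (con e′) =
      iteration (quick $ to-apply e $ go 1 $ untaken refl e′ $ go 1 $
          taken refl (cong (_∸ 1) e′) $ go 2 stop)
        refl refl (main refl refl refl refl refl)
    iter-apply-inert e (app e′) =
      iteration (quick $ to-apply e $ go 1 $ untaken refl e′ $ go 1 $
          untaken refl (cong (_∸ 1) e′) $ go 1 $ untaken refl (cong (λ n → n ∸ 1 ∸ 1) e′) $
          go 3 stop)
        refl refl (main refl refl refl refl refl)
    iter-apply-inert e (var e′ e″) =
      iteration (quick $ to-apply e $ go 1 $ taken refl e′ $ go 5 $
          untaken refl (cong (_∸ 4) e″) $ go 3 stop)
        refl refl (main refl refl refl refl refl)

    iter-apply-variable : M sp ≡ 1 → M q ≡ 0 → M (M (1 + q)) ≡ 4 →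
      Iteration R M at-loop (alloc M f 2 (1 + p) sp) (R 1) (3 + f) f (R 4)
    iter-apply-variable e e′ e″ =
      iteration (quick $ to-apply e $ go 1 $ taken refl e′ $ go 5 $ taken refl (cong (_∸ 4) e″) $
          go 10 stop)
        refl refl (main refl refl refl refl refl)

    iter-beta-stop : M sp ≡ 1 → M q ≡ 2 → R 1 ≡ 0 → Iteration R M at-final M (R 1) f sp (R 4)
    iter-beta-stop e e′ e″ =
      iteration (quick $ to-apply e $ go 1 $ untaken refl e′ $ go 1 $
          untaken refl (cong (_∸ 1) e′) $ go 1 $ taken refl (cong (λ n → n ∸ 1 ∸ 1) e′) $
          taken refl e″ stop)
        refl refl (main refl refl refl refl refl)

    -- The index is the tag that the new substitution receives. A variable hands on the flag of its
    -- own substitution, so no chain is followed when a substitution is created.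
    data Arg-tag : ℕ → Set where
      var : M r ≡ 0 → Arg-tag (M (M (1 + r)))
      con : M r ≡ 1 → Arg-tag 5
      abs : M r ≡ 2 → Arg-tag 4
      app : M r ≡ 3 → Arg-tag 5

    iter-beta : ∀ {b φ} → M sp ≡ 1 → M q ≡ 2 → R 1 ≡ suc b → Arg-tag φ →
      Iteration R M at-loop
        (((((M [ q ≔ φ ]) [ 1 + q ≔ R 4 ]) [ 2 + q ≔ r ]) [ h ≔ M (1 + q) ]) [ sp ≔ 0 ])
        b f sp q
    iter-beta e e′ e″ (var x) =
      iteration (quick $ to-beta e e′ e″ $ go 5 $ taken refl x $ go 11 stop)
        refl refl (main (cong (_∸ 1) e″) refl refl refl refl)
    iter-beta e e′ e″ (con x) =
      iteration (quick $ to-beta e e′ e″ $ go 5 $ untaken refl x $ go 1 $ taken refl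
          (cong (_∸ 1) x) $
          go 8 stop)
        refl refl (main (cong (_∸ 1) e″) refl refl refl refl)
    iter-beta e e′ e″ (abs x) =
      iteration (quick $ to-beta e e′ e″ $ go 5 $ untaken refl x $ go 1 $ untaken refl
          (cong (_∸ 1) x) $ go 1 $
          taken refl (cong (λ n → n ∸ 1 ∸ 1) x) $ go 9 stop)
        refl refl (main (cong (_∸ 1) e″) refl refl refl refl)
    iter-beta e e′ e″ (app x) =
      iteration (quick $ to-beta e e′ e″ $ go 5 $ untaken refl x $ go 1 $ untaken refl
          (cong (_∸ 1) x) $ go 1 $
          untaken refl (cong (λ n → n ∸ 1 ∸ 1) x) $ go 9 stop)
        refl refl (main (cong (_∸ 1) e″) refl refl refl refl)

    iter-fill-follow : M sp ≡ 2 → M (M (2 + q)) ≡ 0 →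
      Iteration R M at-loop (alloc M f 2 (2 + q) sp) (R 1) (3 + f) f (R 4)
    iter-fill-follow e e′ =
      iteration (quick $ to-fill e $ go 3 $ taken refl e′ $ go 9 stop)
        refl refl (main refl refl refl refl refl)

    iter-fill-stop : ∀ {m} → M sp ≡ 2 → M (M (2 + q)) ≡ 2 → charge ∸ R 1 ≡ suc m →
      Iteration R M at-final M (R 1) f sp (R 4)
    iter-fill-stop e e′ e″ =
      iteration (quick $ to-fill e $ go 3 $ untaken refl e′ $ go 1 $ untaken refl e″ $ go 1 stop)
        refl refl (main refl refl refl refl refl)

    iter-fill-replace : M sp ≡ 2 → M (M (2 + q)) ≡ 2 → charge ∸ R 1 ≡ 0 →
      Iteration R M at-loop ((M [ h ≔ M (2 + q) ]) [ sp ≔ 3 ]) (R 1 ∸ charge) f sp (R 4)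
    iter-fill-replace e e′ e″ =
      iteration (quick $ to-fill e $ go 3 $ untaken refl e′ $ go 1 $ taken refl e″ $ go 5 stop)
        refl refl (main refl refl refl refl refl)

    iter-copy-con : M sp ≡ 3 → M p ≡ 1 →
      Iteration R M at-loop (alloc (M [ h ≔ f ]) f (M p) q r) (R 1) (3 + f) (M (2 + sp)) (R 4)
    iter-copy-con e e′ =
      iteration (quick $ to-copy e $ go 3 $ untaken refl e′ $ go 1 $
          taken refl (cong (_∸ 1) e′) $ go 10 stop)
        refl refl (main refl refl refl refl refl)

    iter-copy-free : ∀ {m} → M sp ≡ 3 → M p ≡ 0 → M q ∸ 2 ≡ suc m →
      Iteration R M at-loop (alloc (M [ h ≔ f ]) f (M p) q r) (R 1) (3 + f) (M (2 + sp)) (R 4)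
    iter-copy-free e e′ e″ =
      iteration (quick $ to-copy e $ go 3 $ taken refl e′ $ go 2 $ untaken refl e″ $ go 11 stop)
        refl refl (main refl refl refl refl refl)

    iter-copy-bound : M sp ≡ 3 → M p ≡ 0 → M q ≡ 2 →
      Iteration R M at-loop (alloc (M [ h ≔ f ]) f (M p) (M (2 + q)) r) (R 1) (3 + f) (M (2 + sp))
          (R 4)
    iter-copy-bound e e′ e″ =
      iteration (quick $ to-copy e $ go 3 $ taken refl e′ $ go 2 $ taken refl (cong (_∸ 2) e″) $
          go 12 stop)
        refl refl (main refl refl refl refl refl)

    iter-copy-ƛ : M sp ≡ 3 → M p ≡ 2 →
      Iteration R M at-loop
        (alloc (alloc ((M [ h ≔ f ]) [ 2 + p ≔ f ]) f (M p) q r) (3 + f) 3 (1 + f) (M (2 + sp)))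
        (R 1) (6 + f) (3 + f) (R 4)
    iter-copy-ƛ e e′ =
      iteration (quick $ to-copy e $ go 3 $ untaken refl e′ $ go 1 $
          untaken refl (cong (_∸ 1) e′) $ go 1 $ taken refl (cong (λ n → n ∸ 1 ∸ 1) e′) $
          go 19 stop)
        refl refl (main refl refl refl refl refl)

    iter-copy-app : M sp ≡ 3 → M p ≡ 3 →
      Iteration R M at-loop
        (alloc (alloc (alloc (M [ h ≔ f ]) f (M p) q r) (3 + f) 3 (1 + f) (M (2 + sp))) (6 + f) 3
            (2 + f) (3 + f))
        (R 1) (9 + f) (6 + f) (R 4)
    iter-copy-app e e′ =
      iteration (quick $ to-copy e $ go 3 $ untaken refl e′ $ go 1 $
          untaken refl (cong (_∸ 1) e′) $ go 1 $ untaken refl (cong (λ n → n ∸ 1 ∸ 1) e′) $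
          go 25 stop)
        refl refl (main refl refl refl refl refl)

  iter-collect : ∀ R M {m} → M (R 4) ≡ suc m → R 11 ≡ 4 → R 5 ≡ 1 → R 13 ≡ 0 →
    ∃[ s′ ] ⟪ at-collect , R , M ⟫ ⟶⟨ 64 ⟩ s′ × State.pc s′ ≡ at-collect ×
      State.mem s′ ≡ ((M [ 1 + R 4 ≔ R 0 ]) [ R 4 ≔ 4 ]) ×
      State.reg s′ 0 ≡ R 4 × State.reg s′ 4 ≡ M (1 + R 4) ×
      State.reg s′ 11 ≡ 4 × State.reg s′ 5 ≡ 1 × State.reg s′ 13 ≡ 0
  iter-collect R M e r₁₁ r₅ r₁₃ =
    _ , (quick $ go 1 $ untaken refl e $ go 6 $ taken refl r₁₃ stop) , refl ,
    cong₂ (λ i x → (M [ i + R 4 ≔ R 0 ]) [ R 4 ≔ x ]) r₅ r₁₁ ,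
    cong (_+ R 4) r₁₃ , cong₂ (λ i j → i + M (j + R 4)) r₁₃ r₅ , r₁₁ , r₅ , r₁₃

  collect-end : ∀ R M → M (R 4) ≡ 0 → ∃[ s′ ] ⟪ at-collect , R , M ⟫ ⟶⟨ 64 ⟩ s′ ×
    State.pc s′ ≡ at-end × State.mem s′ ≡ M × State.reg s′ 0 ≡ R 0
  collect-end R M e = _ , (quick $ go 1 $ taken refl e stop) , refl , refl , refl

  final-start : ∀ R M → ∃[ s′ ] ⟪ at-final , R , M ⟫ ⟶⟨ 64 ⟩ s′ × State.pc s′ ≡ at-collect ×
    State.mem s′ ≡ M × State.reg s′ 0 ≡ M (R 12) × State.reg s′ 4 ≡ R 4 ×
    State.reg s′ 11 ≡ 4 × State.reg s′ 5 ≡ 1 × State.reg s′ 13 ≡ 0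
  final-start R M = _ , (quick $ go 5 stop) , refl , refl , refl , refl , refl , refl , refl

  start-up : ∀ root len f M → ∃[ s′ ] ⟪ 0 , registers root len f , M ⟫ ⟶⟨ 64 ⟩ s′ ×
    State.pc s′ ≡ at-loop ×
    State.mem s′ ≡ alloc (alloc (alloc M f root 0 0) (3 + f) 4 0 0) (6 + f) 0 f (3 + f) ×
    Main (State.reg s′) len (9 + f) (6 + f) (1 + f) f
  start-up root len f M = _ , (quick $ go 25 stop) , refl , refl , main refl refl refl refl refl

  end-halts : ∀ R M → fetch P ⟪ at-end , R , M ⟫ ≡ nothing
  end-halts R M = refl

-- Halting with a correct output, and the copying of terms

off : ∀ {f x y} → δ x x + y ≤ ι f x → y ≡ 0
off {f} {x} p = δ-excl {x} (≤-trans p (ι≤1 f x))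

bump : ∀ {f x a} → x ≤ ι f a → occ (node f) a + x ≤ ι (3 + f) a
bump {f} {x} {a} p = ≤-trans
  (sum≤ (δ f a ∷ δ (1 + f) a ∷ δ (2 + f) a ∷ x ∷ []) ((# 0 ⊕ # 1 ⊕ # 2 ⊕ # 9) ⊕ # 3)
      (# 2 ⊕ # 1 ⊕ # 0 ⊕ # 3))
  (+-monoʳ-≤ (δ (2 + f) a) (+-monoʳ-≤ (δ (1 + f) a) (+-monoʳ-≤ (δ f a) p)))

occ₃ : ∀ p A B a → occ (node p ++ A ++ B) a ≡ occ (node p) a + (occ A a + occ B a)
occ₃ p A B a = trans (occ-++ (node p) (A ++ B) a) (cong (occ (node p) a +_) (occ-++ A B a))

here : ∀ x → 1 ≤ δ x x
here x = ≤-reflexive (sym (δ-refl x))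

ι-step : ∀ f a → ι f a ≤ ι (3 + f) a
ι-step f a = ≤-trans (m≤n+m _ (occ (node f) a)) (bump ≤-refl)

-- The third cell of an abstraction that is being copied points to the copy; explicit substitutions
-- are not copied.
Forward : (ℕ → ℕ) → (ℕ → ℕ) → ℕ → ℕ → Set
Forward M κ q q′ = 1 ≤ κ q ×
  ((M q ≡ 2 × 1 ≤ κ (2 + q) × M (2 + q) ≡ q′) ⊎ (∃[ m ] M q ∸ 2 ≡ suc m × q′ ≡ q))

Forward-≈ : ∀ {M M′ κ κ′ q q′} → (∀ a → κ a ≤ κ′ a) → M ≈[ κ ] M′ → Forward M κ q q′ → Forward M′
    κ′ q q′
Forward-≈ i k (c , inj₁ (x , y , z)) = ≤-trans c (i _) , inj₁
    (trans (k _ c) x , ≤-trans y (i _) , trans (k _ y) z)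
Forward-≈ i k (c , inj₂ (m , x , y)) = ≤-trans c (i _) , inj₂
    (m , trans (cong (_∸ 2) (k _ c)) x , y)

module Machine (charge : ℕ) (Res : Term shared 0 → Set) where
  open Execution charge

  record Halts (s : State) (T : ℕ) : Set where
    constructor halts
    field
      {steps}  : ℕ
      {result} : Term shared 0
      bound    : steps ≤ 64 * T
      stops    : fetch P (exec steps s) ≡ nothing
      output   : Output (exec steps s) result
      correct  : Res result

  Halts-mono : ∀ {s T T′} → T ≤ T′ → Halts s T → Halts s T′
  Halts-mono p (halts q x y z) = halts (≤-trans q (*-monoʳ-≤ 64 p)) x y z

  Halts-step : ∀ {s s′ T} → s ⟶⟨ 64 ⟩ s′ → Halts s′ T → Halts s (suc T)
  Halts-step {s} {s′} {T} (j , r , j≤) (halts {k} {w} k≤ x y z) =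
    halts {steps = j + k}
      (≤-trans (+-mono-≤ j≤ k≤) (≤-reflexive (sym (*-suc 64 T))))
      (transport (λ s″ → fetch P s″ ≡ nothing) eq x) (transport (λ s″ → Output s″ w) eq y) z
    where
    eq : exec k s′ ≡ exec (j + k) s
    eq = trans (cong (exec k) (sym (Run⇒exec r))) (sym (exec-+ j k s))

  -- Correctness in continuation style: the rest of the run from this configuration halts with a
  -- correct output. A run that stops for lack of budget then needs no return path through the
  -- pending tasks.
  HaltsAt : ℕ → (b f sp e z : ℕ) → (ℕ → ℕ) → ℕ → Set
  HaltsAt l b f sp e z M T = ∀ R → Main R b f sp e z → Halts ⟪ l , R , M ⟫ T

  Loop Stop : (b f sp e z : ℕ) → (ℕ → ℕ) → ℕ → Set
  Loop = HaltsAt at-loop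
  Stop = HaltsAt at-final

  Loop-mono : ∀ {b f sp e z M T T′} → T ≤ T′ → Loop b f sp e z M T → Loop b f sp e z M T′
  Loop-mono p x R m = Halts-mono p (x R m)

  iterate : ∀ {R M l M′ b f sp e T} → Iteration R M l M′ b f sp e →
            HaltsAt l b f sp e (R 12) M′ T → Halts ⟪ at-loop , R , M ⟫ (suc T)
  iterate (iteration {s} r refl refl m) x = Halts-step r (x (State.reg s) m)

  -- The source is intact afterwards: forward pointers overwrite only the third cells of
  -- abstractions, whose contents `Rep` leaves arbitrary.
  Copied : ∀ {m} → Term plain m → (ρs ρd : Vec ℕ m) → (src h : ℕ) → List ℕ → (κ M M′ : ℕ → ℕ) → ℕ →
      Set
  Copied t ρs ρd src h A κ M M′ f′ =
    ∃[ A′ ] Rep M′ ρd (M′ h) t A′ × Rep M′ ρs src t A × M ≈[ κ ] M′ ×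
      (∀ a → occ A′ a + (occ A a + (δ h a + κ a)) ≤ ι f′ a)

  copy-leaf : ∀ {m} {t : Term plain m} {ρs ρd : Vec ℕ m} {src A M} h f sp κ x y z →
    (∀ a → occ A a + (δ h a + (occ (node sp) a + κ a)) ≤ ι f a) → Rep M ρs src t A →
    let M′ = alloc (M [ h ≔ f ]) f x y z in
    Rep M′ ρd f t (node f) → Copied t ρs ρd src h A κ M M′ (3 + f)
  copy-leaf {t = t} {ρd = ρd} {A = A} {M} h f sp κ x y z ω r r′ =
    _ , transport (λ p → Rep M′ ρd p t (node f)) (sym eh) r′ , Rep-≈ r kA , kκ ,
    λ a → bump (≤-trans (sum≤ (xs a) (# 0 ⊕ # 1 ⊕ # 3) all) (ω a))
    where
    M₁ = M [ h ≔ f ]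
    M′ = alloc M₁ f x y z
    xs : ℕ → List ℕ
    xs a = occ A a ∷ δ h a ∷ occ (node sp) a ∷ κ a ∷ []
    all = # 0 ⊕ # 1 ⊕ # 2 ⊕ # 3
    eh : M′ h ≡ f
    eh = trans (alloc-≈ {δ h} M₁ f x y z (λ a → ≤-trans (sum≤ (xs a) (# 1) all) (ω a)) h
                 (≤-reflexive (sym (δ-refl h)))) (hit M h f)
    kA : M ≈[ occ A ] M′
    kA = ≈-trans (≔-≈ {occ A} M h f (off {f} (≤-trans (sum≤ (xs h) (# 1 ⊕ # 0) all) (ω h))))
                 (alloc-≈ M₁ f x y z λ a → ≤-trans (sum≤ (xs a) (# 0) all) (ω a))
    kκ : M ≈[ κ ] M′
    kκ = ≈-trans (≔-≈ {κ} M h f (off {f} (≤-trans (sum≤ (xs h) (# 1 ⊕ # 3) all) (ω h))))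
                 (alloc-≈ M₁ f x y z λ a → ≤-trans (sum≤ (xs a) (# 3) all) (ω a))

  -- The binders of the source and of the copy are listed separately, and `Forward` links them. The
  -- protected footprint `κ` grows on the way down by the nodes already visited, since their forward
  -- pointers must last until the subterms have been copied.
  copy : ∀ {m} (t : Term plain m) {ρs ρd : Vec ℕ m} {src h sp nxt : ℕ} {A M} (κ : ℕ → ℕ)
      {T b f e z} →
    M sp ≡ 3 → M (1 + sp) ≡ h → M (2 + sp) ≡ nxt → M h ≡ src → Rep M ρs src t A →
    (∀ i → Forward M κ (lookup ρs i) (lookup ρd i)) →
    (∀ a → occ A a + (δ h a + (occ (node sp) a + κ a)) ≤ ι f a) →
    (∀ M′ f′ → Copied t ρs ρd src h A κ M M′ f′ → Loop b f′ nxt e z M′ T) →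
    Loop b f sp e z M (∣ t ∣ + T)
  copy (var i) {ρs} {ρd} {A = A} {M} κ {T} tag refl refl refl r@(var e₀ e₁) fwd ω cont R
      (main refl refl refl refl refl)
    with fwd i
  ... | _ , inj₁ (x , _ , y) =
    iterate (iter-copy-bound R M tag e₀ (trans (cong M e₁) x)) $ cont _ _ $
      copy-leaf h f (R 3) κ (M p) (M (2 + M (1 + p))) (M (2 + p)) ω r $
        var (trans (alloc₀ (M [ h ≔ f ]) f _ _ _) e₀)
            (trans (alloc₁ (M [ h ≔ f ]) f (M p) _ (M (2 + p)))
                (trans (cong (λ q → M (2 + q)) e₁) y))
    where h = M (1 + R 3)
          f = R 2
          p = M h
  ... | _ , inj₂ (_ , x , y) =
    iterate (iter-copy-free R M tag e₀ (trans (cong (λ q → M q ∸ 2) e₁) x)) $ cont _ _ $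
      copy-leaf h f (R 3) κ (M p) (M (1 + p)) (M (2 + p)) ω r $
        var (trans (alloc₀ (M [ h ≔ f ]) f _ _ _) e₀)
            (trans (alloc₁ (M [ h ≔ f ]) f (M p) _ (M (2 + p))) (trans e₁ (sym y)))
    where h = M (1 + R 3)
          f = R 2
          p = M h
  copy (con c) {ρs} {ρd} {A = A} {M} κ tag refl refl refl r@(con e₀ e₁) fwd ω cont R
      (main refl refl refl refl refl) =
    iterate (iter-copy-con R M tag e₀) $ cont _ _ $
      copy-leaf h f (R 3) κ (M p) (M (1 + p)) (M (2 + p)) ω r $
        con (trans (alloc₀ (M [ h ≔ f ]) f _ _ _) e₀)
            (trans (alloc₁ (M [ h ≔ f ]) f (M p) _ (M (2 + p))) e₁)
    where h = M (1 + R 3)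
          f = R 2
          p = M h
  copy (ƛ t) {ρs} {ρd} {M = M} κ {T} tag refl refl refl (ƛ_ {A = A} e₀ r) fwd ω cont R
      (main refl refl refl refl refl) =
    Halts-mono (≤-reflexive (cong (_+ T) (+-comm 1 ∣ t ∣))) $ iterate (iter-copy-ƛ R M tag e₀) $
      copy t κ₁ (alloc₀ M₂ (3 + f) _ _ _) (alloc₁ M₂ (3 + f) 3 _ nxt)
          (alloc₂ M₂ (3 + f) 3 (1 + f) _)
        q′ (Rep-≈ r (≈-mono (λ a → sum≤ (xs a) (# 0) kept) k))
        -- The binder just passed is forwarded by the third cell of its node, which now holds the
        -- address of the copy; the outer binders keep their forwarding.
        (λ { zero    → ≤-trans (here p) (sum≤ (xs p) (# 4) prot) ,
                       inj₁ (trans (k p (≤-trans (here p) (sum≤ (xs p) (# 4) kept))) e₀ ,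
                             ≤-trans (here (2 + p)) (sum≤ (xs (2 + p)) (# 6) prot) , p₂)
           ; (suc i) → Forward-≈ (λ a → sum≤ (xs a) (# 3) prot)
               (≈-mono (λ a → sum≤ (xs a) (# 3) kept) k) (fwd i) })
        (λ a → ≤-trans (sum≤ (xs a ++ occ (node (3 + f)) a ∷ [])
                          (# 0 ⊕ # 8 ⊕ # 10 ⊕ prot) (# 10 ⊕ (# 7 ⊕ # 8 ⊕ # 9 ⊕ # 99) ⊕ all))
                        (bump (bump (ω₀ a))))
        λ { M′ f′ (A′ , r′ , rs , k′ , ω′) → cont M′ f′
          ( node f ++ A′
          , transport (λ c → Rep M′ ρd c (ƛ t) (node f ++ A′))
              (sym (trans (k′ h (≤-trans (here h) (sum≤ (xs h) (# 1) prot))) h′))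
              ((ƛ trans (k′ f (≤-trans (here f) (sum≤ (xs f) (# 7) prot))) (trans f₀ e₀)) r′)
          , (ƛ trans (k′ p (≤-trans (here p) (sum≤ (xs p) (# 4) prot)))
                 (trans (k p (≤-trans (here p) (sum≤ (xs p) (# 4) kept))) e₀))
              (transport (λ c → Rep M′ (p ∷ ρs) c t A)
                (sym (trans (k′ (1 + p) (≤-trans (here (1 + p)) (sum≤ (xs (1 + p)) (# 5) prot)))
                            (k (1 + p) (≤-trans (here (1 + p)) (sum≤ (xs (1 + p)) (# 5) kept)))))
                                rs)
          , ≈-trans (≈-mono (λ a → sum≤ (xs a) (# 3) kept) k)
              (≈-mono (λ a → sum≤ (xs a) (# 3) prot) k′)
          , λ a → ≤-trans (≤-reflexive (cong₂ (λ x y → x + (y + (δ h a + κ a)))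
              (occ-++ (node f) A′ a) (occ-++ (node p) A a)))
              (≤-trans (sum≤ (xs a ++ occ A′ a ∷ [])
                          (((# 7 ⊕ # 8 ⊕ # 9 ⊕ # 99) ⊕ # 10) ⊕ ((# 4 ⊕ # 5 ⊕ # 6 ⊕ # 99) ⊕ # 0) ⊕ #
                              1 ⊕ # 3)
                          (# 10 ⊕ # 0 ⊕ # 8 ⊕ prot))
                        (ω′ a)) ) }
    where
    f   = R 2
    sp  = R 3
    h   = M (1 + sp)
    nxt = M (2 + sp)
    p   = M h
    q   = M (1 + p)
    M₁ = (M [ h ≔ f ]) [ 2 + p ≔ f ]
    M₂ = alloc M₁ f (M p) q (M (2 + p))
    M₃ = alloc M₂ (3 + f) 3 (1 + f) nxt
    xs : ℕ → List ℕ
    xs a = occ A a ∷ δ h a ∷ occ (node sp) a ∷ κ a ∷ δ p a ∷ δ (1 + p) a ∷ δ (2 + p) a ∷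
           δ f a ∷ δ (1 + f) a ∷ δ (2 + f) a ∷ []
    κ₁ : ℕ → ℕ
    κ₁ a = δ h a + (occ (node p) a + (δ f a + (δ (2 + f) a + κ a)))
    prot kept : Sum
    prot  = # 1 ⊕ (# 4 ⊕ # 5 ⊕ # 6 ⊕ # 99) ⊕ # 7 ⊕ # 9 ⊕ # 3
    kept  = # 0 ⊕ # 4 ⊕ # 5 ⊕ # 3
    all : Sum
    all = # 0 ⊕ # 1 ⊕ # 2 ⊕ # 3 ⊕ # 4 ⊕ # 5 ⊕ # 6
    ω₀ : ∀ a → ⟦ all ⟧ (xs a) ≤ ι f a
    ω₀ a = ≤-trans (≤-trans (sum≤ (xs a) all (((# 4 ⊕ # 5 ⊕ # 6 ⊕ # 99) ⊕ # 0) ⊕ # 1 ⊕ # 2 ⊕ # 3))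
             (≤-reflexive (cong (_+ (δ h a + (occ (node sp) a + κ a)))
                 (sym (occ-++ (node p) A a))))) (ω a)
    k : M ≈[ (λ a → ⟦ kept ⟧ (xs a)) ] M₃
    k = ≈-trans (≔-≈ M h f (off {f} (≤-trans (sum≤ (xs h) (# 1 ⊕ kept) all) (ω₀ h))))
       (≈-trans (≔-≈ (M [ h ≔ f ]) (2 + p) f (off {f} (≤-trans (sum≤ (xs (2 + p)) (# 6 ⊕ kept) all)
           (ω₀ (2 + p)))))
       (≈-trans (alloc-≈ M₁ f (M p) q (M (2 + p)) λ a → ≤-trans (sum≤ (xs a) kept all) (ω₀ a))
                (alloc-≈ M₂ (3 + f) 3 (1 + f) nxt λ a → ≤-trans
                    (≤-trans (sum≤ (xs a) kept all) (ω₀ a)) (ι-step f a))))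
    low : ∀ x → δ x x ≤ ι f x → M₃ x ≡ M₁ x
    low x l = trans (alloc-below M₂ (3 + f) 3 (1 + f) nxt x (≤-trans x<f (m≤n+m f 3)))
        (alloc-below M₁ f (M p) q (M (2 + p)) x x<f)
      where
      x<f : x < f
      x<f = ≰⇒> λ f≤x → 1≰0 (≤-trans (here x) l) (ι-beyond f x f≤x)
    f₀ : M₃ f ≡ M p
    f₀ = trans (alloc-below M₂ (3 + f) 3 (1 + f) nxt f (m≤n+m (suc f) 2)) (alloc₀ M₁ f _ _ _)
    q′ : M₃ (1 + f) ≡ q
    q′ = trans (alloc-below M₂ (3 + f) 3 (1 + f) nxt (1 + f) (m≤n+m (2 + f) 1))
        (alloc₁ M₁ f (M p) _ (M (2 + p)))
    p₂ : M₃ (2 + p) ≡ f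
    p₂ = trans (low (2 + p) (≤-trans (sum≤ (xs (2 + p)) (# 6) all) (ω₀ (2 + p))))
        (hit (M [ h ≔ f ]) (2 + p) f)
    h′ : M₃ h ≡ f
    h′ = trans (low h (≤-trans (sum≤ (xs h) (# 1) all) (ω₀ h)))
           (trans (≔-≈ {δ h} (M [ h ≔ f ]) (2 + p) f
                    (off {f} (≤-trans (sum≤ (xs (2 + p)) (# 6 ⊕ # 1) all) (ω₀ (2 + p)))) h
                        (≤-reflexive (sym (δ-refl h))))
                  (hit M h f))
  copy (t · u) {ρs} {ρd} {M = M} κ {T} tag refl refl refl (_·_ {A = A} {B} e₀ r s) fwd ω cont R
      (main refl refl refl refl refl) =
    Halts-mono (≤-reflexive size) $ iterate (iter-copy-app R M tag e₀) $
      copy u κᵤ (alloc₀ M₃ (6 + f) _ _ _) (alloc₁ M₃ (6 + f) 3 _ (3 + f))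
          (alloc₂ M₃ (6 + f) 3 (2 + f) _)
        r′ (Rep-≈ s (≈-mono (λ a → sum≤ (xs a) (# 10) kept) k))
        (λ i → Forward-≈ (λ a → sum≤ (xs a) (# 3) protᵤ) (≈-mono (λ a → sum≤ (xs a) (# 3) kept) k)
            (fwd i))
        (λ a → ≤-trans (sum≤ (xs a) (# 10 ⊕ # 9 ⊕ # 12 ⊕ protᵤ) (# 12 ⊕ # 11 ⊕ fresh ⊕ all))
                 (bump {6 + f} (bump {3 + f} (bump (ω₀ a)))))
        λ { M₅ f₅ (B′ , ru′ , ru , k₅ , ω₅) →
          -- The task of the argument was pushed last and has run first, so its source and its copy
          -- join the protected cells while the function is copied.
          let κₜ : ℕ → ℕ
              κₜ a = occ B′ a + (occ B a + (δ (2 + f) a +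
                  (δ f a + (δ h a + (occ (node p) a + κ a)))))
              protₜ = # 13 ⊕ # 10 ⊕ # 9 ⊕ # 7 ⊕ # 1 ⊕ pnode ⊕ # 3
              ys = λ a → xs a ++ occ B′ a ∷ []
              k₄ : M ≈[ (λ a → ⟦ # 3 ⊕ # 4 ⊕ # 5 ⊕ # 6 ⊕ # 0 ⟧ (xs a)) ] M₅
              k₄ = ≈-trans (≈-mono (λ a → sum≤ (xs a) (# 3 ⊕ # 4 ⊕ # 5 ⊕ # 6 ⊕ # 0) kept) k)
                           (≈-mono (λ a → sum≤ (xs a) (# 3 ⊕ # 4 ⊕ # 5 ⊕ # 6 ⊕ # 0) protᵤ) k₅)
              task : ∀ {x} → 1 ≤ occ (node (3 + f)) x → M₅ x ≡ M₄ x
              task l = k₅ _ (≤-trans l (sum≤ (xs _) (# 11) protᵤ))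
          in
          copy t κₜ
            (trans (task (at₀ (3 + f) [])) (trans (alloc-below M₃ (6 + f) 3 (2 + f) (3 + f) (3 + f)
                (m≤n+m (4 + f) 2)) (alloc₀ M₂ (3 + f) _ _ _)))
            (trans (task (at₁ (3 + f) [])) (trans (alloc-below M₃ (6 + f) 3 (2 + f) (3 + f) (4 + f)
                (m≤n+m (5 + f) 1)) (alloc₁ M₂ (3 + f) 3 _ nxt)))
            (trans (task (at₂ (3 + f) [])) (trans (alloc-below M₃ (6 + f) 3 (2 + f) (3 + f) (5 + f)
                ≤-refl) (alloc₂ M₂ (3 + f) 3 (1 + f) _)))
            (trans (k₅ (1 + f) (≤-trans (here (1 + f)) (sum≤ (xs (1 + f)) (# 8) protᵤ))) q′)
            (Rep-≈ r (≈-mono (λ a → sum≤ (xs a) (# 0) (# 3 ⊕ # 4 ⊕ # 5 ⊕ # 6 ⊕ # 0)) k₄))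
            (λ i → Forward-≈ (λ a → sum≤ (ys a) (# 3) protₜ)
                (≈-mono (λ a → sum≤ (xs a) (# 3) (# 3 ⊕ # 4 ⊕ # 5 ⊕ # 6 ⊕ # 0)) k₄) (fwd i))
            (λ a → ≤-trans (sum≤ (ys a) (# 0 ⊕ # 8 ⊕ # 11 ⊕ protₜ) (# 13 ⊕ # 10 ⊕ # 9 ⊕ protᵤ))
                (ω₅ a))
            λ { M₆ f₆ (A′ , rt′ , rt , k₆ , ω₆) → cont M₆ f₆
              ( node f ++ A′ ++ B′
              , transport (λ c → Rep M₆ ρd c (t · u) (node f ++ A′ ++ B′))
                  (sym (trans (k₆ h (≤-trans (here h) (sum≤ (ys h) (# 1) protₜ)))
                       (trans (k₅ h (≤-trans (here h) (sum≤ (xs h) (# 1) protᵤ))) h′)))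
                  (_·_ (trans (k₆ f (≤-trans (here f) (sum≤ (ys f) (# 7) protₜ)))
                         (trans (k₅ f (≤-trans (here f) (sum≤ (xs f) (# 7) protᵤ))) (trans f₀ e₀)))
                    rt′
                    (transport (λ c → Rep M₆ ρd c u B′)
                      (sym (k₆ (2 + f) (≤-trans (here (2 + f)) (sum≤ (ys (2 + f)) (# 9) protₜ))))
                      (Rep-≈ ru′ (≈-mono (λ a → sum≤ (ys a) (# 13) protₜ) k₆))))
              , _·_ (trans (k₆ p (≤-trans (here p) (sum≤ (ys p) (# 4) protₜ)))
                      (trans (k₄ p (≤-trans (here p) (sum≤ (xs p) (# 4)
                          (# 3 ⊕ # 4 ⊕ # 5 ⊕ # 6 ⊕ # 0)))) e₀))
                  (transport (λ c → Rep M₆ ρs c t A)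
                    (sym (trans (k₆ (1 + p) (≤-trans (here (1 + p))
                        (sum≤ (ys (1 + p)) (# 5) protₜ)))
                      (k₄ (1 + p) (≤-trans (here (1 + p))
                          (sum≤ (xs (1 + p)) (# 5) (# 3 ⊕ # 4 ⊕ # 5 ⊕ # 6 ⊕ # 0)))))) rt)
                  (transport (λ c → Rep M₆ ρs c u B)
                    (sym (trans (k₆ (2 + p) (≤-trans (here (2 + p))
                        (sum≤ (ys (2 + p)) (# 6) protₜ)))
                      (k₄ (2 + p) (≤-trans (here (2 + p))
                          (sum≤ (xs (2 + p)) (# 6) (# 3 ⊕ # 4 ⊕ # 5 ⊕ # 6 ⊕ # 0))))))
                    (Rep-≈ ru (≈-mono (λ a → sum≤ (ys a) (# 10) protₜ) k₆)))
              , ≈-trans (≈-mono (λ a → sum≤ (xs a) (# 3) (# 3 ⊕ # 4 ⊕ # 5 ⊕ # 6 ⊕ # 0)) k₄)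
                        (≈-mono (λ a → sum≤ (ys a) (# 3) protₜ) k₆)
              , λ a → ≤-trans (≤-reflexive (cong₂ (λ x y → x + (y + (δ h a + κ a)))
                  (occ₃ f A′ B′ a) (occ₃ p A B a)))
                  (≤-trans (sum≤ (ys a ++ occ A′ a ∷ [])
                              ((fresh ⊕ # 14 ⊕ # 13) ⊕ (pnode ⊕ # 0 ⊕ # 10) ⊕ # 1 ⊕ # 3)
                              (# 14 ⊕ # 0 ⊕ # 8 ⊕ protₜ))
                            (ω₆ a)) ) } }
    where
    f   = R 2
    sp  = R 3
    h   = M (1 + sp)
    nxt = M (2 + sp)
    p   = M h
    q   = M (1 + p)
    M₁ = M [ h ≔ f ]
    M₂ = alloc M₁ f (M p) q (M (2 + p))
    M₃ = alloc M₂ (3 + f) 3 (1 + f) nxt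
    M₄ = alloc M₃ (6 + f) 3 (2 + f) (3 + f)
    xs : ℕ → List ℕ
    xs a = occ A a ∷ δ h a ∷ occ (node sp) a ∷ κ a ∷ δ p a ∷ δ (1 + p) a ∷ δ (2 + p) a ∷
           δ f a ∷ δ (1 + f) a ∷ δ (2 + f) a ∷ occ B a ∷ occ (node (3 + f)) a ∷ occ (node (6 + f))
               a ∷ []
    pnode fresh protᵤ kept all : Sum
    pnode = # 4 ⊕ # 5 ⊕ # 6 ⊕ # 99
    fresh = # 7 ⊕ # 8 ⊕ # 9 ⊕ # 99
    κᵤ : ℕ → ℕ
    κᵤ a = occ (node (3 + f)) a + (δ f a + (δ (1 + f) a +
        (δ h a + (occ (node p) a + (occ A a + κ a)))))
    protᵤ = # 11 ⊕ # 7 ⊕ # 8 ⊕ # 1 ⊕ pnode ⊕ # 0 ⊕ # 3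
    kept  = # 0 ⊕ # 10 ⊕ pnode ⊕ # 3
    all = # 0 ⊕ # 1 ⊕ # 2 ⊕ # 3 ⊕ # 4 ⊕ # 5 ⊕ # 6 ⊕ # 10
    size : suc (∣ u ∣ + (∣ t ∣ + T)) ≡ ∣ t ∣ + ∣ u ∣ + 1 + T
    size rewrite sym (+-assoc ∣ u ∣ ∣ t ∣ T) | +-comm (∣ t ∣ + ∣ u ∣) 1 | +-comm ∣ u ∣ ∣ t ∣ = refl
    ω₀ : ∀ a → ⟦ all ⟧ (xs a) ≤ ι f a
    ω₀ a = ≤-trans (≤-trans (sum≤ (xs a) all ((pnode ⊕ # 0 ⊕ # 10) ⊕ # 1 ⊕ # 2 ⊕ # 3))
             (≤-reflexive (cong (_+ (δ h a + (occ (node sp) a + κ a))) (sym (occ₃ p A B a))))) (ω a)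
    kept≤ : ∀ a → ⟦ kept ⟧ (xs a) ≤ ι f a
    kept≤ a = ≤-trans (sum≤ (xs a) kept all) (ω₀ a)
    k : M ≈[ (λ a → ⟦ kept ⟧ (xs a)) ] M₄
    k = ≈-trans (≔-≈ M h f (off {f} (≤-trans (sum≤ (xs h) (# 1 ⊕ kept) all) (ω₀ h))))
       (≈-trans (alloc-≈ M₁ f (M p) q (M (2 + p)) kept≤)
       (≈-trans (alloc-≈ M₂ (3 + f) 3 (1 + f) nxt λ a → ≤-trans (kept≤ a) (ι-step f a))
                (alloc-≈ M₃ (6 + f) 3 (2 + f) (3 + f)
                  λ a → ≤-trans (kept≤ a) (≤-trans (ι-step f a) (ι-step (3 + f) a)))))
    low : ∀ x → x < 3 + f → M₄ x ≡ M₂ x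
    low x l = trans (alloc-below M₃ (6 + f) 3 (2 + f) (3 + f) x (≤-trans l (m≤n+m (3 + f) 3)))
                    (alloc-below M₂ (3 + f) 3 (1 + f) nxt x l)
    f₀ : M₄ f ≡ M p
    f₀ = trans (low f (m≤n+m (suc f) 2)) (alloc₀ M₁ f _ _ _)
    q′ : M₄ (1 + f) ≡ q
    q′ = trans (low (1 + f) (m≤n+m (2 + f) 1)) (alloc₁ M₁ f (M p) _ (M (2 + p)))
    r′ : M₄ (2 + f) ≡ M (2 + p)
    r′ = trans (low (2 + f) ≤-refl) (alloc₂ M₁ f (M p) q _)
    h<f : h < f
    h<f = ≰⇒> λ f≤h → 1≰0 (≤-trans (here h) (≤-trans (sum≤ (xs h) (# 1) all) (ω₀ h)))
        (ι-beyond f h f≤h)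
    h′ : M₄ h ≡ f
    h′ = trans (low h (≤-trans h<f (m≤n+m f 3)))
           (trans (alloc-below M₁ f (M p) q (M (2 + p)) h h<f) (hit M h f))

-- Bounded abstractions, and environments in memory

size-rename : ∀ {n m} (ρ : Fin n → Fin m) (t : Term plain n) → ∣ rename ρ t ∣ ≡ ∣ t ∣
size-rename ρ (var i) = refl
size-rename ρ (con a) = refl
size-rename ρ (ƛ t)   = cong (_+ 1) (size-rename (ext ρ) t)
size-rename ρ (t · u) = cong₂ (λ x y → x + y + 1) (size-rename ρ t) (size-rename ρ u)

-- Only abstractions are bounded. Applications outside them may grow along a derivation, but what is
-- copied is an abstraction, and what a contraction starts to evaluate is the body of one.
data Small (N : ℕ) {n} : Term plain n → Set where
  var : ∀ {i} → Small N (var i)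
  con : ∀ {a} → Small N (con a)
  ƛ_  : ∀ {t} → ∣ ƛ t ∣ ≤ N → Small N (ƛ t)
  _·_ : ∀ {t u} → Small N t → Small N u → Small N (t · u)

size⇒Small : ∀ {N n} (t : Term plain n) → ∣ t ∣ ≤ N → Small N t
size⇒Small (var i) p = var
size⇒Small (con a) p = con
size⇒Small (ƛ t)   p = ƛ p
size⇒Small (t · u) p =
  size⇒Small t (≤-trans (≤-trans (m≤m+n _ ∣ u ∣) (m≤m+n _ 1)) p) ·
  size⇒Small u (≤-trans (≤-trans (m≤n+m _ ∣ t ∣) (m≤m+n _ 1)) p)

Small-rename : ∀ {N n m} (ρ : Fin n → Fin m) {t : Term plain n} → Small N t → Small N (rename ρ t)
Small-rename ρ var           = var
Small-rename ρ con           = con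
Small-rename ρ (ƛ_ {t = t} p) = ƛ ≤-trans (≤-reflexive (size-rename ρ (ƛ t))) p
Small-rename ρ (p · q)       = Small-rename ρ p · Small-rename ρ q

data SmallEnv (N : ℕ) : ∀ {n} → Env n → Set where
  []  : SmallEnv N []
  _▷_ : ∀ {n} {E : Env n} {c} → SmallEnv N E → Small N c → SmallEnv N (E ▷ c)

hop-small : ∀ {N n} {E : Env n} x {v} → SmallEnv N E → hop E x ≡ head v → ∣ ƛ v ∣ ≤ N
hop-small {E = E ▷ c} (suc i) (s ▷ _) eq with hop E i in eq′
hop-small {N} {E = E ▷ c} (suc i) (s ▷ _) refl | head v =
  ≤-trans (≤-reflexive (size-rename suc (ƛ v))) (hop-small i s eq′)
hop-small {E = E ▷ (ƛ v)} zero (s ▷ (ƛ p)) refl = ≤-trans (≤-reflexive (size-rename suc (ƛ v))) p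
hop-small {E = E ▷ var y} zero s eq with hop E y
hop-small {E = E ▷ var y} zero s () | head _
hop-small {E = E ▷ var y} zero s () | env _
hop-small {E = E ▷ var y} zero s () | stuck

pending : ∀ {n} → Term plain n → ℕ
pending (var _) = 1
pending _       = 0

-- A potential: every replacement inside a chain turns a variable content into a value for good, and
-- so lowers it by one.
vars : ∀ {n} → Env n → ℕ
vars []      = 0
vars (E ▷ c) = vars E + pending c

-- During the run the tag of an explicit substitution is 5 if its content unfolds to an inert term.
data Flag : Term plain 0 → ℕ → Set where
  abs   : ∀ {t} → Flag (ƛ t) 4
  inert : ∀ {t} → Inert t → Flag t 5

Flag-tag : ∀ {t x} → Flag t x → ∃[ m ] x ∸ 2 ≡ suc m
Flag-tag abs       = 1 , refl
Flag-tag (inert _) = 2 , refl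

data EnvRep (M : ℕ → ℕ) : ∀ {n} → ℕ → Vec ℕ n → Env n → List ℕ → Set where
  []   : ∀ {e} → M e ≡ 0 → EnvRep M e [] [] (e ∷ [])
  bind : ∀ {n} {ρ : Vec ℕ n} {E : Env n} {c q e r A B} →
        Flag (subst (unfold E) c) (M q) → M (1 + q) ≡ e → M (2 + q) ≡ r →
        Rep M ρ r c A → EnvRep M e ρ E B → EnvRep M q (q ∷ ρ) (E ▷ c) (node q ++ A ++ B)

occ-⊆ᵐ : ∀ p A B a → occ A a ≤ occ (node p ++ A ++ B) a
occ-⊆ᵐ p A B a = ≤-trans (occ-⊆ˡ A B a) (occ-⊆ʳ (node p) (A ++ B) a)

occ-⊆ᵉ : ∀ p A B a → occ B a ≤ occ (node p ++ A ++ B) a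
occ-⊆ᵉ p A B a = ≤-trans (occ-⊆ʳ A B a) (occ-⊆ʳ (node p) (A ++ B) a)

EnvRep-≈ : ∀ {M M′ n e} {ρ : Vec ℕ n} {E B} → EnvRep M e ρ E B → M ≈[ occ B ] M′ → EnvRep M′ e ρ E B
EnvRep-≈ {e = e} ([] z) k = [] (trans (k e (≤-trans (here e) (m≤m+n _ 0))) z)
EnvRep-≈ (bind {q = q} {A = A} {B} fl x y r s) k =
  bind (transport (Flag _) (sym (k q (at₀ q (A ++ B)))) fl)
      (trans (k (1 + q) (at₁ q (A ++ B))) x) (trans (k (2 + q) (at₂ q (A ++ B))) y)
      (Rep-≈ r (≈-mono (occ-⊆ᵐ q A B) k)) (EnvRep-≈ s (≈-mono (occ-⊆ᵉ q A B) k))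

env-flag : ∀ {M n e} {ρ : Vec ℕ n} {E B} → EnvRep M e ρ E B → ∀ x →
           Flag (unfold E x) (M (lookup ρ x)) × 1 ≤ occ B (lookup ρ x)
env-flag (bind {q = q} {A = A} {B} fl x y r s) zero    = fl , at₀ q (A ++ B)
env-flag (bind {q = q} {A = A} {B} fl x y r s) (suc i) =
  let fl′ , p = env-flag s i in fl′ , ≤-trans p (occ-⊆ᵉ q A B _)

Rep-strengthen : ∀ {M k n m} {ρ : Vec ℕ n} {ρ′ : Vec ℕ m} (r : Fin n → Fin m) {p} (t : Term k n)
    {A} →
                 lookup ρ′ ∘ r ≗ lookup ρ → Rep M ρ′ p (rename r t) A → Rep M ρ p t A
Rep-strengthen r (var i) e (var x y) = var x (trans y (e i))
Rep-strengthen r (con a) e (con x y) = con x y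
Rep-strengthen {ρ = ρ} {ρ′} r {p} (ƛ t) e (ƛ_ x s) =
  (ƛ x) (Rep-strengthen (ext r) t (lookup-ext {ρ = ρ} {ρ′} {r} p e) s)
Rep-strengthen r (t · u) e (_·_ x s s′) = _·_ x (Rep-strengthen r t e s) (Rep-strengthen r u e s′)
Rep-strengthen {ρ = ρ} {ρ′} r {p} (t [← u ]) e (_[←_] x s s′) =
  _[←_] x (Rep-strengthen (ext r) t (lookup-ext {ρ = ρ} {ρ′} {r} p e) s) (Rep-strengthen r u e s′)

-- The value is borrowed from the environment while it is copied. Copying alters some of its cells,
-- so `return` asks that the value be represented again and only the remaining cells be unchanged,
-- like a separating implication.
record Located (M : ℕ → ℕ) {n} (e : ℕ) (ρ : Vec ℕ n) (E : Env n) (B : List ℕ) (x : Fin n)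
               (v : Term plain (suc n)) : Set where
  field
    {cells rest} : List ℕ
    rep    : Rep M ρ (M (2 + lookup ρ x)) (ƛ v) cells
    split  : ∀ a → occ B a ≡ occ cells a + occ rest a
    binders : ∀ i → 1 ≤ occ rest (lookup ρ i)
    return : ∀ {M′} → M ≈[ occ rest ] M′ → Rep M′ ρ (M (2 + lookup ρ x)) (ƛ v) cells →
             EnvRep M′ e ρ E B

locate : ∀ {M n e} {ρ : Vec ℕ n} {E B} → EnvRep M e ρ E B → ∀ x {v} → hop E x ≡ head v →
         Located M e ρ E B x v
locate {E = E ▷ c} (bind {q = q} {A = A} {B} fl x y r s) (suc i) eq with hop E i in eq′
locate {M} {ρ = _ ∷ ρ} {E = E ▷ c} (bind {q = q} {A = A} {B} fl x y r s) (suc i) refl | head v =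
    record
  { rest   = node q ++ A ++ L.rest
  ; rep    = Rep-rename suc (λ _ → refl) L.rep
  ; split  = λ a → trans (occ₃ q A B a) (trans (cong (λ z → occ (node q) a + (occ A a + z))
      (L.split a))
               (trans (swap₃ (occ (node q) a) (occ A a) (occ L.cells a) (occ L.rest a))
                 (cong (occ L.cells a +_) (sym (occ₃ q A L.rest a)))))
  ; binders = λ { zero → at₀ q (A ++ L.rest) ; (suc j) → ≤-trans (L.binders j)
      (occ-⊆ᵉ q A L.rest _) }
  ; return = λ k r′ →
      bind (transport (Flag _) (sym (k q (at₀ q (A ++ L.rest)))) fl)
          (trans (k (1 + q) (at₁ q (A ++ L.rest))) x) (trans (k (2 + q) (at₂ q (A ++ L.rest))) y)
          (Rep-≈ r (≈-mono (occ-⊆ᵐ q A L.rest) k))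
          (L.return (≈-mono (occ-⊆ᵉ q A L.rest) k) (Rep-strengthen suc (ƛ v) (λ _ → refl) r′))
  }
  where
  module L = Located (locate s i eq′)
  swap₃ : ∀ n a c r → n + (a + (c + r)) ≡ c + (n + (a + r))
  swap₃ n a c r = ≤-antisym (sum≤ (n ∷ a ∷ c ∷ r ∷ []) (# 0 ⊕ # 1 ⊕ # 2 ⊕ # 3)
      (# 2 ⊕ # 0 ⊕ # 1 ⊕ # 3))
                            (sum≤ (n ∷ a ∷ c ∷ r ∷ []) (# 2 ⊕ # 0 ⊕ # 1 ⊕ # 3)
                                (# 0 ⊕ # 1 ⊕ # 2 ⊕ # 3))
locate {M} {E = E ▷ (ƛ v)} (bind {q = q} {A = A} {B} fl x refl r s) zero refl = record
  { rest   = node q ++ B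
  ; rep    = Rep-rename suc (λ _ → refl) r
  ; split  = λ a → trans (occ₃ q A B a) (trans (swap₂ (occ (node q) a) (occ A a) (occ B a))
               (cong (occ A a +_) (sym (occ-++ (node q) B a))))
  ; binders = λ { zero → at₀ q B ; (suc j) → ≤-trans (proj₂ (env-flag s j)) (occ-⊆ʳ (node q) B _) }
  ; return = λ k r′ →
      bind (transport (Flag _) (sym (k q (at₀ q B))) fl)
          (trans (k (1 + q) (at₁ q B)) x) (k (2 + q) (at₂ q B))
          (Rep-strengthen suc (ƛ v) (λ _ → refl) r′)
          (EnvRep-≈ s (≈-mono (occ-⊆ʳ (node q) B) k))
  }
  where
  swap₂ : ∀ n a b → n + (a + b) ≡ a + (n + b)
  swap₂ n a b = trans (sym (+-assoc n a b)) (trans (cong (_+ b) (+-comm n a)) (+-assoc a n b))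
locate {E = E ▷ var y} s zero eq with hop E y
locate {E = E ▷ var y} s zero () | head _
locate {E = E ▷ var y} s zero () | env _
locate {E = E ▷ var y} s zero () | stuck

ƛ-tag : ∀ {M k n} {ρ : Vec ℕ n} {p} {t : Term k (suc n)} {A} → Rep M ρ p (ƛ t) A → M p ≡ 2
ƛ-tag (ƛ_ x _) = x

-- Resolution of chains of substitutions

module Chase (charge : ℕ) (Res : Term shared 0 → Set) (N : ℕ) where
  open Execution charge
  open Machine charge Res

  fill : ∀ {n} (E : Env n) x {v : Term plain (suc n)} {M e ρ B sp h nxt p} (κ : ℕ → ℕ) {T b f g z} →
    EnvRep M e ρ E B → hop E x ≡ head v → ∣ ƛ v ∣ ≤ N →
    M sp ≡ 2 → M (1 + sp) ≡ h → M (2 + sp) ≡ nxt → M h ≡ p → M (1 + p) ≡ lookup ρ x →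
    (∀ a → occ B a + (δ h a + (occ (node sp) a + κ a)) ≤ ι f a) →
    (b < charge → Stop b f sp g z M T) →
    (charge ≤ b → ∀ M′ f′ A′ → Rep M′ ρ (M′ h) (ƛ v) A′ → EnvRep M′ e ρ E B → M ≈[ κ ] M′ →
      (∀ a → occ A′ a + (occ B a + (δ h a + κ a)) ≤ ι f′ a) → Loop (b ∸ charge) f′ nxt g z M′ T) →
    Loop b f sp g z M (1 + N + T)
  fill E x {v} {M} {e} {ρ} {B} {sp} {h} {nxt} κ {T} {b} {f} s hd small t₀ refl refl refl t₁ ω out
      cont R (main refl refl refl refl refl)
    with charge ≤? b
  ... | no ¬p = Halts-mono (s≤s (m≤n+m T N)) $
    iterate (iter-fill-stop R M t₀ (trans (cong (λ q → M (M (2 + q))) t₁) tag) (proj₂ positive))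
        (out (≰⇒> ¬p))
    where
    tag : M (M (2 + lookup ρ x)) ≡ 2
    tag = ƛ-tag (Located.rep (locate s x hd))
    positive : ∃[ m ] charge ∸ R 1 ≡ suc m
    positive with charge ∸ R 1 in eq
    ... | zero  = 0 , ⊥-elim (¬p (m∸n≡0⇒m≤n eq))
    ... | suc m = m , refl
  ... | yes p = Halts-mono (+-monoʳ-≤ 1 (+-monoˡ-≤ T small)) $
    iterate (iter-fill-replace R M t₀ (trans (cong (λ q → M (M (2 + q))) t₁) tag) (m≤n⇒m∸n≡0 p)) $
      copy (ƛ v) κ₁ (hit (M [ h ≔ c ]) sp 3) (k (1 + sp)
          (≤-trans (here (1 + sp)) (sum≤ (xs (1 + sp)) (# 5) kept)))
          (k (2 + sp) (≤-trans (here (2 + sp)) (sum≤ (xs (2 + sp)) (# 6) kept)))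
        (trans (miss (M [ h ≔ c ]) sp h 3 sp≢h) (hit M h c))
        (Rep-≈ rep (≈-mono (λ a → sum≤ (xs a) (# 0) kept) k))
        -- The free variables of a content are bound by substitutions, whose tags 4 and 5 exceed 2;
        -- they are forwarded to themselves.
        (λ i → Forward-≈ (λ a → sum≤ (xs a) (# 1) prot) (≈-mono (λ a → sum≤ (xs a) (# 1) kept) k)
          (binders i , inj₂ (_ , proj₂ (Flag-tag (proj₁ (env-flag s i))) , refl)))
        (λ a → ≤-trans (sum≤ (xs a) (# 0 ⊕ # 2 ⊕ (# 4 ⊕ # 5 ⊕ # 6 ⊕ # 99) ⊕ prot) all) (ω₀ a))
        λ { M′ f′ (A′ , r′ , r , k′ , ω′) → cont p M′ f′ A′ r′
              (return (≈-trans (≈-mono (λ a → sum≤ (xs a) (# 1) kept) k)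
                  (≈-mono (λ a → sum≤ (xs a) (# 1) prot) k′)) r)
              (≈-trans (≈-mono (λ a → sum≤ (xs a) (# 3) kept) k)
                  (≈-mono (λ a → sum≤ (xs a) (# 3) prot) k′))
              λ a → ≤-trans (≤-reflexive (cong (λ w → occ A′ a + (w + (δ h a + κ a))) (split a)))
                (≤-trans (sum≤ (xs a ++ occ A′ a ∷ []) (# 7 ⊕ (# 0 ⊕ # 1) ⊕ # 2 ⊕ # 3)
                    (# 7 ⊕ # 0 ⊕ # 2 ⊕ prot)) (ω′ a)) }
    where
    q = M (1 + M h)
    c = M (2 + q)
    open Located (locate s x hd) using (cells; rest; split; binders) renaming
        (rep to rep₀; return to return₀)
    rep : Rep M ρ c (ƛ v) cells
    rep = transport (λ q → Rep M ρ (M (2 + q)) (ƛ v) cells) (sym t₁) rep₀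
    return : ∀ {M′} → M ≈[ occ rest ] M′ → Rep M′ ρ c (ƛ v) cells → EnvRep M′ e ρ E B
    return k r = return₀ k (transport (λ q → Rep _ ρ (M (2 + q)) (ƛ v) cells) t₁ r)
    tag : M (M (2 + lookup ρ x)) ≡ 2
    tag = ƛ-tag (rep₀)
    M₁ = (M [ h ≔ c ]) [ sp ≔ 3 ]
    xs : ℕ → List ℕ
    xs a = occ cells a ∷ occ rest a ∷ δ h a ∷ κ a ∷ δ sp a ∷ δ (1 + sp) a ∷ δ (2 + sp) a ∷ []
    prot kept all : Sum
    prot = # 3 ⊕ # 1
    kept = # 0 ⊕ # 1 ⊕ # 3 ⊕ # 5 ⊕ # 6
    all  = # 0 ⊕ # 1 ⊕ # 2 ⊕ # 3 ⊕ # 4 ⊕ # 5 ⊕ # 6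
    κ₁ : ℕ → ℕ
    κ₁ a = κ a + occ rest a
    ω₀ : ∀ a → ⟦ all ⟧ (xs a) ≤ ι f a
    ω₀ a = ≤-trans (≤-trans (sum≤ (xs a) all ((# 0 ⊕ # 1) ⊕ # 2 ⊕ (# 4 ⊕ # 5 ⊕ # 6 ⊕ # 99) ⊕ # 3))
             (≤-reflexive (cong (_+ (δ h a + (occ (node sp) a + κ a))) (sym (split a))))) (ω a)
    sp≢h : sp ≢ h
    sp≢h eq = 1≰0 (here h) (trans (cong (λ y → δ y h) (sym eq))
      (off {f} (≤-trans (sum≤ (xs h) (# 2 ⊕ # 4) all) (ω₀ h))))
    k : M ≈[ (λ a → ⟦ kept ⟧ (xs a)) ] M₁
    k = ≈-trans (≔-≈ M h c (off {f} (≤-trans (sum≤ (xs h) (# 2 ⊕ kept) all) (ω₀ h))))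
                (≔-≈ (M [ h ≔ c ]) sp 3 (off {f} (≤-trans (sum≤ (xs sp) (# 4 ⊕ kept) all) (ω₀ sp))))

  record Resolved {n} (Q : ℕ → Env n → Set) (κ : ℕ → ℕ) (M : ℕ → ℕ) (e : ℕ) (ρ : Vec ℕ n)
      (E : Env n)
                  (M′ : ℕ → ℕ) (f′ b′ : ℕ) (E′ : Env n) : Set where
    constructor resolved
    field
      {cells} : List ℕ
      rep     : EnvRep M′ e ρ E′ cells
      agree   : M ≈[ κ ] M′
      room    : ∀ a → occ cells a + κ a ≤ ι f′ a
      same    : unfold E′ ≗ unfold E
      small   : SmallEnv N E′
      holds   : Q b′ E′

  -- The machine walks down the chain, leaving one task per variable, and replaces on the way back,
  -- beginning next to the value. Each replacement is exactly one `hop` from `x`, so `Q` is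
  -- transported step by step. A variable content refers to an older binding, hence the recursion on
  -- the telescope. The factor `2 + N` pays for one iteration down, one back and the copy.
  resolve : ∀ {n} (E : Env n) x {M e ρ B sp h p} κ (Q : ℕ → Env n → Set) {T b f g z} →
    EnvRep M e ρ E B → isƛ (unfold E x) ≡ true → SmallEnv N E →
    M sp ≡ 2 → M (1 + sp) ≡ h → M h ≡ p → M (1 + p) ≡ lookup ρ x →
    (∀ a → occ B a + κ a ≤ ι f a) → Q b E →
    (∀ {b E E′} → Q b E → hop E x ≡ env E′ → charge ≤ b → Q (b ∸ charge) E′) →
    (∀ {M′ f′ b′ E′ sp′} → Resolved Q κ M e ρ E M′ f′ b′ E′ → b′ < charge → Stop b′ f′ sp′ g z M′
        T) →
    (∀ {M′ f′ b′ E′ v} → Resolved Q κ M e ρ E M′ f′ b′ E′ → hop E′ x ≡ head v →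
       Loop b′ f′ sp g z M′ (vars E′ * (2 + N) + T)) →
    Loop b f sp g z M (vars E * (2 + N) + T)
  resolve (E ▷ c) (suc i) {M} κ Q {T} (bind {ρ = ρ} {q = q} {e} {r} {A} {B} fl x₁ x₂ rep s) isl
      (sm ▷ sc) t₀ t₁ t₂ t₃ ω Qb hops out ready =
    Loop-mono (≤-reflexive (shift (vars E) (pending c))) $
    resolve E i κ₁ (λ b E → Q b (E ▷ c)) s isl sm t₀ t₁ t₂ t₃
      (λ a → ≤-trans (sum≤ (xs a) (# 0 ⊕ # 3 ⊕ # 1 ⊕ # 2) ((# 1 ⊕ # 2 ⊕ # 0) ⊕ # 3))
        (≤-trans (≤-reflexive (cong (_+ κ a) (sym (occ₃ q A B a)))) (ω a)))
      Qb (λ Qb eq → hops Qb (cong (weaken c) eq))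
      (λ res lt R′ m → Halts-mono (m≤n+m T (pending c * (2 + N))) (out (extend res) lt R′ m))
      (λ {_} {_} {_} {E′} res eq → Loop-mono (≤-reflexive (sym (shift (vars E′) (pending c)))) $
         ready (extend res) (cong (weaken c) eq))
    where
    κ₁ : ℕ → ℕ
    κ₁ a = κ a + (occ (node q) a + occ A a)
    xs : ℕ → List ℕ
    xs a = occ B a ∷ occ (node q) a ∷ occ A a ∷ κ a ∷ []
    shift : ∀ k m → k * (2 + N) + (m * (2 + N) + T) ≡ (k + m) * (2 + N) + T
    shift k m rewrite *-distribʳ-+ (2 + N) k m = sym (+-assoc (k * (2 + N)) _ T)
    extend : ∀ {M′ f′ b′ E′} → Resolved (λ b E → Q b (E ▷ c)) κ₁ M e ρ E M′ f′ b′ E′ →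
             Resolved Q κ M q (q ∷ ρ) (E ▷ c) M′ f′ b′ (E′ ▷ c)
    extend {M′} {f′} {b′} {E′} (resolved {B′} rep′ k ω′ same small Q′) = resolved
      (bind (transport (Flag _) (sym (kq q (at₀ q [])))
          (transport (λ t → Flag t (M q)) (subst-cong (λ j → sym (same j)) c) fl))
            (trans (kq (1 + q) (at₁ q [])) x₁) (trans (kq (2 + q) (at₂ q [])) x₂)
            (Rep-≈ rep (≈-mono (λ a → sum≤ (xs a) (# 2) (# 3 ⊕ # 1 ⊕ # 2)) k)) rep′)
      (≈-mono (λ a → sum≤ (xs a) (# 3) (# 3 ⊕ # 1 ⊕ # 2)) k)
      (λ a → ≤-trans (≤-reflexive (cong (_+ κ a) (occ₃ q A B′ a)))
        (≤-trans (sum≤ (xs a ++ occ B′ a ∷ []) ((# 1 ⊕ # 2 ⊕ # 4) ⊕ # 3) (# 4 ⊕ # 3 ⊕ # 1 ⊕ # 2))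
            (ω′ a)))
      (◂-cong (subst-cong same c) same) (small ▷ sc) Q′
      where
      kq : M ≈[ occ (node q) ] M′
      kq = ≈-mono (λ a → sum≤ (xs a) (# 1) (# 3 ⊕ # 1 ⊕ # 2)) k
  resolve (E ▷ (ƛ v)) zero κ Q s isl sm t₀ t₁ t₂ t₃ ω Qb hops out ready =
    ready (resolved s (λ _ _ → refl) ω (λ _ → refl) sm Qb) refl
  resolve (E ▷ con _) zero κ Q s () sm t₀ t₁ t₂ t₃ ω Qb hops out ready
  resolve (E ▷ (_ · _)) zero κ Q s () sm t₀ t₁ t₂ t₃ ω Qb hops out ready
  resolve (E ▷ var y) zero {M} κ Q {T} (bind {ρ = ρ} {q = q} {e} {A = A} {B} fl x₁ refl
      rep@(var e₀ e₁) s) isl (sm ▷ _) t₀ refl refl t₃ ω Qb hops out ready R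
      (main refl refl refl refl refl) =
    Halts-mono (≤-reflexive cost) $
    iterate (iter-fill-follow R M t₀ (trans (cong (λ q → M (M (2 + q))) t₃) e₀)) $
    transport (λ q → Loop (R 1) (3 + f) f (R 4) (R 12) (alloc M f 2 (2 + q) sp)
        (vars E * (2 + N) + (1 + N + T))) (sym t₃) $
    resolve E y κ₁ (λ b E → Q b (E ▷ var y)) (EnvRep-≈ s (≈-mono (λ a → sum≤ (xs a) (# 0) kept) k))
        isl sm
      (alloc₀ M f _ _ _) (alloc₁ M f 2 _ sp) (k (2 + q)
          (≤-trans (here (2 + q)) (sum≤ (xs (2 + q)) (# 3) kept)))
      (trans (k (1 + r) (≤-trans (at₁ r []) (sum≤ (xs (1 + r)) (# 4) kept))) e₁)
      (λ a → ≤-trans (sum≤ (xs a) (# 0 ⊕ prot) (# 6 ⊕ kept)) (bump (ω₀ a)))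
      Qb
      (λ {b} {E₁} {E₂} Qb eq → hops Qb (hop-env eq))
      (λ res lt R′ m → Halts-mono (m≤n+m T (1 + N)) (out (back res) lt R′ m))
      ready₁
    where
    f  = R 2
    sp = R 3
    r  = M (2 + q)
    xs : ℕ → List ℕ
    xs a = occ B a ∷ δ q a ∷ δ (1 + q) a ∷ δ (2 + q) a ∷ occ (node r) a ∷ κ a ∷ occ (node f) a ∷ []
    κ₁ : ℕ → ℕ
    κ₁ a = κ a + (occ (node f) a + (occ (node q) a + occ (node r) a))
    prot kept : Sum
    prot = # 5 ⊕ # 6 ⊕ (# 1 ⊕ # 2 ⊕ # 3 ⊕ # 99) ⊕ # 4
    kept = ((# 1 ⊕ # 2 ⊕ # 3 ⊕ # 99) ⊕ # 4 ⊕ # 0) ⊕ # 5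
    ω₀ : ∀ a → ⟦ kept ⟧ (xs a) ≤ ι f a
    ω₀ a = ≤-trans (≤-reflexive (cong (_+ κ a) (sym (occ₃ q A B a)))) (ω a)
    M₁ = alloc M f 2 (2 + q) sp
    k : M ≈[ (λ a → ⟦ kept ⟧ (xs a)) ] M₁
    k = alloc-≈ M f 2 (2 + q) sp ω₀
    cost : suc (vars E * (2 + N) + (1 + N + T)) ≡ (vars E + 1) * (2 + N) + T
    cost rewrite *-distribʳ-+ (2 + N) (vars E) 1 | +-identityʳ N | +-assoc (vars E * (2 + N))
        (2 + N) T =
      sym (+-suc (vars E * (2 + N)) (1 + N + T))
    hop-env : ∀ {E₁ E₂} → hop E₁ y ≡ env E₂ → hop (E₁ ▷ var y) zero ≡ env (E₂ ▷ var y)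
    hop-env eq rewrite eq = refl
    hop-head′ : ∀ {E₁ v} → hop E₁ y ≡ head v → hop (E₁ ▷ var y) zero ≡ env (E₁ ▷ (ƛ v))
    hop-head′ eq rewrite eq = refl
    Qʸ : ℕ → Env _ → Set
    Qʸ b E = Q b (E ▷ var y)
    through : ∀ {M₂ κ′} → (∀ a → κ′ a ≤ ⟦ kept ⟧ (xs a)) → (∀ a → κ′ a ≤ ⟦ prot ⟧ (xs a)) → M₁ ≈[
        κ₁ ] M₂ → M ≈[ κ′ ] M₂
    through i j k₁ = ≈-trans (≈-mono i k) (≈-mono j k₁)
    back : ∀ {M₂ f′ b′ E₁} → Resolved Qʸ κ₁ M₁ e ρ E M₂ f′ b′ E₁ →
           Resolved Q κ M q (q ∷ ρ) (E ▷ var y) M₂ f′ b′ (E₁ ▷ var y)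
    back {M₂} (resolved {B₁} rep₁ k₁ ω₁ same small Q₁) = resolved
      (bind (transport (Flag _) (sym (kq q (at₀ q [])))
          (transport (λ t → Flag t (M q)) (sym (same y)) fl))
            (trans (kq (1 + q) (at₁ q [])) x₁) (kq (2 + q) (at₂ q []))
                (Rep-≈ rep (through (λ a → sum≤ (xs a) (# 4) kept) (λ a → sum≤ (xs a) (# 4) prot)
                k₁)) rep₁)
      (through (λ a → sum≤ (xs a) (# 5) kept) (λ a → sum≤ (xs a) (# 5) prot) k₁)
      (λ a → ≤-trans (≤-reflexive (cong (_+ κ a) (occ₃ q A B₁ a)))
        (≤-trans (sum≤ (xs a ++ occ B₁ a ∷ []) (((# 1 ⊕ # 2 ⊕ # 3 ⊕ # 99) ⊕ # 4 ⊕ # 7) ⊕ # 5)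
            (# 7 ⊕ prot)) (ω₁ a)))
      (◂-cong (same y) same) (small ▷ var) Q₁
      where
      kq : M ≈[ occ (node q) ] M₂
      kq = through (λ a → sum≤ (xs a) (# 1 ⊕ # 2 ⊕ # 3 ⊕ # 99) kept)
          (λ a → sum≤ (xs a) (# 1 ⊕ # 2 ⊕ # 3 ⊕ # 99) prot) k₁
    ready₁ : ∀ {M₂ f₂ b₂ E₁ v} → Resolved Qʸ κ₁ M₁ e ρ E M₂ f₂ b₂ E₁ → hop E₁ y ≡ head v →
             Loop b₂ f₂ f (R 4) (R 12) M₂ (vars E₁ * (2 + N) + (1 + N + T))
    ready₁ {M₂} {f₂} {b₂} {E₁} {v} res@(resolved {B₁} rep₁ k₁ ω₁ same small Q₁) eq =
      Loop-mono (≤-reflexive arith) $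
      fill E₁ y κ₂ rep₁ eq (hop-small y small eq)
        (trans (k₁ f (≤-trans (at₀ f []) (sum≤ (xs f) (# 6) prot))) (alloc₀ M f _ _ _))
        (trans (k₁ (1 + f) (≤-trans (at₁ f []) (sum≤ (xs (1 + f)) (# 6) prot))) (alloc₁ M f 2 _ sp))
        (trans (k₁ (2 + f) (≤-trans (at₂ f []) (sum≤ (xs (2 + f)) (# 6) prot)))
            (alloc₂ M f 2 (2 + q) _))
        (kq (2 + q) (at₂ q []))
        (trans (through (λ a → sum≤ (xs a) (# 4) kept) (λ a → sum≤ (xs a) (# 4) prot) k₁ (1 + r)
            (at₁ r [])) e₁)
        (λ a → ≤-trans (sum≤ (xs a ++ occ B₁ a ∷ []) (# 7 ⊕ # 3 ⊕ # 6 ⊕ # 5 ⊕ # 1 ⊕ # 2)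
            (# 7 ⊕ prot)) (ω₁ a))
        (λ lt R′ m → Halts-mono (m≤n+m T (vars E₁ * (2 + N))) (out (back res) lt R′ m))
        λ le M₃ f₃ A′ r′ s′ k₃ ω₃ →
          let kq₃ : M ≈[ (λ a → δ q a + δ (1 + q) a) ] M₃
              kq₃ = ≈-trans (≈-mono (λ a → sum≤ (xs a) (# 1 ⊕ # 2) (# 1 ⊕ # 2 ⊕ # 3 ⊕ # 99)) kq)
                            (≈-mono (λ a → sum≤ (xs a) (# 1 ⊕ # 2) (# 5 ⊕ # 1 ⊕ # 2)) k₃)
          in
          Loop-mono (≤-reflexive (cong (λ m → m * (2 + N) + T) (+-identityʳ (vars E₁)))) $
          ready (resolved
            (bind (transport (Flag _) (sym (kq₃ q (≤-trans (here q) (m≤m+n _ _))))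
                    (transport (λ t → Flag t (M q)) (trans (sym (same y)) (unfold-head E₁ y eq))
                        fl))
                  (trans (kq₃ (1 + q) (≤-trans (here (1 + q)) (m≤n+m _ (δ q (1 + q))))) x₁) refl r′
                      s′)
            (≈-trans (through (λ a → sum≤ (xs a) (# 5) kept) (λ a → sum≤ (xs a) (# 5) prot) k₁)
                     (≈-mono (λ a → sum≤ (xs a) (# 5) (# 5 ⊕ # 1 ⊕ # 2)) k₃))
            (λ a → ≤-trans (≤-reflexive (cong (_+ κ a) (occ₃ q A′ B₁ a)))
              (≤-trans (sum≤ (xs a ++ occ B₁ a ∷ occ A′ a ∷ [])
                          (((# 1 ⊕ # 2 ⊕ # 3 ⊕ # 99) ⊕ # 8 ⊕ # 7) ⊕ # 5)
                              (# 8 ⊕ # 7 ⊕ # 3 ⊕ # 5 ⊕ # 1 ⊕ # 2)) (ω₃ a)))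
            (◂-cong (trans (sym (unfold-head E₁ y eq)) (same y)) same)
            (small ▷ (ƛ hop-small y small eq))
            (hops Q₁ (hop-head′ eq) le))
            refl
      where
      κ₂ : ℕ → ℕ
      κ₂ a = κ a + (δ q a + δ (1 + q) a)
      arith : 1 + N + (vars E₁ * (2 + N) + T) ≡ vars E₁ * (2 + N) + (1 + N + T)
      arith = trans (sym (+-assoc (1 + N) (vars E₁ * (2 + N)) T))
                (trans (cong (_+ T) (+-comm (1 + N) (vars E₁ * (2 + N))))
                    (+-assoc (vars E₁ * (2 + N)) (1 + N) T))
      kq : M ≈[ occ (node q) ] M₂
      kq = through (λ a → sum≤ (xs a) (# 1 ⊕ # 2 ⊕ # 3 ⊕ # 99) kept)
          (λ a → sum≤ (xs a) (# 1 ⊕ # 2 ⊕ # 3 ⊕ # 99) prot) k₁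

-- `Stack M ρ z F sp h B`: the tasks from sp on are those of the frames F, whose hole is the cell h;
-- z is the cell that points to the whole term, and B does not include h.
data Stack (M : ℕ → ℕ) {n} (ρ : Vec ℕ n) (z : ℕ) : Frames n → ℕ → ℕ → List ℕ → Set where
  []    : ∀ {sp} → M sp ≡ 4 → Stack M ρ z [] sp z (sp ∷ [])
  left  : ∀ {sp h sp′ p r f A F B} →
          M sp ≡ 1 → M (1 + sp) ≡ h → M (2 + sp) ≡ sp′ → M h ≡ p → M p ≡ 3 → M (2 + p) ≡ r →
          Rep M ρ r f A → Stack M ρ z F sp′ h B →
          Stack M ρ z (left f ∷ F) sp (1 + p) (node sp ++ p ∷ 2 + p ∷ h ∷ A ++ B)
  right : ∀ {sp sp₁ h sp′ p r t A F B} →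
          M sp ≡ 0 → M (1 + sp) ≡ 1 + p → M (2 + sp) ≡ sp₁ →
          M sp₁ ≡ 1 → M (1 + sp₁) ≡ h → M (2 + sp₁) ≡ sp′ → M h ≡ p → M p ≡ 3 → M (1 + p) ≡ r →
          Rep M ρ r t A → Stack M ρ z F sp′ h B →
          Stack M ρ z (right t ∷ F) sp (2 + p) (node sp ++ node sp₁ ++ p ∷ 1 + p ∷ h ∷ A ++ B)

occˡ : ∀ sp p h A B a → occ (node sp ++ p ∷ 2 + p ∷ h ∷ A ++ B) a ≡
       occ (node sp) a + (δ p a + (δ (2 + p) a + (δ h a + (occ A a + occ B a))))
occˡ sp p h A B a = trans (occ-++ (node sp) (p ∷ 2 + p ∷ h ∷ A ++ B) a)
  (cong (λ x → occ (node sp) a + (δ p a + (δ (2 + p) a + (δ h a + x)))) (occ-++ A B a))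

occʳ : ∀ sp sp₁ p h A B a → occ (node sp ++ node sp₁ ++ p ∷ 1 + p ∷ h ∷ A ++ B) a ≡
       occ (node sp) a + (occ (node sp₁) a + (δ p a + (δ (1 + p) a +
           (δ h a + (occ A a + occ B a)))))
occʳ sp sp₁ p h A B a = trans (occ-++ (node sp) (node sp₁ ++ p ∷ 1 + p ∷ h ∷ A ++ B) a)
  (cong (occ (node sp) a +_) (trans (occ-++ (node sp₁) (p ∷ 1 + p ∷ h ∷ A ++ B) a)
    (cong (λ x → occ (node sp₁) a + (δ p a + (δ (1 + p) a + (δ h a + x)))) (occ-++ A B a))))

Stack-≈ : ∀ {M M′ n} {ρ : Vec ℕ n} {z F sp h B} → Stack M ρ z F sp h B → M ≈[ occ B ] M′ → Stack M′
    ρ z F sp h B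
Stack-≈ ([] {sp} x) k = [] (trans (k sp (≤-trans (here sp) (m≤m+n _ 0))) x)
Stack-≈ {M} {M′} (left {sp} {h} {sp′} {p} {r} {f} {A} {F} {B} t₀ t₁ t₂ x y w rep s) k =
  left (trans (k₁ (at₀ sp [])) t₀) (trans (k₁ (at₁ sp [])) t₁) (trans (k₁ (at₂ sp [])) t₂)
    (trans (k₀ h (≤-trans (here h) (sum≤ (xs h) (# 3) all))) x)
    (trans (k₀ p (≤-trans (here p) (sum≤ (xs p) (# 1) all))) y)
    (trans (k₀ (2 + p) (≤-trans (here (2 + p)) (sum≤ (xs (2 + p)) (# 2) all))) w)
    (Rep-≈ rep (≈-mono (λ a → sum≤ (xs a) (# 4) all) k₀))
        (Stack-≈ s (≈-mono (λ a → sum≤ (xs a) (# 5) all) k₀))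
  where
  xs : ℕ → List ℕ
  xs a = occ (node sp) a ∷ δ p a ∷ δ (2 + p) a ∷ δ h a ∷ occ A a ∷ occ B a ∷ []
  all = # 0 ⊕ # 1 ⊕ # 2 ⊕ # 3 ⊕ # 4 ⊕ # 5
  k₀ : M ≈[ (λ a → ⟦ all ⟧ (xs a)) ] M′
  k₀ = ≈-mono (λ a → ≤-reflexive (sym (occˡ sp p h A B a))) k
  k₁ : ∀ {x} → 1 ≤ occ (node sp) x → M′ x ≡ M x
  k₁ {x} l = k₀ x (≤-trans l (sum≤ (xs x) (# 0) all))
Stack-≈ {M} {M′} (right {sp} {sp₁} {h} {sp′} {p} {r} {f} {A} {F} {B} t₀ t₁ t₂ u₀ u₁ u₂ x y w rep s)
    k =
  right (trans (k₁ (at₀ sp [])) t₀) (trans (k₁ (at₁ sp [])) t₁) (trans (k₁ (at₂ sp [])) t₂)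
    (trans (k₂ (at₀ sp₁ [])) u₀) (trans (k₂ (at₁ sp₁ [])) u₁) (trans (k₂ (at₂ sp₁ [])) u₂)
    (trans (k₀ h (≤-trans (here h) (sum≤ (xs h) (# 3) all))) x)
    (trans (k₀ p (≤-trans (here p) (sum≤ (xs p) (# 1) all))) y)
    (trans (k₀ (1 + p) (≤-trans (here (1 + p)) (sum≤ (xs (1 + p)) (# 2) all))) w)
    (Rep-≈ rep (≈-mono (λ a → sum≤ (xs a) (# 4) all) k₀))
        (Stack-≈ s (≈-mono (λ a → sum≤ (xs a) (# 5) all) k₀))
  where
  xs : ℕ → List ℕ
  xs a = occ (node sp) a ∷ δ p a ∷ δ (1 + p) a ∷ δ h a ∷ occ A a ∷ occ B a ∷ occ (node sp₁) a ∷ []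
  all = # 0 ⊕ # 6 ⊕ # 1 ⊕ # 2 ⊕ # 3 ⊕ # 4 ⊕ # 5
  k₀ : M ≈[ (λ a → ⟦ all ⟧ (xs a)) ] M′
  k₀ = ≈-mono (λ a → ≤-reflexive (sym (occʳ sp sp₁ p h A B a))) k
  k₁ : ∀ {x} → 1 ≤ occ (node sp) x → M′ x ≡ M x
  k₁ {x} l = k₀ x (≤-trans l (sum≤ (xs x) (# 0) all))
  k₂ : ∀ {x} → 1 ≤ occ (node sp₁) x → M′ x ≡ M x
  k₂ {x} l = k₀ x (≤-trans l (sum≤ (xs x) (# 6) all))

Stack-weaken : ∀ {M n} {ρ : Vec ℕ n} {q z F sp h B} → Stack M ρ z F sp h B →
               Stack M (q ∷ ρ) z (mapᶠ (rename suc) F) sp h B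
Stack-weaken ([] x) = [] x
Stack-weaken (left t₀ t₁ t₂ x y w rep s) =
  left t₀ t₁ t₂ x y w (Rep-rename suc (λ _ → refl) rep) (Stack-weaken s)
Stack-weaken (right t₀ t₁ t₂ u₀ u₁ u₂ x y w rep s) =
  right t₀ t₁ t₂ u₀ u₁ u₂ x y w (Rep-rename suc (λ _ → refl) rep) (Stack-weaken s)

-- Evaluation works in place: when the tasks are forgotten, the cell `z` still leads to the whole
-- term. The machine can therefore stop at any moment.
Stack-plug : ∀ {M n} {ρ : Vec ℕ n} {z F sp h B τ A} → Stack M ρ z F sp h B → Rep M ρ (M h) τ A →
             ∃[ A′ ] Rep M ρ (M z) (plug F τ) A′ × (∀ a → occ A′ a ≤ occ B a + (δ h a + occ A a))
Stack-plug {z = z} {A = A} ([] {sp} x) r =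
  A , r , λ a → ≤-trans (m≤n+m (occ A a) (δ z a)) (m≤n+m (δ z a + occ A a) (occ (sp ∷ []) a))
Stack-plug {A = D} (left {sp} {h} {sp′} {p} {r} {f} {A} {F} {B} t₀ t₁ t₂ refl y refl rep s) r′
  with Stack-plug s (_·_ y r′ rep)
... | A′ , r″ , i = A′ , r″ , λ a → ≤-trans (i a)
  (≤-trans (≤-reflexive (cong (λ x → occ B a + (δ h a + x)) (occ₃ p D A a)))
    (≤-trans (sum≤ (occ (node sp) a ∷ δ p a ∷ δ (2 + p) a ∷ δ h a ∷ occ A a ∷ occ B a ∷ δ (1 + p) a
        ∷ occ D a ∷ [])
                (# 5 ⊕ # 3 ⊕ (# 1 ⊕ # 6 ⊕ # 2 ⊕ # 99) ⊕ # 7 ⊕ # 4)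
                ((# 0 ⊕ # 1 ⊕ # 2 ⊕ # 3 ⊕ # 4 ⊕ # 5) ⊕ # 6 ⊕ # 7))
      (≤-reflexive (cong (_+ (δ (1 + p) a + occ D a)) (sym (occˡ sp p h A B a))))))
Stack-plug {A = D} (right {sp} {sp₁} {h} {sp′} {p} {r} {f} {A} {F} {B} t₀ t₁ t₂ u₀ u₁ u₂ refl y
    refl rep s) r′
  with Stack-plug s (_·_ y rep r′)
... | A′ , r″ , i = A′ , r″ , λ a → ≤-trans (i a)
  (≤-trans (≤-reflexive (cong (λ x → occ B a + (δ h a + x)) (occ₃ p A D a)))
    (≤-trans (sum≤ (occ (node sp) a ∷ δ p a ∷ δ (1 + p) a ∷ δ h a ∷ occ A a ∷ occ B a ∷ δ (2 + p) a
        ∷ occ D a ∷ occ (node sp₁) a ∷ [])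
                (# 5 ⊕ # 3 ⊕ (# 1 ⊕ # 2 ⊕ # 6 ⊕ # 99) ⊕ # 4 ⊕ # 7)
                ((# 0 ⊕ # 8 ⊕ # 1 ⊕ # 2 ⊕ # 3 ⊕ # 4 ⊕ # 5) ⊕ # 6 ⊕ # 7))
      (≤-reflexive (cong (_+ (δ (2 + p) a + occ D a)) (sym (occʳ sp sp₁ p h A B a))))))

-- The number is the budget.
record Invariant (charge : ℕ) (Res : Term shared 0 → Set)
                 (Q : ℕ → ∀ {n} → Term plain n → Env n → Set) : Set where
  field
    done  : ∀ {n τ} {E : Env n} → Q 0 τ E → Res (wrap E (embed τ))
    final : ∀ {n b τ} {E : Env n} → Q b τ E → Fireball (subst (unfold E) τ) → b ≡ 0
    beta  : ∀ {n b F t f} {E : Env n} → Q (suc b) (plug F ((ƛ t) · f)) E → Evald (unfold E)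
        (left f ∷ F) →
            Q b (plug (mapᶠ (rename suc) F) t) (E ▷ f)
    hop₁  : ∀ {n b F x f v} {E : Env n} → Q b (plug F (var x · f)) E → Evald (unfold E)
        (left f ∷ F) →
            hop E x ≡ head v → charge ≤ b → Q (b ∸ charge) (plug F ((ƛ v) · f)) E
    hop₂  : ∀ {n b F x f} {E E′ : Env n} → Q b (plug F (var x · f)) E → Evald (unfold E)
        (left f ∷ F) →
            isƛ (unfold E x) ≡ true → hop E x ≡ env E′ → charge ≤ b → Q (b ∸ charge)
                (plug F (var x · f)) E′

-- Amortised cost and the main loop

SmallFrames : ℕ → ∀ {n} → Frames n → Set
SmallFrames N []            = ⊤
SmallFrames N (right t ∷ F) = Small N t × SmallFrames N F
SmallFrames N (left t ∷ F)  = Small N t × SmallFrames N F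

SmallFrames-weaken : ∀ {N n} (F : Frames n) → SmallFrames N F → SmallFrames N (mapᶠ (rename suc) F)
SmallFrames-weaken []            s       = tt
SmallFrames-weaken (right t ∷ F) (s , p) = Small-rename suc s , SmallFrames-weaken F p
SmallFrames-weaken (left t ∷ F)  (s , p) = Small-rename suc s , SmallFrames-weaken F p

-- The iterations owed to the pending tasks: at most two per node of a function that is still to be
-- evaluated, and one for the contraction task of each frame.
weight : ∀ {n} → Frames n → ℕ
weight []            = 0
weight (right t ∷ F) = 1 + (∣ t ∣ + (∣ t ∣ + weight F))
weight (left t ∷ F)  = 1 + weight F

weight-map : ∀ {n} (F : Frames n) → weight (mapᶠ (rename suc) F) ≡ weight F
weight-map []            = refl
weight-map (right t ∷ F) rewrite size-rename suc t | weight-map F = refl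
weight-map (left t ∷ F)  = cong suc (weight-map F)

vars-hop : ∀ {n} (E : Env n) x {E′} → hop E x ≡ env E′ → vars E′ ≤ vars E
vars-hop (E ▷ c) (suc i) eq with hop E i in eq′
vars-hop (E ▷ c) (suc i) refl | env E′ = +-monoˡ-≤ (pending c) (vars-hop E i eq′)
vars-hop (E ▷ var y) zero eq with hop E y in eq′
vars-hop (E ▷ var y) zero refl | head v = +-monoʳ-≤ (vars E) z≤n
vars-hop (E ▷ var y) zero refl | env E′ = +-monoˡ-≤ 1 (vars-hop E y eq′)

pending≤1 : ∀ {n} (c : Term plain n) → pending c ≤ 1
pending≤1 (var _) = ≤-refl
pending≤1 (con _) = z≤n
pending≤1 (ƛ _)   = z≤n
pending≤1 (_ · _) = z≤n

Flag-cases : ∀ {t x} → Flag t x → (isƛ t ≡ true × x ≡ 4) ⊎ (Inert t × x ≡ 5)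
Flag-cases abs       = inj₁ (refl , refl)
Flag-cases (inert i) = inj₂ (i , refl)

Flag-fireball : ∀ {t x} → Flag t x → Fireball t
Flag-fireball abs       = value
Flag-fireball (inert i) = inert i

module Correctness (charge : ℕ) (charge≤1 : charge ≤ 1) (Res : Term shared 0 → Set) (N : ℕ)
                   (Q : ℕ → ∀ {n} → Term plain n → Env n → Set) (inv : Invariant charge Res Q) where
  open Execution charge
  open Machine charge Res
  open Chase charge Res N
  open Invariant inv

  -- The links run from the newest substitution to the oldest, the order in which `wrap` nests them
  -- from inside. Each node is completed in place, so no memory is allocated.
  collect : ∀ {n} (E : Env n) {b : Term shared n} {R M e ρ A B} f →
    EnvRep M e ρ E B → Rep M ρ (R 0) b A → (∀ a → occ A a + occ B a ≤ ι f a) → Res (wrap E b) →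
    R 4 ≡ e → R 11 ≡ 4 → R 5 ≡ 1 → R 13 ≡ 0 → Halts ⟪ at-collect , R , M ⟫ (1 + n)
  collect [] {b} {R} {M} {A = A} f ([] z) r ω res refl r₁₁ r₅ r₁₃
    with collect-end R M z
  ... | ⟪ _ , R′ , _ ⟫ , steps , refl , refl , eq = Halts-step {T = 0} steps
    (halts {steps = 0} z≤n (end-halts R′ M)
      (A , transport (λ p → Rep M [] p b A) (sym eq) r ,
           occ⇒Unique A λ a → ≤-trans (≤-trans (m≤m+n _ _) (ω a)) (ι≤1 f a)) res)
  collect {suc n} (E ▷ c) {b} {R} {M} {A = A} f (bind {ρ = ρ} {q = q} {e} {A = C} {B} fl refl refl
      rc s) r ω res refl r₁₁ r₅ r₁₃
    with iter-collect R M (proj₂ (positive fl)) r₁₁ r₅ r₁₃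
    where
    positive : ∀ {t x} → Flag t x → ∃[ m ] x ≡ suc m
    positive abs       = 3 , refl
    positive (inert _) = 4 , refl
  ... | ⟪ _ , R′ , _ ⟫ , steps , refl , refl , e₀ , e₄ , e₁₁ , e₅ , e₁₃ = Halts-step {T = suc n}
      steps $
    collect E f (EnvRep-≈ s (≈-mono (λ a → sum≤ (xs a) (# 2) kept) k))
      (transport (λ p → Rep M′ ρ p (b [← embed c ]) (node q ++ A ++ C)) (sym e₀)
        (_[←_] (hit M₁ q 4)
          (transport (λ p → Rep M′ (q ∷ ρ) p b A) (sym (trans (miss M₁ q (1 + q) 4 (<⇒≢ ≤-refl))
              (hit M (1 + q) (R 0))))
            (Rep-≈ r (≈-mono (λ a → sum≤ (xs a) (# 0) kept) k)))
          (transport (λ p → Rep M′ ρ p (embed c) C)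
            (sym (k (2 + q) (≤-trans (here (2 + q)) (sum≤ (xs (2 + q)) (# 5) kept))))
            (Rep-≈ (Rep-embed rc) (≈-mono (λ a → sum≤ (xs a) (# 1) kept) k)))))
      (λ a → ≤-trans (≤-reflexive (cong (_+ occ B a) (occ₃ q A C a)))
        (≤-trans (sum≤ (xs a) (((# 3 ⊕ # 4 ⊕ # 5 ⊕ # 99) ⊕ # 0 ⊕ # 1) ⊕ # 2) all) (ω₀ a)))
      res e₄ e₁₁ e₅ e₁₃
    where
    M₁ = M [ 1 + q ≔ R 0 ]
    M′ = M₁ [ q ≔ 4 ]
    xs : ℕ → List ℕ
    xs a = occ A a ∷ occ C a ∷ occ B a ∷ δ q a ∷ δ (1 + q) a ∷ δ (2 + q) a ∷ []
    kept all : Sum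
    kept = # 0 ⊕ # 1 ⊕ # 2 ⊕ # 5
    all  = # 0 ⊕ (# 3 ⊕ # 4 ⊕ # 5 ⊕ # 99) ⊕ # 1 ⊕ # 2
    ω₀ : ∀ a → ⟦ all ⟧ (xs a) ≤ ι f a
    ω₀ a = ≤-trans (≤-reflexive (cong (occ A a +_) (sym (occ₃ q C B a)))) (ω a)
    k : M ≈[ (λ a → ⟦ kept ⟧ (xs a)) ] M′
    k = ≈-trans (≔-≈ M (1 + q) (R 0) (off {f} (≤-trans (sum≤ (xs (1 + q)) (# 4 ⊕ kept) all)
        (ω₀ (1 + q)))))
                (≔-≈ M₁ q 4 (off {f} (≤-trans (sum≤ (xs q) (# 3 ⊕ kept) all) (ω₀ q))))

  finish : ∀ {n} {E : Env n} {F τ M ρ e z b f sp sp′ h A B C} →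
    Stack M ρ z F sp′ h B → Rep M ρ (M h) τ A → EnvRep M e ρ E C →
    (∀ a → δ h a + (occ B a + (occ A a + occ C a)) ≤ ι f a) → Q 0 (plug F τ) E →
    Stop b f sp e z M (2 + n)
  finish {n} {E = E} {f = f} {h = h} {A} {B} {C} st r s ω q R (main refl refl refl refl refl)
    with Stack-plug st r | final-start R _
  ... | A′ , r′ , i | ⟪ _ , R′ , _ ⟫ , steps , refl , refl , e₀ , e₄ , e₁₁ , e₅ , e₁₃ =
    Halts-step {T = suc n} steps $ collect E f s
      (transport (λ p → Rep _ _ p _ A′) (sym e₀) (Rep-embed r′))
      (λ a → ≤-trans (+-monoˡ-≤ (occ C a) (i a))
        (≤-trans (sum≤ (occ B a ∷ δ h a ∷ occ A a ∷ occ C a ∷ []) ((# 0 ⊕ # 1 ⊕ # 2) ⊕ # 3)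
            (# 1 ⊕ # 0 ⊕ # 2 ⊕ # 3)) (ω a)))
      (done q) e₄ e₁₁ e₅ e₁₃

  -- W pays for filling one cell, and D for a contraction: the evaluation of the body, the later
  -- filling of the new substitution and that of the next head variable.
  W D : ℕ
  W = 2 + N
  D = 5 + (N + (N + (N + N)))

  -- The summand `n` pays for the final pass over the substitutions.
  base : ∀ {n} → Env n → ℕ → ℕ
  base {n} E b = vars E * W + (n + b * D)

  -- The summand `W` prepays the next replacement in head position: `force` spends it, and the
  -- contraction that follows restores it out of its `D`. The constant 3 leaves room for halting.
  eval-cost : ∀ {n} → Env n → Frames n → Term plain n → ℕ → ℕ
  eval-cost E F τ b = 3 + (W + (∣ τ ∣ + (∣ τ ∣ + (weight F + base E b))))

  return-cost beta-cost : ∀ {n} → Env n → Frames n → ℕ → ℕ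
  return-cost E F b = 3 + (W + (weight F + base E b))
  beta-cost   E F b = 4 + (weight F + base E b)

  stop≤ : ∀ {n} (E : Env n) (F : Frames n) b → 2 + n ≤ 3 + (weight F + base E b)
  stop≤ {n} E F b = s≤s (s≤s (≤-trans (m≤m+n n (b * D))
    (≤-trans (m≤n+m _ (vars E * W)) (≤-trans (m≤n+m (base E b) (weight F))
        (n≤1+n (weight F + base E b))))))

  record Static {n} (b : ℕ) (E : Env n) (F : Frames n) (τ : Term plain n) : Set where
    constructor static
    field
      evald       : Evald (unfold E) F
      smallEnv    : SmallEnv N E
      smallFrames : SmallFrames N F
      smallTerm   : Small N τ
      holds       : Q b (plug F τ) E

  -- `ψ` is the footprint of a task that belongs to no frame: the evaluation task on top of the
  -- stack, or nothing when the term in the hole has been evaluated.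
  record Memory {n} (M : ℕ → ℕ) (ρ : Vec ℕ n) (e z f sp h : ℕ) (E : Env n) (F : Frames n)
      (τ : Term plain n)
                (ψ : ℕ → ℕ) : Set where
    constructor memory
    field
      {B A C} : List ℕ
      stack : Stack M ρ z F sp h B
      term  : Rep M ρ (M h) τ A
      envr  : EnvRep M e ρ E C
      room  : ∀ a → ψ a + (δ h a + (occ B a + (occ A a + occ C a))) ≤ ι f a

  argument : ∀ {n} {E : Env n} {M ρ e C f r A} → Rep M ρ r f A → EnvRep M e ρ E C → Fireball
      (subst (unfold E) f) →
    (R : ℕ → ℕ) → r ≡ M (2 + M (M (1 + R 3))) → ∃[ φ ] Arg-tag R M φ × Flag (subst (unfold E) f) φ
  argument {E = E} {M} (var {i = i} x y) s fb R refl =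
    _ , var x , transport (λ q → Flag (unfold E i) (M q)) (sym y) (proj₁ (env-flag s i))
  argument (con x y) s fb R refl = _ , con x , inert con
  argument (ƛ_ x _)  s fb R refl = _ , abs x , abs
  argument (_·_ x _ _) s (inert i) R refl = _ , app x , inert i

  -- The argument `eval` is the induction hypothesis for the body of the contracted abstraction,
  -- passed explicitly so that the lemma stays outside the mutual recursion.
  beta-loop : ∀ fuel {n} {E : Env n} {F t f M ρ e sp h b g z} →
    (∀ {n} {E : Env n} {F τ M ρ e sp h sp′ b f z} → M sp ≡ 0 → M (1 + sp) ≡ h → M (2 + sp) ≡ sp′ →
       Memory M ρ e z f sp′ h E F τ (occ (node sp)) → Static b E F τ → eval-cost E F τ b ≤ fuel →
       Loop b f sp e z M (eval-cost E F τ b)) →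
    Memory M ρ e z g sp h E (left f ∷ F) (ƛ t) (λ _ → 0) → Static b E (left f ∷ F) (ƛ t) →
    beta-cost E F b ≤ suc fuel → Loop b g sp e z M (beta-cost E F b)
  beta-loop fuel {E = E} {F} {b = zero} eval
    (memory {B} {A} {C} st@(left t₀ refl refl refl y refl rf s) (ƛ_ x rt) en ω) stat c≤ R
        (main b≡ refl refl refl refl) =
    iterate (iter-beta-stop R _ t₀ x b≡) λ R′ m →
      Halts-mono (stop≤ E F 0) (finish st ((ƛ x) rt) en ω (Static.holds stat) R′
          (main (trans (Main.budget m) b≡) (Main.free m) (Main.top m) (Main.newest m)
          (Main.root m)))
  beta-loop fuel {n} {E} {F} {t} {f} {M} {ρ} {b = suc b} eval
    (memory {C = C} (left {h = h} {p = p} {A = A} {B = B} t₀ refl refl refl y refl rf s)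
        (ƛ_ {A = G} x rt) en ω)
    (static (left fb ev) se (sf , sF) (ƛ sz) q-holds) (s≤s c≤) R (main b≡ refl refl refl refl)
    with argument rf en fb R refl
  ... | φ , tag , fl =
    iterate (iter-beta R M t₀ x b≡ tag) λ R′ m → Halts-mono cost
      (eval (hit M₄ sp 0)
        (k (1 + sp) (≤-trans (here (1 + sp)) (sum≤ (xs (1 + sp)) (# 12) kept)))
        (k (2 + sp) (≤-trans (here (2 + sp)) (sum≤ (xs (2 + sp)) (# 13) kept)))
        (memory (Stack-weaken (Stack-≈ s (≈-mono (λ a → sum≤ (xs a) (# 1) kept) k)))
          (transport (λ c → Rep M₅ (q ∷ ρ) c t G) (sym h≡)
              (Rep-≈ rt (≈-mono (λ a → sum≤ (xs a) (# 2) kept) k)))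
          (bind (transport (Flag _) (sym q≡) fl) q₁≡ q₂≡
            (Rep-≈ rf (≈-mono (λ a → sum≤ (xs a) (# 0) kept) k))
            (EnvRep-≈ en (≈-mono (λ a → sum≤ (xs a) (# 3) kept) k)))
          (λ a → ≤-trans (≤-reflexive (cong (λ y → occ (node sp) a +
              (δ h a + (occ B a + (occ G a + y)))) (occ₃ q A C a)))
            (≤-trans (sum≤ (xs a) ((# 11 ⊕ # 12 ⊕ # 13 ⊕ # 99) ⊕ # 7 ⊕ # 1 ⊕ # 2 ⊕
                (# 8 ⊕ # 9 ⊕ # 10 ⊕ # 99) ⊕ # 0 ⊕ # 3) all) (ω₀ a))))
        (static (Evald-rename ev) (se ▷ sf) (SmallFrames-weaken F sF)
            (size⇒Small t (≤-trans (m≤m+n _ 1) sz))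
          (beta q-holds (left fb ev)))
        (≤-trans cost c≤) R′ m)
    where
    sp = R 3
    g  = R 2
    q  = M (1 + p)
    r  = M (2 + p)
    M₁ = M [ q ≔ φ ]
    M₂ = M₁ [ 1 + q ≔ R 4 ]
    M₃ = M₂ [ 2 + q ≔ r ]
    M₄ = M₃ [ h ≔ M (1 + q) ]
    M₅ = M₄ [ sp ≔ 0 ]
    xs : ℕ → List ℕ
    xs a = occ A a ∷ occ B a ∷ occ G a ∷ occ C a ∷ δ p a ∷ δ (1 + p) a ∷ δ (2 + p) a ∷ δ h a ∷
           δ q a ∷ δ (1 + q) a ∷ δ (2 + q) a ∷ δ sp a ∷ δ (1 + sp) a ∷ δ (2 + sp) a ∷ []
    kept all : Sum
    kept = # 0 ⊕ # 1 ⊕ # 2 ⊕ # 3 ⊕ # 12 ⊕ # 13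
    all  = # 5 ⊕ ((# 11 ⊕ # 12 ⊕ # 13 ⊕ # 99) ⊕ # 4 ⊕ # 6 ⊕ # 7 ⊕ # 0 ⊕ # 1) ⊕
           ((# 8 ⊕ # 9 ⊕ # 10 ⊕ # 99) ⊕ # 2) ⊕ # 3
    ω₀ : ∀ a → ⟦ all ⟧ (xs a) ≤ ι g a
    ω₀ a = ≤-trans (≤-reflexive (sym (cong₂ (λ y w → δ (1 + p) a + (y + (w + occ C a)))
             (occˡ sp p h A B a) (occ-++ (node q) G a)))) (ω a)
    k₅ : ∀ {κ} → κ sp ≡ 0 → M₄ ≈[ κ ] M₅
    k₅ = ≔-≈ M₄ sp 0
    k₄ : ∀ {κ} → κ h ≡ 0 → M₃ ≈[ κ ] M₄
    k₄ = ≔-≈ M₃ h (M (1 + q))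
    k₃ : ∀ {κ} → κ (2 + q) ≡ 0 → M₂ ≈[ κ ] M₃
    k₃ = ≔-≈ M₂ (2 + q) r
    k₂ : ∀ {κ} → κ (1 + q) ≡ 0 → M₁ ≈[ κ ] M₂
    k₂ = ≔-≈ M₁ (1 + q) (R 4)
    k : M ≈[ (λ a → ⟦ kept ⟧ (xs a)) ] M₅
    k = ≈-trans (≔-≈ M q φ (off {g} (≤-trans (sum≤ (xs q) (# 8 ⊕ kept) all) (ω₀ q))))
       (≈-trans (k₂ (off {g} (≤-trans (sum≤ (xs (1 + q)) (# 9 ⊕ kept) all) (ω₀ (1 + q)))))
       (≈-trans (k₃ (off {g} (≤-trans (sum≤ (xs (2 + q)) (# 10 ⊕ kept) all) (ω₀ (2 + q)))))
       (≈-trans (k₄ (off {g} (≤-trans (sum≤ (xs h) (# 7 ⊕ kept) all) (ω₀ h))))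
                (k₅ (off {g} (≤-trans (sum≤ (xs sp) (# 11 ⊕ kept) all) (ω₀ sp)))))))
    h≡ : M₅ h ≡ M (1 + q)
    h≡ = trans (k₅ {δ h} (off {g} (≤-trans (sum≤ (xs sp) (# 11 ⊕ # 7) all) (ω₀ sp))) h (here h))
        (hit M₃ h (M (1 + q)))
    q₂≡ : M₅ (2 + q) ≡ r
    q₂≡ = trans (≈-trans (k₄ {δ (2 + q)} (off {g} (≤-trans (sum≤ (xs h) (# 7 ⊕ # 10) all) (ω₀ h))))
                         (k₅ (off {g} (≤-trans (sum≤ (xs sp) (# 11 ⊕ # 10) all) (ω₀ sp)))) (2 + q)
                             (here (2 + q)))
                (hit M₂ (2 + q) r)
    q₁≡ : M₅ (1 + q) ≡ R 4
    q₁≡ = trans (≈-trans (k₃ {δ (1 + q)} (off {g} (≤-trans (sum≤ (xs (2 + q)) (# 10 ⊕ # 9) all)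
        (ω₀ (2 + q)))))
                (≈-trans (k₄ (off {g} (≤-trans (sum≤ (xs h) (# 7 ⊕ # 9) all) (ω₀ h))))
                         (k₅ (off {g} (≤-trans (sum≤ (xs sp) (# 11 ⊕ # 9) all) (ω₀ sp))))) (1 + q)
                             (here (1 + q)))
                (hit M₁ (1 + q) (R 4))
    q≡ : M₅ q ≡ φ
    q≡ = trans (≈-trans (k₂ {δ q} (off {g} (≤-trans (sum≤ (xs (1 + q)) (# 9 ⊕ # 8) all)
        (ω₀ (1 + q)))))
               (≈-trans (k₃ (off {g} (≤-trans (sum≤ (xs (2 + q)) (# 10 ⊕ # 8) all) (ω₀ (2 + q)))))
               (≈-trans (k₄ (off {g} (≤-trans (sum≤ (xs h) (# 7 ⊕ # 8) all) (ω₀ h))))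
                        (k₅ (off {g} (≤-trans (sum≤ (xs sp) (# 11 ⊕ # 8) all) (ω₀ sp)))))) q
                            (here q))
               (hit M q φ)
    t≤N : ∣ t ∣ ≤ N
    t≤N = ≤-trans (m≤m+n _ 1) sz
    -- The released `D` is `W` for the next head variable, `2 * N` for the body, `W` for the
    -- argument in case it is a variable, and 1 for the new substitution in the final pass.
    cost : eval-cost (E ▷ f) (mapᶠ (rename suc) F) t b ≤ 3 + (weight F + base E (suc b))
    cost rewrite weight-map F = s≤s (s≤s (s≤s
      (≤-trans (+-monoʳ-≤ W (+-mono-≤ t≤N (+-mono-≤ t≤N
          (+-monoʳ-≤ (weight F) (+-monoˡ-≤ (suc n + b * D)
         (≤-trans (≤-reflexive (*-distribʳ-+ W (vars E) (pending f)))
             (+-monoʳ-≤ (vars E * W) (*-monoˡ-≤ W (pending≤1 f)))))))))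
        (sum≤ (1 ∷ N ∷ weight F ∷ vars E * W ∷ n ∷ b * D ∷ [])
          ((# 0 ⊕ # 0 ⊕ # 1) ⊕ # 1 ⊕ # 1 ⊕ # 2 ⊕ (# 3 ⊕ ((# 0 ⊕ # 0 ⊕ # 1) ⊕ # 9)) ⊕
              ((# 0 ⊕ # 4) ⊕ # 5))
          (# 2 ⊕ # 3 ⊕ # 4 ⊕ (# 0 ⊕ # 0 ⊕ # 0 ⊕ # 0 ⊕ # 0 ⊕ # 1 ⊕ # 1 ⊕ # 1 ⊕ # 1) ⊕ # 5)))))

  beta-cost-mono : ∀ {n} {E E′ : Env n} {F : Frames n} {b b′} → vars E′ ≤ vars E → b′ ≤ b →
                   beta-cost E′ F b′ ≤ beta-cost E F b
  beta-cost-mono {n} {F = F} p q =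
    +-monoʳ-≤ 4 (+-monoʳ-≤ (weight F) (+-mono-≤ (*-monoˡ-≤ W p) (+-monoʳ-≤ n (*-monoˡ-≤ D q))))

  -- The head variable is filled only after its chain has been resolved. It is then bound directly
  -- to a value, so its replacement is that of `hop₁`, and a contraction follows at once.
  force : ∀ {n} {E : Env n} {F x f M ρ e sp h b g z} → isƛ (unfold E x) ≡ true → M (lookup ρ x) ≡ 4
      →
    (∀ {E′ v M′ g′ b′} → Memory M′ ρ e z g′ sp h E′ (left f ∷ F) (ƛ v) (λ _ → 0) →
       Static b′ E′ (left f ∷ F) (ƛ v) → beta-cost E′ F b′ ≤ beta-cost E F b →
       Loop b′ g′ sp e z M′ (beta-cost E′ F b′)) →
    Memory M ρ e z g sp h E (left f ∷ F) (var x) (λ _ → 0) → Static b E (left f ∷ F) (var x) →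
    Loop b g sp e z M (return-cost E (left f ∷ F) b)
  force {n} {E} {F} {x} {f} {M} {ρ} {b = b} isl x≡4 beta-go
    (memory {C = C} st@(left {sp} {h} {p = p} {A = A} {B = B} t₀ refl refl refl y refl rf s)
        rx@(var e₀ e₁) en ω)
    (static ev@(left fb evF) se sF@(sf , _) sx holds) R (main refl refl refl refl refl) =
    Halts-mono (≤-reflexive cost₁) $
    iterate (iter-apply-variable R M t₀ e₀ (trans (cong M e₁) x≡4)) $
    resolve E x κ Q′ {T = T₀} (EnvRep-≈ en (≈-mono (λ a → sum≤ (xs a) (# 3) kept) k)) isl se
      (alloc₀ M g _ _ _) (alloc₁ M g 2 _ sp₀)
      (k (1 + p) (≤-trans (here (1 + p)) (sum≤ (xs (1 + p)) (# 1) kept)))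
      (trans (k (1 + q) (≤-trans (at₁ q []) (sum≤ (xs (1 + q)) (# 2) kept))) e₁)
      (λ a → ≤-trans (sum≤ (xs a) (# 3 ⊕ # 4 ⊕ # 0 ⊕ # 1 ⊕ # 2) (# 4 ⊕ kept)) (bump (ω₀ a)))
      (holds , ev , ≤-refl , ≤-refl , isl)
      (λ { {b′} {E₁} (holds , ev , b≤ , v≤ , isl) eq c≤ →
           hop₂ holds ev isl eq c≤ , Evald-cong (unfold-env E₁ x eq) ev , ≤-trans (m∸n≤m b′ charge)
               b≤ ,
           ≤-trans (vars-hop E₁ x eq) v≤ , trans (cong isƛ (unfold-env E₁ x eq x)) isl })
      (λ res lt R′ m → Halts-mono (stop-T res) (give-up (Resolved.rep res) (agreeˢ res) (agreeˣ res)
         (λ a → ≤-trans (sum≤ (xs a ++ occ (Resolved.cells res) a ∷ []) (# 1 ⊕ # 0 ⊕ # 2 ⊕ # 5)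
             (# 5 ⊕ # 4 ⊕ # 0 ⊕ # 1 ⊕ # 2)) (Resolved.room res a))
         lt (proj₁ (Resolved.holds res)) R′ m))
      ready
    where
    sp₀ = R 3
    g = R 2
    q = M (1 + p)
    S : ℕ → ℕ
    S = occ (node sp₀ ++ p ∷ 2 + p ∷ h ∷ A ++ B)
    xs : ℕ → List ℕ
    xs a = S a ∷ δ (1 + p) a ∷ occ (node q) a ∷ occ C a ∷ occ (node g) a ∷ []
    κ : ℕ → ℕ
    κ a = occ (node g) a + (S a + (δ (1 + p) a + occ (node q) a))
    kept : Sum
    kept = # 1 ⊕ # 0 ⊕ # 2 ⊕ # 3
    ω₀ : ∀ a → ⟦ kept ⟧ (xs a) ≤ ι g a
    ω₀ = ω
    M₁ = alloc M g 2 (1 + p) sp₀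
    k : M ≈[ (λ a → ⟦ kept ⟧ (xs a)) ] M₁
    k = alloc-≈ M g 2 (1 + p) sp₀ ω₀
    T₀ : ℕ
    T₀ = 1 + N + (4 + (weight F + (n + R 1 * D)))
    -- `resolve` knows nothing of frames. Whatever the contraction needs after an unknown number of
    -- replacements is carried along in this predicate.
    Q′ : ℕ → Env n → Set
    Q′ b′ E′ = Q b′ (plug F (var x · f)) E′ × Evald (unfold E′) (left f ∷ F) × b′ ≤ R 1 × vars E′ ≤
        vars E ×
               isƛ (unfold E′ x) ≡ true
    cost₁ : suc (vars E * W + T₀) ≡ return-cost E (left f ∷ F) (R 1)
    cost₁ = ≤-antisym
      (sum≤ (1 ∷ N ∷ weight F ∷ vars E * W ∷ n ∷ R 1 * D ∷ [])
        (# 0 ⊕ # 3 ⊕ (# 0 ⊕ # 1) ⊕ (# 0 ⊕ # 0 ⊕ # 0 ⊕ # 0 ⊕ # 2 ⊕ # 4 ⊕ # 5))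
        (# 0 ⊕ # 0 ⊕ # 0 ⊕ (# 0 ⊕ # 0 ⊕ # 1) ⊕ (# 0 ⊕ # 2) ⊕ # 3 ⊕ # 4 ⊕ # 5))
      (sum≤ (1 ∷ N ∷ weight F ∷ vars E * W ∷ n ∷ R 1 * D ∷ [])
        (# 0 ⊕ # 0 ⊕ # 0 ⊕ (# 0 ⊕ # 0 ⊕ # 1) ⊕ (# 0 ⊕ # 2) ⊕ # 3 ⊕ # 4 ⊕ # 5)
        (# 0 ⊕ # 3 ⊕ (# 0 ⊕ # 1) ⊕ (# 0 ⊕ # 0 ⊕ # 0 ⊕ # 0 ⊕ # 2 ⊕ # 4 ⊕ # 5)))
    module _ {M′ f′ b′ E′} (res : Resolved Q′ κ M₁ (R 4) ρ E M′ f′ b′ E′) where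
      open Resolved res renaming (holds to holds′)
      agreeˢ : M ≈[ S ] M′
      agreeˢ = ≈-trans (≈-mono (λ a → sum≤ (xs a) (# 0) kept) k)
                       (≈-mono (λ a → sum≤ (xs a) (# 0) (# 4 ⊕ # 0 ⊕ # 1 ⊕ # 2)) agree)
      agreeˣ : M ≈[ (λ a → δ (1 + p) a + occ (node q) a) ] M′
      agreeˣ = ≈-trans (≈-mono (λ a → sum≤ (xs a) (# 1 ⊕ # 2) kept) k)
                       (≈-mono (λ a → sum≤ (xs a) (# 1 ⊕ # 2) (# 4 ⊕ # 0 ⊕ # 1 ⊕ # 2)) agree)
      stop-T : 2 + n ≤ T₀
      stop-T = sum≤ (1 ∷ N ∷ weight F ∷ n ∷ R 1 * D ∷ []) (# 0 ⊕ # 0 ⊕ # 3)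
                 ((# 0 ⊕ # 1) ⊕ (# 0 ⊕ # 0 ⊕ # 0 ⊕ # 0 ⊕ # 2 ⊕ # 3 ⊕ # 4))
    give-up : ∀ {E′ M′ b′ f′ sp′ C′} → EnvRep M′ (R 4) ρ E′ C′ → M ≈[ S ] M′ →
              M ≈[ (λ a → δ (1 + p) a + occ (node q) a) ] M′ →
              (∀ a → δ (1 + p) a + (S a + (occ (node q) a + occ C′ a)) ≤ ι f′ a) →
              b′ < charge → Q b′ (plug F (var x · f)) E′ → Stop b′ f′ sp′ (R 4) (R 12) M′ (2 + n)
    -- As `charge` is at most 1, a budget below it is 0, the only one at which `done` certifies the
    -- output.
    give-up {M′ = M′} en′ kS kx ω′ lt holds with n<1⇒n≡0 (≤-trans lt charge≤1)
    ... | refl = finish (Stack-≈ st kS)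
      (transport (λ c → Rep M′ ρ c (var x) (node q)) (sym
          (kx (1 + p) (≤-trans (here (1 + p)) (m≤m+n _ _))))
        (Rep-≈ rx (≈-mono (λ a → m≤n+m _ (δ (1 + p) a)) kx))) en′ ω′ holds
    ready : ∀ {M₂ g₂ b₂ E₂ v} → Resolved Q′ κ M₁ (R 4) ρ E M₂ g₂ b₂ E₂ → hop E₂ x ≡ head v →
            Loop b₂ g₂ g (R 4) (R 12) M₂ (vars E₂ * W + T₀)
    ready {M₂} {g₂} {b₂} {E₂} {v} res@(resolved {C₂} rep agree room _ small
        (holds₂ , ev₂ , b≤ , v≤ , _)) eq =
      Loop-mono (≤-reflexive arith) $
      fill E₂ x S {T = T₁} rep eq (hop-small x small eq)
        (trans (kg (at₀ g [])) (alloc₀ M g _ _ _))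
        (trans (kg (at₁ g [])) (alloc₁ M g 2 _ sp₀))
        (trans (kg (at₂ g [])) (alloc₂ M g 2 (1 + p) _))
        (agreeˣ res (1 + p) (≤-trans (here (1 + p)) (m≤m+n _ _)))
        (trans (agreeˣ res (1 + q) (≤-trans (at₁ q []) (m≤n+m _ (δ (1 + p) (1 + q))))) e₁)
        (λ a → ≤-trans (sum≤ (xs a ++ occ C₂ a ∷ []) (# 5 ⊕ # 1 ⊕ # 4 ⊕ # 0)
            (# 5 ⊕ # 4 ⊕ # 0 ⊕ # 1 ⊕ # 2)) (room a))
        (λ lt R′ m → Halts-mono stop-T₁ (give-up rep (agreeˢ res) (agreeˣ res)
          (λ a → ≤-trans (sum≤ (xs a ++ occ C₂ a ∷ []) (# 1 ⊕ # 0 ⊕ # 2 ⊕ # 5)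
              (# 5 ⊕ # 4 ⊕ # 0 ⊕ # 1 ⊕ # 2)) (room a))
          lt holds₂ R′ m))
        λ le M₃ g₃ A′ r′ s′ k₃ ω₃ →
          let b₃≤ = ≤-trans (m∸n≤m b₂ charge) b≤ in
          Loop-mono (cost₂ b₃≤) $
          beta-go (memory (Stack-≈ st (≈-trans (agreeˢ res) k₃)) r′ s′
                    (λ a → ≤-trans (sum≤ (xs a ++ occ C₂ a ∷ occ A′ a ∷ []) (# 1 ⊕ # 0 ⊕ # 6 ⊕ # 5)
                        (# 6 ⊕ # 5 ⊕ # 1 ⊕ # 0)) (ω₃ a)))
                  (static ev₂ small sF (ƛ hop-small x small eq) (hop₁ holds₂ ev₂ eq le))
                  (beta-cost-mono {E = E} {E₂} {F} v≤ b₃≤)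
      where
      T₁ : ℕ
      T₁ = vars E₂ * W + (4 + (weight F + (n + R 1 * D)))
      kg : ∀ {y} → 1 ≤ occ (node g) y → M₂ y ≡ M₁ y
      kg {y} l = agree y (≤-trans l (m≤m+n _ _))
      ys : List ℕ
      ys = 1 ∷ N ∷ weight F ∷ vars E₂ * W ∷ n ∷ R 1 * D ∷ []
      stop-T₁ : 2 + n ≤ T₁
      stop-T₁ = sum≤ ys (# 0 ⊕ # 0 ⊕ # 4) (# 3 ⊕ (# 0 ⊕ # 0 ⊕ # 0 ⊕ # 0 ⊕ # 2 ⊕ # 4 ⊕ # 5))
      arith : 1 + N + T₁ ≡ vars E₂ * W + T₀
      arith = ≤-antisym
        (sum≤ ys ((# 0 ⊕ # 1) ⊕ # 3 ⊕ (# 0 ⊕ # 0 ⊕ # 0 ⊕ # 0 ⊕ # 2 ⊕ # 4 ⊕ # 5))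
            (# 3 ⊕ (# 0 ⊕ # 1) ⊕ (# 0 ⊕ # 0 ⊕ # 0 ⊕ # 0 ⊕ # 2 ⊕ # 4 ⊕ # 5)))
        (sum≤ ys (# 3 ⊕ (# 0 ⊕ # 1) ⊕ (# 0 ⊕ # 0 ⊕ # 0 ⊕ # 0 ⊕ # 2 ⊕ # 4 ⊕ # 5))
            ((# 0 ⊕ # 1) ⊕ # 3 ⊕ (# 0 ⊕ # 0 ⊕ # 0 ⊕ # 0 ⊕ # 2 ⊕ # 4 ⊕ # 5)))
      cost₂ : ∀ {b₃} → b₃ ≤ R 1 → beta-cost E₂ F b₃ ≤ T₁
      cost₂ {b₃} l = ≤-trans (+-monoʳ-≤ 4 (+-monoʳ-≤ (weight F)
          (+-monoʳ-≤ (vars E₂ * W) (+-monoʳ-≤ n (*-monoˡ-≤ D l)))))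
        (sum≤ ys (# 0 ⊕ # 0 ⊕ # 0 ⊕ # 0 ⊕ # 2 ⊕ # 3 ⊕ # 4 ⊕ # 5)
            (# 3 ⊕ (# 0 ⊕ # 0 ⊕ # 0 ⊕ # 0 ⊕ # 2 ⊕ # 4 ⊕ # 5)))

  -- A contraction replaces the term by a body of unrelated structure, so the recursion is not
  -- structural. `fuel` bounds the cost, and the cost drops with every iteration of the machine: the
  -- time bound also proves termination.
  eval-loop : ∀ fuel {n} {E : Env n} {F τ M ρ e sp h sp′ b f z} →
    M sp ≡ 0 → M (1 + sp) ≡ h → M (2 + sp) ≡ sp′ →
    Memory M ρ e z f sp′ h E F τ (occ (node sp)) → Static b E F τ → eval-cost E F τ b ≤ fuel →
    Loop b f sp e z M (eval-cost E F τ b)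

  return-loop : ∀ fuel {n} {E : Env n} {F τ M ρ e sp h b f z} →
    Memory M ρ e z f sp h E F τ (λ _ → 0) → Static b E F τ → Fireball (subst (unfold E) τ) →
    return-cost E F b ≤ fuel → Loop b f sp e z M (return-cost E F b)

  leaf : ∀ fuel {n} {E : Env n} {F τ M ρ e sp h sp′ b f z} →
    M sp ≡ 0 → M (1 + sp) ≡ h → M (2 + sp) ≡ sp′ → M (M h) ∸ 2 ≡ 0 → ∃[ m ] ∣ τ ∣ ≡ suc m →
    Memory M ρ e z f sp′ h E F τ (occ (node sp)) → Static b E F τ → Fireball (subst (unfold E) τ) →
    eval-cost E F τ b ≤ fuel → Loop b f sp e z M (eval-cost E F τ b)
  leaf (suc fuel) {n} {E} {F} {τ} {b = b} t₀ refl refl tag (m , eq) (memory {B} {A} {C} st r en ω)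
      stat fb (s≤s c≤) R mn@(main refl refl refl refl refl) =
    Halts-mono (s≤s lt) $ iterate (iter-eval-leaf R _ t₀ tag) $
      return-loop fuel (memory st r en (λ a → ≤-trans (m≤n+m _ (occ (node (R 3)) a)) (ω a))) stat
          fb (≤-trans lt c≤)
    where
    lt : return-cost E F (R 1) ≤ 2 + (W + (∣ τ ∣ + (∣ τ ∣ + (weight F + base E (R 1)))))
    lt rewrite eq = sum≤ (1 ∷ m ∷ weight F + base E (R 1) ∷ W ∷ [])
      (# 0 ⊕ # 0 ⊕ # 0 ⊕ # 3 ⊕ # 2) (# 0 ⊕ # 0 ⊕ # 3 ⊕ (# 0 ⊕ # 1) ⊕ (# 0 ⊕ # 1) ⊕ # 2)

  eval-loop fuel {τ = var i} t₀ t₁ t₂ mem@(memory _ (var x _) en _) stat =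
    leaf fuel t₀ t₁ t₂ (cong (_∸ 2) x) (0 , refl) mem stat (Flag-fireball (proj₁ (env-flag en i)))
  eval-loop fuel {τ = con a} t₀ t₁ t₂ mem@(memory _ (con x _) en _) stat =
    leaf fuel t₀ t₁ t₂ (cong (_∸ 2) x) (0 , refl) mem stat (inert con)
  eval-loop fuel {τ = ƛ t} t₀ t₁ t₂ mem@(memory _ (ƛ_ x _) en _) stat =
    leaf fuel t₀ t₁ t₂ (cong (_∸ 2) x) (∣ t ∣ , +-comm ∣ t ∣ 1) mem stat value
  eval-loop (suc fuel) {E = E} {F} {t · u} {M} {ρ} t₀ refl refl
    (memory {B} {C = C} st (_·_ {A = A} {A′} y rt ru) en ω) (static ev se sF (st′ · su) q) (s≤s c≤)
        R (main refl refl refl refl refl) =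
    Halts-mono (s≤s lt) $ iterate (iter-eval-app R M t₀ y) $
      eval-loop fuel (alloc₀ M₂ (3 + f) _ _ _) (alloc₁ M₂ (3 + f) 0 _ f)
          (alloc₂ M₂ (3 + f) 0 (2 + p) _)
        (memory
          (right (trans (low f (m≤n+m (1 + f) 2)) (alloc₀ M₁ f _ _ _))
                 (trans (low (1 + f) (m≤n+m (2 + f) 1)) (alloc₁ M₁ f 0 _ sp))
                 (trans (low (2 + f) ≤-refl) (alloc₂ M₁ f 0 (1 + p) _))
                 (trans (alloc-≈ {δ sp} M₂ (3 + f) 0 (2 + p) f
                     (λ a → ≤-trans (δsp≤ a) (ι-step f a)) sp (here sp))
                   (trans (alloc-≈ {δ sp} M₁ f 0 (1 + p) sp δsp≤ sp (here sp)) (hit M sp 1)))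
                 (k (1 + sp) (≤-trans (here (1 + sp)) (sum≤ (xs (1 + sp)) (# 1) kept)))
                 (k (2 + sp) (≤-trans (here (2 + sp)) (sum≤ (xs (2 + sp)) (# 2) kept)))
                 (k h (≤-trans (here h) (sum≤ (xs h) (# 3) kept)))
                 (trans (k p (≤-trans (here p) (sum≤ (xs p) (# 4) kept))) y)
                 (k (1 + p) (≤-trans (here (1 + p)) (sum≤ (xs (1 + p)) (# 5) kept)))
                 (Rep-≈ rt (≈-mono (λ a → sum≤ (xs a) (# 7) kept) k))
                 (Stack-≈ st (≈-mono (λ a → sum≤ (xs a) (# 8) kept) k)))
          (transport (λ c → Rep M₃ ρ c u A′) (sym (k (2 + p)
              (≤-trans (here (2 + p)) (sum≤ (xs (2 + p)) (# 6) kept))))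
            (Rep-≈ ru (≈-mono (λ a → sum≤ (xs a) (# 9) kept) k)))
          (EnvRep-≈ en (≈-mono (λ a → sum≤ (xs a) (# 10) kept) k))
          (λ a → ≤-trans (≤-reflexive (cong (λ w → occ (node (3 + f)) a +
              (δ (2 + p) a + (w + (occ A′ a + occ C a)))) (occʳ f sp p h A B a)))
            (≤-trans (sum≤ (xs a ++ occ (node f) a ∷ occ (node (3 + f)) a ∷ [])
                        (# 12 ⊕ # 6 ⊕ (# 11 ⊕ (# 0 ⊕ # 1 ⊕ # 2 ⊕ # 99) ⊕ # 4 ⊕ # 5 ⊕ # 3 ⊕ # 7 ⊕ #
                            8) ⊕ # 9 ⊕ # 10)
                        (# 12 ⊕ # 11 ⊕ all))
              (bump {3 + f} (bump (ω₀ a))))))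
        (static (right ev) se (st′ , sF) su q) (≤-trans lt c≤)
    where
    f  = R 2
    sp = R 3
    h  = M (1 + sp)
    p  = M h
    M₁ = M [ sp ≔ 1 ]
    M₂ = alloc M₁ f 0 (1 + p) sp
    M₃ = alloc M₂ (3 + f) 0 (2 + p) f
    xs : ℕ → List ℕ
    xs a = δ sp a ∷ δ (1 + sp) a ∷ δ (2 + sp) a ∷ δ h a ∷ δ p a ∷ δ (1 + p) a ∷ δ (2 + p) a ∷
           occ A a ∷ occ B a ∷ occ A′ a ∷ occ C a ∷ []
    kept all : Sum
    kept = # 1 ⊕ # 2 ⊕ # 3 ⊕ # 4 ⊕ # 5 ⊕ # 6 ⊕ # 7 ⊕ # 8 ⊕ # 9 ⊕ # 10
    all  = (# 0 ⊕ # 1 ⊕ # 2 ⊕ # 99) ⊕ # 3 ⊕ # 8 ⊕ ((# 4 ⊕ # 5 ⊕ # 6 ⊕ # 99) ⊕ # 7 ⊕ # 9) ⊕ # 10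
    ω₀ : ∀ a → ⟦ all ⟧ (xs a) ≤ ι f a
    ω₀ a = ≤-trans (≤-reflexive (cong (λ w → occ (node sp) a + (δ h a + (occ B a + (w + occ C a))))
        (sym (occ₃ p A A′ a)))) (ω a)
    δsp≤ : ∀ a → δ sp a ≤ ι f a
    δsp≤ a = ≤-trans (sum≤ (xs a) (# 0) all) (ω₀ a)
    kept≤ : ∀ a → ⟦ kept ⟧ (xs a) ≤ ι f a
    kept≤ a = ≤-trans (sum≤ (xs a) kept all) (ω₀ a)
    k : M ≈[ (λ a → ⟦ kept ⟧ (xs a)) ] M₃
    k = ≈-trans (≔-≈ M sp 1 (off {f} (≤-trans (sum≤ (xs sp) (# 0 ⊕ kept) all) (ω₀ sp))))
       (≈-trans (alloc-≈ M₁ f 0 (1 + p) sp kept≤)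
                (alloc-≈ M₂ (3 + f) 0 (2 + p) f λ a → ≤-trans (kept≤ a) (ι-step f a)))
    low : ∀ x → x < 3 + f → M₃ x ≡ M₂ x
    low = alloc-below M₂ (3 + f) 0 (2 + p) f
    lt : eval-cost E (right t ∷ F) u (R 1) ≤ 2 + (W + (∣ t · u ∣ +
        (∣ t · u ∣ + (weight F + base E (R 1)))))
    lt = sum≤ (1 ∷ W ∷ ∣ t ∣ ∷ ∣ u ∣ ∷ weight F ∷ base E (R 1) ∷ [])
      (# 0 ⊕ # 0 ⊕ # 0 ⊕ # 1 ⊕ # 3 ⊕ # 3 ⊕ (# 0 ⊕ # 2 ⊕ # 2 ⊕ # 4) ⊕ # 5)
      (# 0 ⊕ # 0 ⊕ # 1 ⊕ ((# 2 ⊕ # 3) ⊕ # 0) ⊕ ((# 2 ⊕ # 3) ⊕ # 0) ⊕ # 4 ⊕ # 5)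

  return-inert : ∀ fuel {n} {E : Env n} {F f τ M ρ e sp h b g z} →
    (∀ R → R 3 ≡ sp → Inert-tag R M) →
    Memory M ρ e z g sp h E (left f ∷ F) τ (λ _ → 0) → Static b E (left f ∷ F) τ → Inert
        (subst (unfold E) τ) →
    return-cost E (left f ∷ F) b ≤ fuel → Loop b g sp e z M (return-cost E (left f ∷ F) b)
  return-inert (suc fuel) {E = E} {F} {f} {M = M} tag
    (memory {A = D} {C} (left {sp} {h} {p = p} {A = A} {B = B} t₀ refl refl refl y refl rf s) r en
        ω)
    (static (left fb ev) se (sf , sF) sτ q) i (s≤s c≤) R (main refl refl refl refl refl) =
    Halts-mono (≤-reflexive cost) $ iterate (iter-apply-inert R M t₀ (tag R refl)) $
      return-loop fuel
        (memory s (_·_ y r rf) en (λ a →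
          ≤-trans (≤-reflexive (cong (λ w → δ h a + (occ B a + (w + occ C a))) (occ₃ p D A a)))
            (≤-trans (sum≤ (xs a) (# 0 ⊕ # 1 ⊕ ((# 2 ⊕ # 3 ⊕ # 4 ⊕ # 99) ⊕ # 5 ⊕ # 6) ⊕ # 7)
                               (# 3 ⊕ (# 8 ⊕ # 2 ⊕ # 4 ⊕ # 0 ⊕ # 6 ⊕ # 1) ⊕ # 5 ⊕ # 7))
              (≤-trans (≤-reflexive (cong (λ w → δ (1 + p) a + (w + (occ D a + occ C a)))
                  (sym (occˡ (R 3) p h A B a)))) (ω a)))))
        (static ev se sF (sτ · sf) q) (inert (i · fb)) (≤-trans (≤-reflexive (suc-injective cost))
            c≤)
    where
    xs : ℕ → List ℕ
    xs a = δ h a ∷ occ B a ∷ δ p a ∷ δ (1 + p) a ∷ δ (2 + p) a ∷ occ D a ∷ occ A a ∷ occ C a ∷ occ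
        (node (R 3)) a ∷ []
    cost : suc (return-cost E F (R 1)) ≡ return-cost E (left f ∷ F) (R 1)
    cost = cong (3 +_) (sym (+-suc W (weight F + base E (R 1))))

  return-variable : ∀ fuel {n} {E : Env n} {F f x M ρ e sp h b g z} →
    (isƛ (unfold E x) ≡ true × M (lookup ρ x) ≡ 4) ⊎ (Inert (unfold E x) × M (lookup ρ x) ≡ 5) →
    Memory M ρ e z g sp h E (left f ∷ F) (var x) (λ _ → 0) → Static b E (left f ∷ F) (var x) →
    return-cost E (left f ∷ F) b ≤ fuel → Loop b g sp e z M (return-cost E (left f ∷ F) b)

  return-loop fuel {E = E} {[]} (memory st@([] t₀) r en ω) (static ev se sF sτ q) fb c≤
    with final q fb
  ... | refl = λ { R (main b≡ refl refl refl refl) →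
    Halts-mono (≤-trans (s≤s (stop≤ E [] 0)) (+-monoʳ-≤ 3
        (sum≤ (1 ∷ N ∷ base E 0 ∷ []) (# 0 ⊕ # 2) ((# 0 ⊕ # 0 ⊕ # 1) ⊕ # 2)))) $
    iterate (iter-halt R _ t₀) λ R′ m →
      finish st r en ω q R′ (main (trans (Main.budget m) b≡) (Main.free m) (Main.top m)
          (Main.newest m) (Main.root m)) }
  -- No instruction is executed here: the next task already evaluates `t`. The stack is only read
  -- differently, the evaluated argument passing from the hole into the frame.
  return-loop fuel {E = E} {right t ∷ F} {τ} {b = b}
    (memory {A = D} {C} (right {sp} {sp₁} {h} {p = p} {A = A} {B = B} t₀ t₁ t₂ u₀ u₁ u₂ x y refl rt
        s) r en ω)
    (static (right ev) se (st , sF) sτ q) fb c≤ =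
    Loop-mono cost $ eval-loop fuel t₀ t₁ t₂
      (memory (left u₀ u₁ u₂ x y refl r s) rt en λ a →
        ≤-trans (≤-reflexive (cong (λ w → occ (node sp) a +
            (δ (1 + p) a + (w + (occ A a + occ C a)))) (occˡ sp₁ p h D B a)))
          (≤-trans (sum≤ (occ (node sp) a ∷ δ (1 + p) a ∷ occ (node sp₁) a ∷ δ p a ∷ δ (2 + p) a ∷
              δ h a ∷ occ D a ∷ occ B a ∷ occ A a ∷ occ C a ∷ [])
                      (# 0 ⊕ # 1 ⊕ (# 2 ⊕ # 3 ⊕ # 4 ⊕ # 5 ⊕ # 6 ⊕ # 7) ⊕ # 8 ⊕ # 9)
                      (# 4 ⊕ (# 0 ⊕ # 2 ⊕ # 3 ⊕ # 1 ⊕ # 5 ⊕ # 8 ⊕ # 7) ⊕ # 6 ⊕ # 9))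
            (≤-trans (≤-reflexive (cong (λ w → δ (2 + p) a + (w + (occ D a + occ C a)))
                (sym (occʳ sp sp₁ p h A B a)))) (ω a))))
      (static (left fb ev) se (sτ , sF) st q) (≤-trans cost c≤)
    where
    cost : eval-cost E (left τ ∷ F) t b ≤ return-cost E (right t ∷ F) b
    cost = sum≤ (1 ∷ W ∷ ∣ t ∣ ∷ weight F ∷ base E b ∷ [])
      (# 0 ⊕ # 0 ⊕ # 0 ⊕ # 1 ⊕ # 2 ⊕ # 2 ⊕ (# 0 ⊕ # 3) ⊕ # 4)
          (# 0 ⊕ # 0 ⊕ # 0 ⊕ # 1 ⊕ (# 0 ⊕ # 2 ⊕ # 2 ⊕ # 3) ⊕ # 4)
  return-loop fuel {F = left f ∷ F} {con a} mem@(memory (left t₀ refl refl refl y refl rf s)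
      (con x _) en ω) stat fb c≤ =
    return-inert fuel (λ { R refl → con x }) mem stat con c≤
  return-loop fuel {F = left f ∷ F} {t · u} mem@(memory (left t₀ refl refl refl y refl rf s)
      (_·_ x _ _) en ω) stat (inert i) c≤ =
    return-inert fuel (λ { R refl → app x }) mem stat i c≤
  return-loop (suc fuel) {E = E} {left f ∷ F} {ƛ t} {b = b} mem stat fb c≤ =
    Loop-mono cost $ beta-loop fuel (eval-loop fuel) mem stat (≤-trans cost c≤)
    where
    cost : beta-cost E F b ≤ return-cost E (left f ∷ F) b
    cost = sum≤ (1 ∷ W ∷ weight F ∷ base E b ∷ []) (# 0 ⊕ # 0 ⊕ # 0 ⊕ # 0 ⊕ # 2 ⊕ # 3)
        (# 0 ⊕ # 0 ⊕ # 0 ⊕ # 1 ⊕ (# 0 ⊕ # 2) ⊕ # 3)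
  return-loop fuel {F = left f ∷ F} {var x} mem@(memory _ _ en _) stat fb c≤ =
    return-variable fuel (Flag-cases (proj₁ (env-flag en x))) mem stat c≤

  return-variable fuel {M = M} (inj₂ (i , tag)) mem@(memory (left t₀ refl refl refl y refl rf s)
      (var e₀ e₁) en ω) stat c≤ =
    return-inert fuel (λ { R refl → var e₀ (trans (cong M e₁) tag) }) mem stat i c≤
  return-variable (suc fuel) {E = E} {F} {f} {b = b} (inj₁ (isl , tag)) mem stat c≤ =
    force isl tag (λ mem′ stat′ le → beta-loop fuel (eval-loop fuel) mem′ stat′
        (≤-trans le (≤-trans cost c≤))) mem stat
    where
    cost : beta-cost E F b ≤ return-cost E (left f ∷ F) b
    cost = sum≤ (1 ∷ W ∷ weight F ∷ base E b ∷ []) (# 0 ⊕ # 0 ⊕ # 0 ⊕ # 0 ⊕ # 2 ⊕ # 3)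
        (# 0 ⊕ # 0 ⊕ # 0 ⊕ # 1 ⊕ (# 0 ⊕ # 2) ⊕ # 3)

-- The bound for a complete run

1≤size : ∀ {n} (t : Term plain n) → 1 ≤ ∣ t ∣
1≤size (var i) = ≤-refl
1≤size (con a) = ≤-refl
1≤size (ƛ t)   = m≤n+m 1 ∣ t ∣
1≤size (t · u) = m≤n+m 1 (∣ t ∣ + ∣ u ∣)

run-machine : ∀ charge → charge ≤ 1 → (Res : Term shared 0 → Set)
    (Q : ℕ → ∀ {n} → Term plain n → Env n → Set) →
  Invariant charge Res Q → ∀ t len s → Q len t [] → Input t len s →
  ∃[ k ] ∃[ s′ ] ∃[ w ] program charge ⊢ s ⇓⟨ k ⟩ s′ × k ≤ 576 * ((1 + len) * ∣ t ∣) × Output s′ w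
      × Res w
run-machine charge charge≤1 Res Q inv t len _ q (root , f , M , A , refl , (rep , unique) , below ,
    _) =
  conclude (start-up root len f M)
  where
  open Execution charge
  open Machine charge Res
  open Correctness charge charge≤1 Res ∣ t ∣ Q inv
  N = ∣ t ∣
  M₁ = alloc M f root 0 0
  M₂ = alloc M₁ (3 + f) 4 0 0
  M₃ = alloc M₂ (6 + f) 0 f (3 + f)
  ω : ∀ a → occ A a ≤ ι f a
  ω = Unique⇒occ unique below
  k : M ≈[ occ A ] M₃
  k = ≈-trans (alloc-≈ M f root 0 0 ω)
     (≈-trans (alloc-≈ M₁ (3 + f) 4 0 0 λ a → ≤-trans (ω a) (ι-step f a))
              (alloc-≈ M₂ (6 + f) 0 f (3 + f) λ a → ≤-trans (ω a)
                  (≤-trans (ι-step f a) (ι-step (3 + f) a))))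
  low : ∀ x → x < 3 + f → M₃ x ≡ M₁ x
  low x l = trans (alloc-below M₂ (6 + f) 0 f (3 + f) x (≤-trans l (m≤n+m (3 + f) 3)))
                  (alloc-below M₁ (3 + f) 4 0 0 x l)
  root≡ : M₃ f ≡ root
  root≡ = trans (low f (m≤n+m (1 + f) 2)) (alloc₀ M f root 0 0)
  -- The constant part is `6 + 3 * N` and `D` is `5 + 4 * N`; both are at most `9 * N` because `N`
  -- is positive. With 64 instructions per iteration this gives 576.
  cost : 1 + eval-cost [] [] t len ≤ 9 * ((1 + len) * N)
  cost = ≤-trans (+-monoʳ-≤ 6 (+-monoʳ-≤ N (+-monoʳ-≤ N (+-monoʳ-≤ N (*-monoʳ-≤ len D≤)))))
    (≤-trans (+-monoˡ-≤ (N + (N + (N + len * (9 * N)))) (*-monoʳ-≤ 6 (1≤size t)))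
      (≤-reflexive total))
    where
    D≤ : D ≤ 9 * N
    D≤ = ≤-trans (+-monoˡ-≤ (N + (N + (N + N))) (*-monoʳ-≤ 5 (1≤size t)))
      (sum≤ (N ∷ []) ((# 0 ⊕ # 0 ⊕ # 0 ⊕ # 0 ⊕ # 0 ⊕ # 9) ⊕ # 0 ⊕ # 0 ⊕ # 0 ⊕ # 0)
                     (# 0 ⊕ # 0 ⊕ # 0 ⊕ # 0 ⊕ # 0 ⊕ # 0 ⊕ # 0 ⊕ # 0 ⊕ # 0 ⊕ # 9))
    total : 6 * N + (N + (N + (N + len * (9 * N)))) ≡ 9 * ((1 + len) * N)
    total = solve 2 (λ N len → con 6 :* N :+ (N :+ (N :+ (N :+ len :* (con 9 :* N)))) := con 9 :*
        ((con 1 :+ len) :* N)) refl N len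
      where open import Data.Nat.Solver using (module +-*-Solver)
            open +-*-Solver
  loops : Loop len (9 + f) (6 + f) (1 + f) f M₃ (eval-cost [] [] t len)
  loops = eval-loop (eval-cost [] [] t len)
    (alloc₀ M₂ (6 + f) _ _ _) (alloc₁ M₂ (6 + f) 0 _ (3 + f)) (alloc₂ M₂ (6 + f) 0 f _)
    (memory
      ([] (trans (alloc-below M₂ (6 + f) 0 f (3 + f) (3 + f) (m≤n+m (4 + f) 2))
          (alloc₀ M₁ (3 + f) _ _ _)))
      (transport (λ p → Rep M₃ [] p t A) (sym root≡) (Rep-≈ rep k))
      ([] (trans (low (1 + f) (m≤n+m (2 + f) 1)) (alloc₁ M f root _ 0)))
      λ a → ≤-trans (sum≤ (occ A a ∷ δ f a ∷ δ (1 + f) a ∷ δ (2 + f) a ∷ δ (3 + f) a ∷ δ (4 + f) a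
          ∷ δ (5 + f) a ∷ occ (node (6 + f)) a ∷ [])
                      (# 7 ⊕ # 1 ⊕ (# 4 ⊕ # 9) ⊕ # 0 ⊕ (# 2 ⊕ # 9))
                      (# 7 ⊕ (# 4 ⊕ # 5 ⊕ # 6 ⊕ # 9) ⊕ (# 1 ⊕ # 2 ⊕ # 3 ⊕ # 9) ⊕ # 0))
              (bump {6 + f} (bump {3 + f} (bump (ω a)))))
    (static [] [] tt (size⇒Small t ≤-refl) q) ≤-refl
  s₀ : State
  s₀ = ⟪ 0 , registers root len f , M ⟫
  outcome : Halts s₀ (1 + eval-cost [] [] t len) →
            ∃[ k ] ∃[ s′ ] ∃[ w ] program charge ⊢ s₀ ⇓⟨ k ⟩ s′ × k ≤ 576 * ((1 + len) * N) ×
                Output s′ w × Res w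
  outcome (halts {k} {w} k≤ x y res) =
    let j , j≤k , run = exec⇒⇓ k s₀ x in
    j , exec k s₀ , w , run ,
    ≤-trans j≤k (≤-trans k≤ (≤-trans (*-monoʳ-≤ 64 cost)
        (≤-reflexive (sym (*-assoc 64 9 ((1 + len) * N)))))) , y , res
  conclude : ∃[ s′ ] s₀ ⟶⟨ 64 ⟩ s′ × State.pc s′ ≡ at-loop × State.mem s′ ≡ M₃ ×
             Main (State.reg s′) len (9 + f) (6 + f) (1 + f) f →
             ∃[ k ] ∃[ s′ ] ∃[ w ] program charge ⊢ s₀ ⇓⟨ k ⟩ s′ × k ≤ 576 * ((1 + len) * N) ×
                 Output s′ w × Res w
  conclude (⟪ _ , R , _ ⟫ , steps , refl , refl , m) = outcome (Halts-step steps (loops R m))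

-- Simulation of the Fireball Calculus

spine : ∀ {n} → Evaluation n → Frames n
spine □              = []
spine (u ·ʳ F)       = spine F ++ right u ∷ []
spine (F ·ˡ (f , _)) = spine F ++ left f ∷ []

plug-spine : ∀ {n} (F : Evaluation n) t → plug (spine F) t ≡ (F ⟨ t ⟩ᶠ)
plug-spine □              t = refl
plug-spine (u ·ʳ F)       t = trans (plug-++ (spine F) (right u ∷ []) t)
    (cong (u ·_) (plug-spine F t))
plug-spine (F ·ˡ (f , _)) t = trans (plug-++ (spine F) (left f ∷ []) t)
    (cong (_· f) (plug-spine F t))

Evald-++ : ∀ {n} {σ : Fin n → Term plain 0} {F G} → Evald σ F → Evald σ G → Evald σ (F ++ G)
Evald-++ []         q = q
Evald-++ (right p)  q = right (Evald-++ p q)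
Evald-++ (left f p) q = left f (Evald-++ p q)

spine-evald : (F : Evaluation 0) → Evald var (spine F)
spine-evald □              = []
spine-evald (u ·ʳ F)       = Evald-++ (spine-evald F) (right [])
spine-evald (F ·ˡ (f , p)) = Evald-++ (spine-evald F) (left
    (transport Fireball (sym (subst-var f)) p) [])

Evald-subst : ∀ {n} {σ : Fin n → Term plain 0} {F} → Evald σ F → Evald var (mapᶠ (subst σ) F)
Evald-subst []         = []
Evald-subst (right p)  = right (Evald-subst p)
Evald-subst (left x p) = left (transport Fireball (sym (subst-var _)) x) (Evald-subst p)

mapᶠ-weaken : ∀ {n} (E : Env n) f F → mapᶠ (subst (unfold (E ▷ f))) (mapᶠ (rename suc) F) ≡ mapᶠ
    (subst (unfold E)) F
mapᶠ-weaken E f []            = refl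
mapᶠ-weaken E f (right t ∷ F) = cong₂ (λ t F → right t ∷ F) (subst-▷ E f t) (mapᶠ-weaken E f F)
mapᶠ-weaken E f (left t ∷ F)  = cong₂ (λ t F → left t ∷ F) (subst-▷ E f t) (mapᶠ-weaken E f F)

-- The step may come from any derivation; uniqueness of the redex identifies its evaluation context
-- with the given frames.
→f-redex : ∀ {t u : Term plain 0} {F s f} → t →f u → Evald var (left f ∷ F) → t ≡ plug F
    ((ƛ s) · f) →
           u ≡ plug F (subst (zero↦ f) s)
→f-redex {F = F} {s} {f} (β F′ {t′} {f′} fb) ev eq
  with redex-unique ev (ƛ s) refl (left (transport Fireball (sym (subst-var f′)) fb)
      (spine-evald F′)) (ƛ t′) refl
         (trans (sym eq) (sym (plug-spine F′ _)))
... | refl = sym (plug-spine F′ _)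

→f-normal : ∀ {t u : Term plain 0} → t →f u → Fireball t → ⊥
→f-normal {t} (β F′ {t′} {f′} fb) p =
  fireball-normal (left (transport Fireball (sym (subst-var f′)) fb) (spine-evald F′)) (ƛ t′) refl
    (sym (plug-spine F′ _)) (transport Fireball (sym (subst-var t)) p)

Steps : Term plain 0 → ℕ → Term plain 0 → Set
Steps u b t = Σ (Star _→f_ t u) λ d → length d ≡ b

Fireball-state : Term plain 0 → ℕ → ∀ {n} → Term plain n → Env n → Set
Fireball-state u b τ E = Steps u b (subst (unfold E) τ)

-- A replacement leaves the unfolding, and with it the rest of the derivation, unchanged, whence the
-- charge 0. A contraction of the flat state is a step of its unfolding, since unfolding the
-- appended binding substitutes the argument.
fireball-invariant : ∀ u → Invariant 0 (λ w → w ↓ ≡ u) (Fireball-state u)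
fireball-invariant u = record
  { done  = λ { {τ = τ} {E} (ε , refl) → trans (wrap-↓ E (embed τ))
      (cong (subst (unfold E)) (embed-↓ τ)) }
  ; final = λ { (ε , refl) _ → refl ; (s ◅ _ , refl) fb → ⊥-elim (→f-normal s fb) }
  ; beta  = λ { {b = b} {F} {t} {f} {E} (s ◅ d , refl) ev →
      transport (Steps u b)
        (trans (→f-redex s (Evald-subst ev) (plug-subst (unfold E) F ((ƛ t) · f)))
          (trans (cong₂ plug (sym (mapᶠ-weaken E f F)) (subst-zero↦ (unfold E) t f))
                 (sym (plug-subst (unfold (E ▷ f)) (mapᶠ (rename suc) F) t))))
        (d , refl) }
  ; hop₁  = λ { {b = b} {F} {x} {f} {v} {E} q ev eq _ → transport (Steps u b)
      (trans (plug-subst (unfold E) F (var x · f))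
        (trans (cong (λ t → plug (mapᶠ (subst (unfold E)) F) (t · subst (unfold E) f))
            (unfold-head E x eq))
               (sym (plug-subst (unfold E) F ((ƛ v) · f))))) q }
  ; hop₂  = λ { {b = b} {F} {x} {f} {E} {E′} q ev _ eq _ → transport (Steps u b)
      (subst-cong (λ i → sym (unfold-env E x eq i)) (plug F (var x · f))) q }
  }

-- Flattening of terms and contexts with explicit substitutions

module BagSolver {A : Set} = CommutativeMonoidSolver (++-commutativeMonoid {A = A})
open BagSolver using (solve; _⊜_) renaming (_⊕_ to _⊞_; id to ∅)

Bindings : ℕ → Set
Bindings n = List (Fin n × Term plain n)

-- `Flat r t τ xs`: floating all explicit substitutions of t outwards leaves the plain term τ and the
-- substitutions xs, the variables that they bind being named by Fin n; r names the free variables of t.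
data Flat {n} : ∀ {m} → (Fin m → Fin n) → Term shared m → Term plain n → Bindings n → Set where
  var   : ∀ {m} {r : Fin m → Fin n} {i j} → r i ≡ j → Flat r (var i) (var j) []
  con   : ∀ {m} {r : Fin m → Fin n} {a} → Flat r (con a) (con a) []
  abs   : ∀ {m} {r : Fin m → Fin n} {t τ} (s : Term plain (suc m)) →
          t ≡ embed s → τ ≡ rename (ext r) s → Flat r (ƛ t) (ƛ τ) []
  _·_   : ∀ {m} {r : Fin m → Fin n} {t u τ υ xs ys} →
          Flat r t τ xs → Flat r u υ ys → Flat r (t · u) (τ · υ) (xs ++ ys)
  _[←_] : ∀ {m} {r : Fin m → Fin n} {t u τ υ x xs ys} →
          Flat (x ◂ r) t τ xs → Flat r u υ ys → Flat r (t [← u ]) τ ((x , υ) ∷ xs ++ ys)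

◂-ext : ∀ {n m l} {r : Fin m → Fin n} {ρ : Fin l → Fin m} {r′ : Fin l → Fin n} {x} →
        r ∘ ρ ≗ r′ → (x ◂ r) ∘ ext ρ ≗ (x ◂ r′)
◂-ext e zero    = refl
◂-ext e (suc i) = e i

ext-≗ : ∀ {n m l} {r : Fin m → Fin n} {ρ : Fin l → Fin m} {r′ : Fin l → Fin n} →
        r ∘ ρ ≗ r′ → ext r ∘ ext ρ ≗ ext r′
ext-≗ e zero    = refl
ext-≗ e (suc i) = cong suc (e i)

Flat-rename : ∀ {n m l} {r : Fin m → Fin n} (ρ : Fin l → Fin m) {r′ : Fin l → Fin n} {t τ xs} →
              r ∘ ρ ≗ r′ → Flat r′ t τ xs → Flat r (rename ρ t) τ xs
Flat-rename ρ e (var {i = i} x) = var (trans (e i) x)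
Flat-rename ρ e con             = con
Flat-rename {r = r} ρ e (abs s refl eq) =
  abs (rename (ext ρ) s) (rename-embed (ext ρ) s)
      (trans eq (sym (trans (rename-rename (ext r) (ext ρ) s) (rename-cong (ext-≗ e) s))))
Flat-rename ρ e (f · g)         = Flat-rename ρ e f · Flat-rename ρ e g
Flat-rename ρ e (f [← g ])      = Flat-rename (ext ρ) (◂-ext e) f [← Flat-rename ρ e g ]

weaken-binding : ∀ {n} → Fin n × Term plain n → Fin (suc n) × Term plain (suc n)
weaken-binding (x , υ) = suc x , rename suc υ

Flat-weaken : ∀ {n m} {r : Fin m → Fin n} {r′ : Fin m → Fin (suc n)} {t τ xs} → suc ∘ r ≗ r′ → Flat
    r t τ xs →
              Flat r′ t (rename suc τ) (map weaken-binding xs)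
Flat-weaken e (var {i = i} x) = var (trans (sym (e i)) (cong suc x))
Flat-weaken e con             = con
Flat-weaken {r = r} {r′} e (abs s eq eq′) = abs s eq
  (trans (cong (rename (ext suc)) eq′) (trans (rename-rename (ext suc) (ext r) s)
      (rename-cong lem s)))
  where
  lem : ext suc ∘ ext r ≗ ext r′
  lem zero    = refl
  lem (suc i) = cong suc (e i)
Flat-weaken e (_·_ {xs = xs} {ys} f g) rewrite map-++ weaken-binding xs ys = Flat-weaken e f ·
    Flat-weaken e g
Flat-weaken {r = r} {r′} e (_[←_] {x = x} {xs} {ys} f g) rewrite map-++ weaken-binding xs ys =
  Flat-weaken lem f [← Flat-weaken e g ]
  where
  lem : suc ∘ (x ◂ r) ≗ (suc x ◂ r′)
  lem zero    = refl
  lem (suc i) = e i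

Flat-embed : ∀ {n m} (r : Fin m → Fin n) (t : Term plain m) → Flat r (embed t) (rename r t) []
Flat-embed r (var i) = var refl
Flat-embed r (con a) = con
Flat-embed r (ƛ t)   = abs t refl refl
Flat-embed r (t · u) = Flat-embed r t · Flat-embed r u

-- Where the hole of a weak context ends up: under frames in the main term, or in the content of the
-- substitution z while the main term is τ.
data Where (n : ℕ) : Set where
  main  : Frames n → Where n
  bound : Fin n → Frames n → Term plain n → Where n

main-term : ∀ {n} → Where n → Term plain n → Term plain n
main-term (main F)      t = plug F t
main-term (bound z F τ) t = τ

hole-binding : ∀ {n} → Where n → Term plain n → Bindings n
hole-binding (main F)      t = []
hole-binding (bound z F τ) t = (z , plug F t) ∷ []

inʳ inˡ : ∀ {n} → Term plain n → Where n → Where n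
inʳ u (main F)      = main (F ++ right u ∷ [])
inʳ u (bound z F τ) = bound z F (u · τ)
inˡ u (main F)      = main (F ++ left u ∷ [])
inˡ u (bound z F τ) = bound z F (τ · u)

into : ∀ {n} → Fin n → Term plain n → Where n → Where n
into x τ (main F)      = bound x F τ
into x τ (bound z F υ) = bound z F τ

into-binding : ∀ {n} → Fin n → Where n → Bindings n
into-binding x (main F)      = []
into-binding x (bound z F υ) = (x , υ) ∷ []

data FlatW {n} : ∀ {m l} → (Fin m → Fin n) → Weak m l → (Fin l → Fin n) → Where n → Bindings n →
    Set where
  □      : ∀ {m} {r : Fin m → Fin n} → FlatW r □ r (main []) []
  _·ʳ_   : ∀ {m l} {r : Fin m → Fin n} {u υ ys} {W : Weak m l} {r′ w xs} →
           Flat r u υ ys → FlatW r W r′ w xs → FlatW r (u ·ʳ W) r′ (inʳ υ w) (ys ++ xs)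
  _·ˡ_   : ∀ {m l} {r : Fin m → Fin n} {u υ ys} {W : Weak m l} {r′ w xs} →
           FlatW r W r′ w xs → Flat r u υ ys → FlatW r (W ·ˡ u) r′ (inˡ υ w) (ys ++ xs)
  _[←_]  : ∀ {m l} {r : Fin m → Fin n} {u υ ys x} {W : Weak (suc m) l} {r′ w xs} →
           FlatW (x ◂ r) W r′ w xs → Flat r u υ ys → FlatW r (W [← u ]) r′ w ((x , υ) ∷ ys ++ xs)
  _[←_]ʳ : ∀ {m l} {r : Fin m → Fin n} {u υ ys x} {W : Weak m l} {r′ w xs} →
           Flat (x ◂ r) u υ ys → FlatW r W r′ w xs →
           FlatW r (u [← W ]ʳ) r′ (into x υ w) (into-binding x w ++ ys ++ xs)

inʳ-main : ∀ {n} (u : Term plain n) w t → u · main-term w t ≡ main-term (inʳ u w) t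
inʳ-main u (main F)      t = sym (plug-++ F (right u ∷ []) t)
inʳ-main u (bound z F τ) t = refl

inʳ-hole : ∀ {n} (u : Term plain n) w t → hole-binding w t ≡ hole-binding (inʳ u w) t
inʳ-hole u (main F)      t = refl
inʳ-hole u (bound z F τ) t = refl

inˡ-main : ∀ {n} (u : Term plain n) w t → main-term w t · u ≡ main-term (inˡ u w) t
inˡ-main u (main F)      t = sym (plug-++ F (left u ∷ []) t)
inˡ-main u (bound z F τ) t = refl

inˡ-hole : ∀ {n} (u : Term plain n) w t → hole-binding w t ≡ hole-binding (inˡ u w) t
inˡ-hole u (main F)      t = refl
inˡ-hole u (bound z F τ) t = refl

into-main : ∀ {n} (x : Fin n) τ w t → main-term (into x τ w) t ≡ τ
into-main x τ (main F)      t = refl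
into-main x τ (bound z F υ) t = refl

into-hole : ∀ {n} (x : Fin n) τ w t →
            (x , main-term w t) ∷ hole-binding w t ↭ hole-binding (into x τ w) t ++ into-binding x w
into-hole x τ (main F)      t = ↭-refl
into-hole x τ (bound z F υ) t = Perm.swap _ _ ↭-refl

-- Bindings are tracked up to permutation only, because composition interleaves the substitutions of
-- the context with those of the hole. `sort` recovers an order in the end.
plugʷ : ∀ {n m l} {r : Fin m → Fin n} {W : Weak m l} {r′ w xs t τ ys} → FlatW r W r′ w xs → Flat r′
    t τ ys →
        ∃[ zs ] Flat r (W ⟨ t ⟩) (main-term w τ) zs × zs ↭ hole-binding w τ ++ xs ++ ys
plugʷ □ f = _ , f , ↭-refl
plugʷ {τ = τ} {ys} (_·ʳ_ {υ = υ} {vs} {w = w} {xs} g fw) f with plugʷ fw f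
... | zs , f′ , p = vs ++ zs , transport (λ σ → Flat _ _ σ (vs ++ zs)) (inʳ-main υ w τ) (g · f′) ,
  ↭-trans (++⁺ˡ vs p) (↭-trans
    (solve 4 (λ h vs xs ys → vs ⊞ (h ⊞ (xs ⊞ ys)) ⊜ h ⊞ ((vs ⊞ xs) ⊞ ys)) ↭-refl (hole-binding w τ)
        vs xs ys)
    (↭-reflexive (cong (_++ (vs ++ xs) ++ ys) (inʳ-hole υ w τ))))
plugʷ {τ = τ} {ys} (_·ˡ_ {υ = υ} {vs} {w = w} {xs} fw g) f with plugʷ fw f
... | zs , f′ , p = zs ++ vs , transport (λ σ → Flat _ _ σ (zs ++ vs)) (inˡ-main υ w τ) (f′ · g) ,
  ↭-trans (++⁺ʳ vs p) (↭-trans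
    (solve 4 (λ h vs xs ys → (h ⊞ (xs ⊞ ys)) ⊞ vs ⊜ h ⊞ ((vs ⊞ xs) ⊞ ys)) ↭-refl (hole-binding w τ)
        vs xs ys)
    (↭-reflexive (cong (_++ (vs ++ xs) ++ ys) (inˡ-hole υ w τ))))
plugʷ {τ = τ} {ys} (_[←_] {υ = υ} {vs} {x} {w = w} {xs} fw g) f with plugʷ fw f
... | zs , f′ , p = _ , f′ [← g ] ,
  ↭-trans (prep _ (++⁺ʳ vs p))
    (solve 5 (λ a h vs xs ys → a ⊞ ((h ⊞ (xs ⊞ ys)) ⊞ vs) ⊜ h ⊞ ((a ⊞ (vs ⊞ xs)) ⊞ ys)) ↭-refl
       ((x , υ) ∷ []) (hole-binding w τ) vs xs ys)
plugʷ {τ = τ} {ys} (_[←_]ʳ {υ = υ} {vs} {x} {w = w} {xs} g fw) f with plugʷ fw f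
... | zs , f′ , p = _ , transport (λ σ → Flat _ _ σ _) (sym (into-main x υ w τ)) (g [← f′ ]) ,
  ↭-trans (prep _ (++⁺ˡ vs p)) (↭-trans
    (solve 5 (λ a h vs xs ys → a ⊞ (vs ⊞ (h ⊞ (xs ⊞ ys))) ⊜ (a ⊞ h) ⊞ (vs ⊞ (xs ⊞ ys))) ↭-refl
       ((x , main-term w τ) ∷ []) (hole-binding w τ) vs xs ys)
    (↭-trans (++⁺ʳ (vs ++ xs ++ ys) (into-hole x υ w τ))
      (solve 5 (λ h i vs xs ys → (h ⊞ i) ⊞ (vs ⊞ (xs ⊞ ys)) ⊜ h ⊞ ((i ⊞ (vs ⊞ xs)) ⊞ ys)) ↭-refl
         (hole-binding (into x υ w) τ) (into-binding x w) vs xs ys)))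

record Split {n m l} (r : Fin m → Fin n) (W : Weak m l) (t : Term shared l) (σ : Term plain n)
    (zs : Bindings n) : Set where
  constructor split
  field
    {naming} : Fin l → Fin n
    {place}  : Where n
    {outer}  : Bindings n
    {term}   : Term plain n
    {inner}  : Bindings n
    context  : FlatW r W naming place outer
    content  : Flat naming t term inner
    whole    : σ ≡ main-term place term
    parts    : zs ↭ hole-binding place term ++ outer ++ inner

-- Converse to `plugʷ`. A rule is analysed by splitting the flat form of its left side at each
-- context, and its right side is rebuilt by plugging into the same pieces.
splitʷ : ∀ {n m l} {r : Fin m → Fin n} (W : Weak m l) {t σ zs} → Flat r (W ⟨ t ⟩) σ zs → Split r W
    t σ zs
splitʷ □ f = split □ f refl ↭-refl
splitʷ (u ·ʳ W) (_·_ {xs = vs} g f) with splitʷ W f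
... | split {place = w} {xs} {τ} {ys} fw f′ refl p = split (g ·ʳ fw) f′ (inʳ-main _ w τ)
  (↭-trans (++⁺ˡ vs p) (↭-trans
    (solve 4 (λ h vs xs ys → vs ⊞ (h ⊞ (xs ⊞ ys)) ⊜ h ⊞ ((vs ⊞ xs) ⊞ ys)) ↭-refl (hole-binding w τ)
        vs xs ys)
    (↭-reflexive (cong (_++ (vs ++ xs) ++ ys) (inʳ-hole _ w τ)))))
splitʷ (W ·ˡ u) (_·_ {ys = vs} f g) with splitʷ W f
... | split {place = w} {xs} {τ} {ys} fw f′ refl p = split (fw ·ˡ g) f′ (inˡ-main _ w τ)
  (↭-trans (++⁺ʳ vs p) (↭-trans
    (solve 4 (λ h vs xs ys → (h ⊞ (xs ⊞ ys)) ⊞ vs ⊜ h ⊞ ((vs ⊞ xs) ⊞ ys)) ↭-refl (hole-binding w τ)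
        vs xs ys)
    (↭-reflexive (cong (_++ (vs ++ xs) ++ ys) (inˡ-hole _ w τ)))))
splitʷ (W [← u ]) (_[←_] {υ = υ} {x} {ys = vs} f g) with splitʷ W f
... | split {place = w} {xs} {τ} {ys} fw f′ refl p = split (fw [← g ]) f′ refl
  (↭-trans (prep _ (++⁺ʳ vs p))
    (solve 5 (λ a h vs xs ys → a ⊞ ((h ⊞ (xs ⊞ ys)) ⊞ vs) ⊜ h ⊞ ((a ⊞ (vs ⊞ xs)) ⊞ ys)) ↭-refl
       ((x , υ) ∷ []) (hole-binding w τ) vs xs ys))
splitʷ (u [← W ]ʳ) (_[←_] {τ = υ} {x = x} {vs} g f) with splitʷ W f
... | split {place = w} {xs} {τ} {ys} fw f′ refl p = split (g [← fw ]ʳ) f′ (sym (into-main x _ w τ))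
  (↭-trans (prep _ (++⁺ˡ vs p)) (↭-trans
    (solve 5 (λ a h vs xs ys → a ⊞ (vs ⊞ (h ⊞ (xs ⊞ ys))) ⊜ (a ⊞ h) ⊞ (vs ⊞ (xs ⊞ ys))) ↭-refl
       ((x , main-term w τ) ∷ []) (hole-binding w τ) vs xs ys)
    (↭-trans (++⁺ʳ (vs ++ xs ++ ys) (into-hole x υ w τ))
      (solve 5 (λ h i vs xs ys → (h ⊞ i) ⊞ (vs ⊞ (xs ⊞ ys)) ⊜ h ⊞ ((i ⊞ (vs ⊞ xs)) ⊞ ys)) ↭-refl
         (hole-binding (into x υ w) τ) (into-binding x w) vs xs ys))))

inside-naming : ∀ {n m l} {r : Fin m → Fin n} {W : Weak m l} {r′ w xs} → FlatW r W r′ w xs → r′ ∘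
    inside W ≗ r
inside-naming □            i = refl
inside-naming (_ ·ʳ fw)    i = inside-naming fw i
inside-naming (fw ·ˡ _)    i = inside-naming fw i
inside-naming (fw [← _ ])  i = inside-naming fw (suc i)
inside-naming (_ [← fw ]ʳ) i = inside-naming fw i

-- The names in `Fin n` are global, so moving a context into the scope of further substitutions, as
-- `replace` does, does not change its flat form.
renameʷ-Flat : ∀ {n m l m′} {r : Fin m′ → Fin n} (ρ : Fin m → Fin m′) {r₀ : Fin m → Fin n}
    {W : Weak m l} {r′ w xs} →
               r ∘ ρ ≗ r₀ → FlatW r₀ W r′ w xs → ∃[ r″ ] FlatW r (proj₂ (renameʷ ρ W)) r″ w xs
renameʷ-Flat ρ e □            = _ , □
renameʷ-Flat ρ e (g ·ʳ fw)    = let _ , fw′ = renameʷ-Flat ρ e fw in _ , Flat-rename ρ e g ·ʳ fw′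
renameʷ-Flat ρ e (fw ·ˡ g)    = let _ , fw′ = renameʷ-Flat ρ e fw in _ , fw′ ·ˡ Flat-rename ρ e g
renameʷ-Flat ρ e (fw [← g ])  = let _ , fw′ = renameʷ-Flat (ext ρ) (◂-ext e) fw in _ , fw′ [←
    Flat-rename ρ e g ]
renameʷ-Flat ρ e (g [← fw ]ʳ) = let _ , fw′ = renameʷ-Flat ρ e fw in _ , Flat-rename (ext ρ)
    (◂-ext e) g [← fw′ ]ʳ

shallow-main : ∀ {n m l} {r : Fin m → Fin n} (S : Shallow m l) {r′ w xs} → FlatW r ⌊ S ⌋ r′ w xs →
    ∃[ F ] w ≡ main F
shallow-main □          □           = _ , refl
shallow-main (S ·ˡ u)   (fw ·ˡ g)   with shallow-main S fw
... | _ , refl = _ , refl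
shallow-main (u ·ʳ S)   (g ·ʳ fw)   with shallow-main S fw
... | _ , refl = _ , refl
shallow-main (S [← u ]) (fw [← g ]) = shallow-main S fw

substitution-main : ∀ {n m l} {r : Fin m → Fin n} (L : Substitution m l) {r′ w xs} → FlatW r ⌊ L ⌋ˡ
    r′ w xs → w ≡ main []
substitution-main □          □           = refl
substitution-main (L [← u ]) (fw [← g ]) = substitution-main L fw

under : ∀ {n} → Frames n → Where n → Where n
under F (main G)      = main (G ++ F)
under F (bound z G τ) = bound z G (plug F τ)

under-[] : ∀ {n} (w : Where n) → under [] w ≡ w
under-[] (main G)      = cong main (++-identityʳ G)
under-[] (bound z G τ) = refl

inˡ-under : ∀ {n} u F (w : Where n) → inˡ u (under F w) ≡ under (F ++ left u ∷ []) w
inˡ-under u F (main G)      = cong main (++-assoc G F _)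
inˡ-under u F (bound z G τ) = cong (bound z G) (sym (plug-++ F _ τ))

inʳ-under : ∀ {n} u F (w : Where n) → inʳ u (under F w) ≡ under (F ++ right u ∷ []) w
inʳ-under u F (main G)      = cong main (++-assoc G F _)
inʳ-under u F (bound z G τ) = cong (bound z G) (sym (plug-++ F _ τ))

composeʷ : ∀ {n m l k} {r : Fin m → Fin n} (S : Shallow m l) {r′ w F xs} {V : Weak l k} {r″ w′ ys} →
           FlatW r ⌊ S ⌋ r′ w xs → w ≡ main F → FlatW r′ V r″ w′ ys →
           ∃[ zs ] FlatW r (⌊ S ⌋ ∘ʷ V) r″ (under F w′) zs × zs ↭ xs ++ ys
composeʷ □ {w′ = w′} {ys} □ refl fw =
  ys , transport (λ w → FlatW _ _ _ w ys) (sym (under-[] w′)) fw , ↭-refl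
composeʷ (S ·ˡ u) {w′ = w′} {ys} (_·ˡ_ {υ = υ} {vs} {xs = xs} fw g) eq fw′ with shallow-main S fw
composeʷ (S ·ˡ u) {w′ = w′} {ys} (_·ˡ_ {υ = υ} {vs} {xs = xs} fw g) refl fw′ | F , refl with
    composeʷ S fw refl fw′
... | zs , fw″ , p = _ , transport (λ w → FlatW _ _ _ w (vs ++ zs)) (inˡ-under υ F w′) (fw″ ·ˡ g) ,
  ↭-trans (++⁺ˡ vs p) (↭-reflexive (sym (++-assoc vs xs ys)))
composeʷ (u ·ʳ S) {w′ = w′} {ys} (_·ʳ_ {υ = υ} {vs} {xs = xs} g fw) eq fw′ with shallow-main S fw
composeʷ (u ·ʳ S) {w′ = w′} {ys} (_·ʳ_ {υ = υ} {vs} {xs = xs} g fw) refl fw′ | F , refl with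
    composeʷ S fw refl fw′
... | zs , fw″ , p = _ , transport (λ w → FlatW _ _ _ w (vs ++ zs)) (inʳ-under υ F w′) (g ·ʳ fw″) ,
  ↭-trans (++⁺ˡ vs p) (↭-reflexive (sym (++-assoc vs xs ys)))
composeʷ (S [← u ]) {ys = ys} (_[←_] {ys = vs} {xs = xs} fw g) eq fw′ with composeʷ S fw eq fw′
... | zs , fw″ , p = _ , fw″ [← g ] , prep _ (↭-trans (++⁺ˡ vs p)
    (↭-reflexive (sym (++-assoc vs xs ys))))

record Decomposed {n m l k} (r : Fin m → Fin n) (S : Shallow m l) (V : Weak l k)
    (r″ : Fin k → Fin n)
                  (w : Where n) (xs : Bindings n) : Set where
  constructor decomposed
  field
    {naming}  : Fin l → Fin n
    {frames}  : Frames n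
    {place}   : Where n
    {ys zs}   : Bindings n
    outer     : FlatW r ⌊ S ⌋ naming (main frames) ys
    inner     : FlatW naming V r″ place zs
    placed    : w ≡ under frames place
    parts     : xs ↭ ys ++ zs

decompose : ∀ {n m l k} {r : Fin m → Fin n} (S : Shallow m l) {V : Weak l k} {r″ w xs} →
            FlatW r (⌊ S ⌋ ∘ʷ V) r″ w xs → Decomposed r S V r″ w xs
decompose □ {w = w} fw = decomposed □ fw (sym (under-[] w)) ↭-refl
decompose (S ·ˡ u) (_·ˡ_ {υ = υ} {vs} fw g) with decompose S fw
... | decomposed {frames = F} {w} {ys} {zs} o i refl p = decomposed (o ·ˡ g) i (inˡ-under υ F w)
  (↭-trans (++⁺ˡ vs p) (↭-reflexive (sym (++-assoc vs ys zs))))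
decompose (u ·ʳ S) (_·ʳ_ {υ = υ} {vs} g fw) with decompose S fw
... | decomposed {frames = F} {w} {ys} {zs} o i refl p = decomposed (g ·ʳ o) i (inʳ-under υ F w)
  (↭-trans (++⁺ˡ vs p) (↭-reflexive (sym (++-assoc vs ys zs))))
decompose (S [← u ]) (_[←_] {ys = vs} fw g) with decompose S fw
... | decomposed {ys = ys} {zs} o i eq p = decomposed (o [← g ]) i eq
  (prep _ (↭-trans (++⁺ˡ vs p) (↭-reflexive (sym (++-assoc vs ys zs)))))

⌊∘ˢ⌋ : ∀ {m l k} (S : Shallow m l) (T : Shallow l k) → ⌊ S ∘ˢ T ⌋ ≡ ⌊ S ⌋ ∘ʷ ⌊ T ⌋
⌊∘ˢ⌋ □          T = refl
⌊∘ˢ⌋ (S ·ˡ u)   T = cong (λ W → W ·ˡ u) (⌊∘ˢ⌋ S T)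
⌊∘ˢ⌋ (u ·ʳ S)   T = cong (λ W → u ·ʳ W) (⌊∘ˢ⌋ S T)
⌊∘ˢ⌋ (S [← u ]) T = cong (λ W → W [← u ]) (⌊∘ˢ⌋ S T)

-- Substitution contexts contribute no frames, so the application nearest to the hole becomes the
-- innermost frame.
applicative-frames : ∀ {n m k} {r : Fin m → Fin n} {S : Shallow m k} → Applicative S → ∀ {r′ F xs} →
                     FlatW r ⌊ S ⌋ r′ (main F) xs → ∃[ υ ] ∃[ G ] F ≡ left υ ∷ G
applicative-frames (_ , S , L , u , refl) fw
  with decompose S (transport (λ W → FlatW _ W _ _ _) (⌊∘ˢ⌋ S (shallow L ·ˡ u)) fw)
... | decomposed {frames = F} o i eq p = lem i eq
  where
  lem : ∀ {n m l} {r : Fin m → Fin n} {L : Substitution m l} {u r′ w ys F G} →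
        FlatW r (⌊ shallow L ⌋ ·ˡ u) r′ w ys → main G ≡ under F w → ∃[ υ ] ∃[ H ] G ≡ left υ ∷ H
  lem {L = L} (fw ·ˡ g) eq with substitution-main L fw
  lem {L = L} (fw ·ˡ g) refl | refl = _ , _ , refl

-- Bindings against environments

record IsEntry {n} (E : Env n) (b : Fin n × Term plain n) : Set where
  constructor is
  field content : entry E (proj₁ b) ≡ proj₂ b

Entries : ∀ {n} → Env n → Bindings n → Set
Entries E = All (IsEntry E)

equal : ∀ {n} → Fin n → Fin n → ℕ
equal zero    zero    = 1
equal zero    (suc _) = 0
equal (suc _) zero    = 0
equal (suc i) (suc j) = equal i j

occurs : ∀ {n} → Fin n → Bindings n → ℕ
occurs i []             = 0
occurs i ((x , _) ∷ xs) = equal i x + occurs i xs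

occurs-↭ : ∀ {n} (i : Fin n) {xs ys} → xs ↭ ys → occurs i xs ≡ occurs i ys
occurs-↭ i Perm.refl = refl
occurs-↭ i (Perm.prep (x , _) p) = cong (equal i x +_) (occurs-↭ i p)
occurs-↭ i (Perm.swap {ys = ys} (x , _) (y , _) p) rewrite occurs-↭ i p =
  trans (sym (+-assoc (equal i x) (equal i y) _))
    (trans (cong (_+ occurs i ys) (+-comm (equal i x) (equal i y)))
        (+-assoc (equal i y) (equal i x) _))
occurs-↭ i (Perm.trans p q) = trans (occurs-↭ i p) (occurs-↭ i q)

occurs-weaken-zero : ∀ {n} (xs : Bindings n) → occurs zero (map weaken-binding xs) ≡ 0
occurs-weaken-zero []       = refl
occurs-weaken-zero (x ∷ xs) = occurs-weaken-zero xs

occurs-weaken-suc : ∀ {n} (i : Fin n) xs → occurs (suc i) (map weaken-binding xs) ≡ occurs i xs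
occurs-weaken-suc i []             = refl
occurs-weaken-suc i ((x , _) ∷ xs) = cong (equal i x +_) (occurs-weaken-suc i xs)

Entries-weaken : ∀ {n} (E : Env n) f {xs} → Entries E xs → Entries (E ▷ f) (map weaken-binding xs)
Entries-weaken E f []      = []
Entries-weaken E f (is p ∷ q) = is (cong (rename suc) p) ∷ Entries-weaken E f q

-- The order of the substitutions is forgotten; what remains is that every variable is bound exactly
-- once, to its entry.
Matches : ∀ {n} → Env n → Bindings n → Set
Matches E xs = Entries E xs × (∀ i → occurs i xs ≡ 1)

Matches-↭ : ∀ {n} {E : Env n} {xs ys} → xs ↭ ys → Matches E xs → Matches E ys
Matches-↭ p (e , c) = All-resp-↭ p e , λ i → trans (sym (occurs-↭ i p)) (c i)

-- Transfers the side conditions of the calculus, which speak of `↓` of subterms, to the unfolding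
-- of flat terms through `E`.
flat-unfold : ∀ {n m} (E : Env n) {r : Fin m → Fin n} {t τ xs} → Flat r t τ xs → Entries E xs →
              subst (unfold E) τ ≡ subst (unfold E ∘ r) (t ↓)
flat-unfold E (var refl) e = refl
flat-unfold E con e = refl
flat-unfold E {r} (abs s refl refl) e = cong ƛ_
  (trans (subst-rename _ (ext r) s) (trans (subst-cong (exts-ext (unfold E) r) s)
    (cong (subst (exts (unfold E ∘ r))) (sym (embed-↓ s)))))
flat-unfold E (_·_ {xs = xs} f g) e = cong₂ _·_ (flat-unfold E f (++⁻ˡ xs e))
    (flat-unfold E g (++⁻ʳ xs e))
flat-unfold E {r} (_[←_] {t = t} {u} {υ = υ} {x} {xs} f g) (is e₀ ∷ e) =
  trans (flat-unfold E f (++⁻ˡ xs e)) (trans (subst-cong lem (t ↓))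
      (sym (subst-∘-zero↦ (unfold E ∘ r) (t ↓) (u ↓))))
  where
  lem : unfold E ∘ (x ◂ r) ≗ (subst (unfold E ∘ r) (u ↓) ◂ (unfold E ∘ r))
  lem zero    = trans (unfold-entry E x) (trans (cong (subst (unfold E)) e₀)
      (flat-unfold E g (++⁻ʳ xs e)))
  lem (suc i) = refl

-- Substitution in shallow contexts

substˢ-cong : ∀ {n m n′} {σ σ′ : Fin n → Term shared n′} → σ ≗ σ′ → (S : Shallow n m) → substˢ σ S
    ≡ substˢ σ′ S
substˢ-cong e □          = refl
substˢ-cong e (S ·ˡ u)   = cong₂ (λ p t → _ , proj₂ p ·ˡ t) (substˢ-cong e S) (subst-cong e u)
substˢ-cong e (u ·ʳ S)   = cong₂ (λ p t → _ , t ·ʳ proj₂ p) (substˢ-cong e S) (subst-cong e u)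
substˢ-cong e (S [← u ]) = cong₂ (λ p t → _ , proj₂ p [← t ]) (substˢ-cong (exts-cong e) S)
    (subst-cong e u)

substˢ-substˢ : ∀ {n m n′ n″} (τ : Fin n′ → Term shared n″) (σ : Fin n → Term shared n′)
    (S : Shallow n m) →
                substˢ τ (proj₂ (substˢ σ S)) ≡ substˢ (subst τ ∘ σ) S
substˢ-substˢ τ σ □          = refl
substˢ-substˢ τ σ (S ·ˡ u)   = cong₂ (λ p t → _ , proj₂ p ·ˡ t) (substˢ-substˢ τ σ S)
    (subst-subst τ σ u)
substˢ-substˢ τ σ (u ·ʳ S)   = cong₂ (λ p t → _ , t ·ʳ proj₂ p) (substˢ-substˢ τ σ S)
    (subst-subst τ σ u)
substˢ-substˢ τ σ (S [← u ]) = cong₂ (λ p t → _ , proj₂ p [← t ])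
  (trans (substˢ-substˢ (exts τ) (exts σ) S) (substˢ-cong (exts-exts τ σ) S)) (subst-subst τ σ u)

substˢ-var : ∀ {n m} {σ : Fin n → Term shared n} → σ ≗ var → (S : Shallow n m) → substˢ σ S ≡
    (m , S)
substˢ-var e □          = refl
substˢ-var e (S ·ˡ u)   = cong₂ (λ p t → _ , proj₂ p ·ˡ t) (substˢ-var e S)
    (trans (subst-cong e u) (subst-var u))
substˢ-var e (u ·ʳ S)   = cong₂ (λ p t → _ , t ·ʳ proj₂ p) (substˢ-var e S)
    (trans (subst-cong e u) (subst-var u))
substˢ-var e (S [← u ]) = cong₂ (λ p t → _ , proj₂ p [← t ])
  (substˢ-var (λ i → trans (exts-cong e i) (exts-var i)) S) (trans (subst-cong e u) (subst-var u))

flat-fireball : ∀ {n m} (E : Env n) {r : Fin m → Fin n} {σ : Fin m → Term shared 0} {u υ ys} →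
                (∀ i → σ i ≡ embed (unfold E (r i))) → Flat r u υ ys → Entries E ys →
                Fireball (subst σ u ↓) → Fireball (subst (unfold E) υ)
flat-fireball E {σ = σ} {u} e f p = transport Fireball
  (trans (subst-↓ σ u) (trans (subst-cong (λ i → trans (cong _↓ (e i)) (embed-↓ _)) (u ↓))
      (sym (flat-unfold E f p))))

-- Evaluability under a substitution is evaluability after its content has been substituted. The
-- induction therefore carries a closing substitution `σ`, which agrees with the unfolding of the
-- environment.
evaluable-frames : ∀ {n m l} {E : Env n} (S : Shallow m l) {r : Fin m → Fin n} {r′ w xs F}
    (σ : Fin m → Term shared 0) →
  (∀ i → σ i ≡ embed (unfold E (r i))) → FlatW r ⌊ S ⌋ r′ w xs → w ≡ main F → Entries E xs →
  Evaluable (proj₂ (substˢ σ S)) → Evald (unfold E) F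
evaluable-frames □ σ e □ refl p ev = []
evaluable-frames (S ·ˡ u) σ e (fw ·ˡ g) eq p (ev ·ˡ fb) with shallow-main S fw
evaluable-frames {E = E} (S ·ˡ u) σ e (_·ˡ_ {ys = ys} fw g) refl p (ev ·ˡ fb) | F , refl =
  Evald-++ (evaluable-frames S σ e fw refl (++⁻ʳ ys p) ev)
      (left (flat-fireball E e g (++⁻ˡ ys p) fb) [])
evaluable-frames (u ·ʳ S) σ e (g ·ʳ fw) eq p (·ʳ ev) with shallow-main S fw
evaluable-frames (u ·ʳ S) σ e (_·ʳ_ {ys = ys} g fw) refl p (·ʳ ev) | F , refl =
  Evald-++ (evaluable-frames S σ e fw refl (++⁻ʳ ys p) ev) (right [])
evaluable-frames {E = E} (S [← t ]) {r} σ e (_[←_] {υ = υ} {ys} {x} fw g) eq (is p₀ ∷ p)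
    (ev [← _ ]) =
  evaluable-frames S (subst (zero↦ (embed (subst σ t ↓))) ∘ exts σ) e′ fw eq (++⁻ʳ ys p)
    (transport (λ q → Evaluable (proj₂ q)) (substˢ-substˢ (zero↦ (embed (subst σ t ↓))) (exts σ) S)
        ev)
  where
  e′ : ∀ i → subst (zero↦ (embed (subst σ t ↓))) (exts σ i) ≡ embed (unfold E ((x ◂ r) i))
  e′ zero = cong embed
    (trans (subst-↓ σ t) (trans (subst-cong (λ i → trans (cong _↓ (e i)) (embed-↓ _)) (t ↓))
      (trans (sym (flat-unfold E g (++⁻ˡ ys p))) (trans (cong (subst (unfold E)) (sym p₀))
          (sym (unfold-entry E x))))))
  e′ (suc i) = trans (subst-rename _ suc (σ i)) (trans (subst-var (σ i)) (e i))

-- Chains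

data Path {n} (E : Env n) : Fin n → Fin n → Set where
  stop : ∀ {x} → Path E x x
  via  : ∀ {x y z} → entry E x ≡ var y → Path E y z → Path E x z

path-snoc : ∀ {n} {E : Env n} {x y z} → Path E x y → entry E y ≡ var z → Path E x z
path-snoc stop      e = via e stop
path-snoc (via d p) e = via d (path-snoc p e)

path-trans : ∀ {n} {E : Env n} {x y z} → Path E x y → Path E y z → Path E x z
path-trans stop      q = q
path-trans (via d p) q = via d (path-trans p q)

entry-head : ∀ {n} (E : Env n) x {v} → entry E x ≡ ƛ v → hop E x ≡ head v
entry-head (E ▷ (ƛ v)) zero refl = refl
entry-head (E ▷ c) (suc i) eq with entry E i in eq′
entry-head (E ▷ c) (suc i) refl | ƛ v rewrite entry-head E i eq′ = refl

record Updated {n} (E E′ : Env n) (z : Fin n) (c : Term plain n) : Set where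
  constructor updated
  field
    new   : entry E′ z ≡ c
    other : ∀ i → equal i z ≡ 0 → entry E′ i ≡ entry E i

entry-hop : ∀ {n} (E : Env n) x {y v} → entry E x ≡ var y → hop E y ≡ head v →
            ∃[ E′ ] hop E x ≡ env E′ × Updated E E′ x (ƛ v)
entry-hop (E ▷ var y) zero refl eq with hop E y in eq′
entry-hop (E ▷ var y) zero refl refl | head v = _ , refl , updated refl λ { (suc i) _ → refl }
entry-hop (E ▷ c) (suc i) e eq with entry E i in eq′
entry-hop (E ▷ c) (suc i) refl eq | var y with hop E y in eq″
entry-hop (E ▷ c) (suc i) refl refl | var y | head v with entry-hop E i eq′ eq″
... | E′ , h , updated a b rewrite h = _ , refl , updated (cong (rename suc) a)
  λ { zero _ → refl ; (suc j) p → cong (rename suc) (b j p) }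

entry-env : ∀ {n} (E : Env n) x {y E′} → entry E x ≡ var y → hop E y ≡ env E′ → hop E x ≡ env E′
entry-env (E ▷ var y) zero refl eq with hop E y in eq′
entry-env (E ▷ var y) zero refl refl | env E′ = refl
entry-env (E ▷ c) (suc i) e eq with entry E i in eq′
entry-env (E ▷ c) (suc i) refl eq | var y with hop E y in eq″
entry-env (E ▷ c) (suc i) refl refl | var y | env E′ rewrite entry-env E i eq′ eq″ = refl

-- `hop` acts at the end of a chain, so every variable from which the chain passes through `z`
-- triggers the same replacement.
path-hop : ∀ {n} {E : Env n} {y z x v} → Path E y z → entry E z ≡ var x → entry E x ≡ ƛ v →
           ∃[ E′ ] hop E y ≡ env E′ × Updated E E′ z (ƛ v)
path-hop {E = E} {y} {x = x} stop      e₁ e₂ = entry-hop E y e₁ (entry-head E x e₂)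
path-hop {E = E} {y} (via d p) e₁ e₂ with path-hop p e₁ e₂
... | E′ , h , u = E′ , entry-env E y d h , u

path-value : ∀ {n} {E : Env n} {y z} → Path E y z → isƛ (unfold E z) ≡ true → isƛ (unfold E y) ≡
    true
path-value stop p = p
path-value {E = E} {y} (via d q) p =
  trans (cong isƛ (trans (unfold-entry E y) (cong (subst (unfold E)) d))) (path-value q p)

into-entries : ∀ {n} {E : Env n} x υ w t ys xs →
  Entries E (hole-binding (into x υ w) t ++ into-binding x w ++ ys ++ xs) →
  entry E x ≡ main-term w t × Entries E ys × Entries E (hole-binding w t ++ xs)
into-entries x υ w t ys xs e
  with All-resp-↭ (↭-trans
    (solve 4 (λ h i ys xs → h ⊞ (i ⊞ (ys ⊞ xs)) ⊜ (h ⊞ i) ⊞ (ys ⊞ xs)) ↭-refl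
      (hole-binding (into x υ w) t) (into-binding x w) ys xs)
    (↭-trans (++⁺ʳ (ys ++ xs) (↭-sym (into-hole x υ w t)))
      (prep _ (solve 3 (λ h ys xs → h ⊞ (ys ⊞ xs) ⊜ ys ⊞ (h ⊞ xs)) ↭-refl (hole-binding w t) ys
          xs)))) e
... | is p ∷ q = p , ++⁻ˡ ys q , ++⁻ʳ ys q

-- Identity contexts create no frames: the hole is the main term itself, or the whole content of a
-- substitution that a chain starting at the main term reaches.
Leads : ∀ {n} → Env n → Where n → Set
Leads E w = w ≡ main [] ⊎ (∃[ z ] ∃[ y ] w ≡ bound z [] (var y) × Path E y z)

leads-to : ∀ {n} {E : Env n} {w x xs} → Leads E w → Entries E (hole-binding w (var x) ++ xs) →
           ∃[ y ] main-term w (var x) ≡ var y × Path E y x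
leads-to (inj₁ refl)                 e       = _ , refl , stop
leads-to (inj₂ (z , y , refl , p)) (is e ∷ _) = y , refl , path-snoc p e

leads-into : ∀ {n} {E : Env n} {w x y υ t} → Leads E w → υ ≡ var y → Path E y x → entry E x ≡
    main-term w t →
             Leads E (into x υ w)
leads-into (inj₁ refl)                  refl p e = inj₂ (_ , _ , refl , p)
leads-into (inj₂ (z , y′ , refl , p′)) refl p e = inj₂ (z , _ , refl , path-trans (path-snoc p e)
    p′)

hole-name : ∀ {n m l} {r : Fin (suc m) → Fin n} {W : Weak (suc m) l} {r′ w xs τ ys} →
            FlatW r W r′ w xs → Flat r′ (var (inside W zero)) τ ys → τ ≡ var (r zero) × ys ≡ []
hole-name fw (var eq) = cong var (trans (sym eq) (inside-naming fw zero)) , refl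

hole-entries : ∀ {n} {E : Env n} w t xs {ys} → Entries E ys → ys ↭ hole-binding w t ++ xs ++ [] →
    Entries E (hole-binding w t ++ xs)
hole-entries w t xs e p = transport (λ xs → Entries _ (hole-binding w t ++ xs)) (++-identityʳ xs)
    (All-resp-↭ p e)

hole-binding-under : ∀ {n} (F : Frames n) w t → hole-binding (under F w) t ≡ hole-binding w t
hole-binding-under F (main G)      t = refl
hole-binding-under F (bound z G τ) t = refl

identity-leads : ∀ {n m l} {E : Env n} {r : Fin m → Fin n} (I : Identity m l) {r′ w xs} x → FlatW r
    ⌊ I ⌋ⁱ r′ w xs →
  Entries E (hole-binding w (var x) ++ xs) → Leads E w
identity-leads □ x □ e = inj₁ refl
identity-leads (I [← t ]) x (_[←_] {υ = υ} {ys} {y} {w = w} {xs} fw g) e =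
  identity-leads I x fw (++⁻ˡ (hole-binding w (var x) ++ xs) (All-resp-↭
    (solve 4 (λ h a ys xs → h ⊞ (a ⊞ (ys ⊞ xs)) ⊜ (h ⊞ xs) ⊞ (a ⊞ ys)) ↭-refl
      (hole-binding w (var x)) ((y , υ) ∷ []) ys xs) e))
identity-leads (I ⟨x⟩[← I′ ]) x (_[←_]ʳ {υ = υ} {ys} {y} {w = w} {xs} g fw) e
  with splitʷ ⌊ I ⌋ⁱ g | into-entries y υ w (var x) ys xs e
... | split {place = w₁} {xs₁} fw₁ f refl p | e₀ , e₁ , e₂ with hole-name fw₁ f
... | refl , refl with leads-to (identity-leads I y fw₁ (hole-entries w₁ (var y) xs₁ e₁ p))
    (hole-entries w₁ (var y) xs₁ e₁ p)
... | z , eq , q = leads-into (identity-leads I′ x fw e₂) eq q e₀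

-- The rule assumes usefulness of the chain-starting context, from which the frames around `source`
-- come, but it changes the content of `target`. The path between them is the chain that `hop`
-- follows.
record Chained {n m l} (E : Env n) (r : Fin m → Fin n) (C : Chain m l) (j : Fin l) (w : Where n) :
    Set where
  constructor chained
  field
    {target source} : Fin n
    {frames}        : Frames n
    {naming}        : Fin (proj₁ (start C j)) → Fin n
    {bindings}      : Bindings n
    place           : w ≡ bound target [] (plug frames (var source))
    path            : Path E source target
    startʷ          : FlatW r ⌊ proj₂ (start C j) ⌋ naming (main frames) bindings
    entries         : Entries E bindings

chain : ∀ {n m l} {E : Env n} {r : Fin m → Fin n} (C : Chain m l) j {r′ w xs} → FlatW r ⌊ C ⌋ᶜ r′ w
    xs →
        Entries E (hole-binding w (var (r′ j)) ++ xs) → Chained E r C j w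
chain (S ⟨x⟩[← I ]ˢ) j {r′} (_[←_]ʳ {υ = υ} {ys} {x} {w = w} {xs} g fw) e
  with splitʷ ⌊ S ⌋ g | into-entries x υ w (var (r′ j)) ys xs e
... | split {place = w₁} {xs₁} fw₁ f refl p | e₀ , e₁ , e₂ with hole-name fw₁ f | shallow-main S
    fw₁ | plugʷ fw (var {i = j} refl)
... | refl , refl | F , refl | zs , f′ , q with identity-leads I (r′ j) fw e₂
... | inj₁ refl =
  chained refl stop (fw₁ [← f′ ])
    (is e₀ ∷ ++⁺ (All-resp-↭ (↭-sym q) (++⁺ {xs = xs} e₂ []))
        (hole-entries (main F) (var x) xs₁ e₁ p))
... | inj₂ (z , y , refl , pa) =
  chained refl (via e₀ pa) (fw₁ [← f′ ])
    (is e₀ ∷ ++⁺ (All-resp-↭ (↭-sym q) (transport (λ xs → Entries _ (_ ∷ xs))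
        (sym (++-identityʳ xs)) e₂)) (hole-entries (main F) (var x) xs₁ e₁ p))
chain (C ⟨x⟩[← I ]) j {r′} (_[←_]ʳ {υ = υ} {ys} {x} {w = w} {xs} g fw) e
  with splitʷ ⌊ C ⌋ᶜ g | into-entries x υ w (var (r′ j)) ys xs e
... | split {naming = r₁} {place = w₁} {xs₁} fw₁ f refl p | e₀ , e₁ , e₂ with hole-name fw₁ f |
    plugʷ fw (var {i = j} refl)
... | refl , refl | zs , f′ , q
  with chain C (inside ⌊ C ⌋ᶜ zero) fw₁
         (transport (λ i → Entries _ (hole-binding w₁ (var i) ++ xs₁))
             (sym (inside-naming fw₁ zero)) (hole-entries w₁ (var x) xs₁ e₁ p))
     | hole-entries w₁ (var x) xs₁ e₁ p
... | chained refl pa st en | is ex ∷ _ with identity-leads I (r′ j) fw e₂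
... | inj₁ refl =
  chained refl (path-snoc pa ex) (st [← f′ ]) (is e₀ ∷ ++⁺
      (All-resp-↭ (↭-sym q) (++⁺ {xs = xs} e₂ [])) en)
... | inj₂ (z , y , refl , pa′) =
  chained refl (path-trans (path-snoc (path-snoc pa ex) e₀) pa′) (st [← f′ ])
    (is e₀ ∷ ++⁺ (All-resp-↭ (↭-sym q) (transport (λ xs → Entries _ (_ ∷ xs))
        (sym (++-identityʳ xs)) e₂)) en)
chain (S ∘ᶜ C) j {r′} {w} {xs} fw e with decompose S fw
... | decomposed {frames = F} {w′} {ys} {zs} o i refl p
  with chain C j i (++⁺ (transport (Entries _) (hole-binding-under F w′ (var (r′ j)))
      (++⁻ˡ (hole-binding (under F w′) (var (r′ j))) e))
                        (++⁻ʳ ys (All-resp-↭ p (++⁻ʳ (hole-binding (under F w′) (var (r′ j))) e))))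
... | chained {frames = G} refl pa st en with composeʷ S o refl st
... | us , st′ , q = chained (cong (bound _ []) (sym (plug-++ G F _))) pa
  (transport (λ W → FlatW _ W _ _ us) (sym (⌊∘ˢ⌋ S (proj₂ (start C j)))) st′)
  (All-resp-↭ (↭-sym q) (++⁺ (++⁻ˡ ys (All-resp-↭ p (++⁻ʳ (_ ∷ []) e))) en))

-- Steps of the Unchaining Fireball Calculus on flat states

useful-frames : ∀ {n l} {E : Env n} {S : Shallow 0 l} {r : Fin 0 → Fin n} {r′ F xs} → Useful S →
                FlatW r ⌊ S ⌋ r′ (main F) xs → Entries E xs → ∃[ f ] ∃[ G ] F ≡ left f ∷ G × Evald
                    (unfold E) (left f ∷ G)
useful-frames {S = S} (ev , ap) fw e with applicative-frames ap fw
... | f , G , refl = f , G , refl ,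
  evaluable-frames S (λ ()) (λ ()) fw refl e (transport (λ p → Evaluable (proj₂ p))
      (sym (substˢ-var (λ ()) S)) ev)

compose-entries : ∀ {n m l k} {E : Env n} {r : Fin m → Fin n} (S : Shallow m l) (T : Shallow l k)
    {r′ F xs r″ G ys} →
  FlatW r ⌊ S ⌋ r′ (main F) xs → FlatW r′ ⌊ T ⌋ r″ (main G) ys → Entries E xs → Entries E ys →
  ∃[ zs ] FlatW r ⌊ S ∘ˢ T ⌋ r″ (main (G ++ F)) zs × Entries E zs
compose-entries S T {ys = ys} fw fw′ e e′ with composeʷ S fw refl fw′
... | zs , fw″ , p = zs , transport (λ W → FlatW _ W _ _ zs) (sym (⌊∘ˢ⌋ S T)) fw″ , All-resp-↭
    (↭-sym p) (++⁺ e e′)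

splitˢ : ∀ {n m l} {r : Fin m → Fin n} (S : Shallow m l) {t σ zs} → Flat r (⌊ S ⌋ ⟨ t ⟩) σ zs →
  ∃[ r′ ] ∃[ F ] ∃[ xs ] ∃[ τ ] ∃[ ys ] FlatW r ⌊ S ⌋ r′ (main F) xs × Flat r′ t τ ys × σ ≡ plug F
      τ × zs ↭ xs ++ ys
splitˢ S f with splitʷ ⌊ S ⌋ f
... | split fw f′ eq p with shallow-main S fw
... | F , refl = _ , F , _ , _ , _ , fw , f′ , eq , p

splitˡ : ∀ {n m l} {r : Fin m → Fin n} (L : Substitution m l) {t σ zs} → Flat r (⌊ L ⌋ˡ ⟨ t ⟩) σ zs
    →
  ∃[ r′ ] ∃[ xs ] ∃[ ys ] FlatW r ⌊ L ⌋ˡ r′ (main []) xs × Flat r′ t σ ys × zs ↭ xs ++ ys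
splitˡ L f with splitʷ ⌊ L ⌋ˡ f
... | split fw f′ eq p with substitution-main L fw
splitˡ L f | split fw f′ refl p | refl = _ , _ , _ , fw , f′ , p

record Contracted {n m l} (E : Env n) (r : Fin 0 → Fin n) (S : Shallow 0 m) (L : Substitution m l)
                  (t : Term shared (suc l)) (u : Term shared m) (τ : Term plain n)
                      (zs : Bindings n) : Set where
  constructor contracted
  field
    {frames}  : Frames n
    {naming}  : Fin l → Fin n
    {body}    : Term plain (suc l)
    {arg}     : Term plain n
    evald     : Evald (unfold E) (left arg ∷ frames)
    redex     : τ ≡ plug frames ((ƛ rename (ext naming) body) · arg)
    contract  : ∀ x → ∃[ zs′ ] Flat r (⌊ S ⌋ ⟨ ⌊ L ⌋ˡ ⟨ t [← rename (inside ⌊ L ⌋ˡ) u ] ⟩ ⟩)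
                  (plug frames (rename (x ◂ naming) body)) zs′ × zs′ ↭ (x , arg) ∷ zs

contract-om : ∀ {n m l} {E : Env n} {r : Fin 0 → Fin n} (S : Shallow 0 m) (L : Substitution m l)
    {t u τ zs} →
  Useful (S ∘ˢ (□ ·ˡ u)) → Flat r (⌊ S ⌋ ⟨ (⌊ L ⌋ˡ ⟨ ƛ t ⟩) · u ⟩) τ zs → Entries E zs → Contracted
      E r S L t u τ zs
contract-om S L {u = u} us f e with splitˢ S f
... | r₁ , F , xs , _ , _ , fw , (_·_ {xs = as} {ys} fλ fu) , refl , p with splitˡ L fλ
... | r₂ , ls , [] , fl , abs s refl refl , q
  with All-resp-↭ p e
... | e′ with compose-entries S (□ ·ˡ u) fw (□ ·ˡ fu) (++⁻ˡ xs e′) (++⁺ (++⁻ʳ as (++⁻ʳ xs e′)) [])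
... | vs , fw′ , e″ with useful-frames us fw′ e″
... | _ , _ , refl , ev = contracted ev refl λ x →
  let fu′ = Flat-rename (inside ⌊ L ⌋ˡ) (inside-naming fl) fu
      zs₁ , f₁ , p₁ = plugʷ fl (Flat-embed (x ◂ r₂) s [← fu′ ])
      zs₂ , f₂ , p₂ = plugʷ fw f₁
  in zs₂ , f₂ , ↭-trans p₂ (↭-trans (++⁺ˡ xs p₁)
       (↭-trans (solve 4 (λ a xs ls ys → xs ⊞ (ls ⊞ (a ⊞ ys)) ⊜ a ⊞ (xs ⊞ (ls ⊞ ys))) ↭-refl
           ((x , _) ∷ []) xs ls ys)
         (prep _ (↭-sym (↭-trans p (++⁺ˡ xs (↭-trans (++⁺ʳ ys q)
           (↭-reflexive (cong (_++ ys) (++-identityʳ ls))))))))))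

State-of : ∀ {n} → Term shared 0 → Term plain n → Env n → Set
State-of {n} u τ E = Σ (Fin 0 → Fin n) λ r → ∃[ zs ] Flat r u τ zs × Matches E zs

data OfStep {n} (E : Env n) (τ : Term plain n) (u′ : Term shared 0) : Set where
  om  : ∀ {F t f} → Evald (unfold E) (left f ∷ F) → τ ≡ plug F ((ƛ t) · f) →
        State-of u′ (plug (mapᶠ (rename suc) F) t) (E ▷ f) → OfStep E τ u′
  oes : ∀ {F x f v} → Evald (unfold E) (left f ∷ F) → τ ≡ plug F (var x · f) → hop E x ≡ head v →
        State-of u′ (plug F ((ƛ v) · f)) E → OfStep E τ u′
  oec : ∀ {F x f E′} → Evald (unfold E) (left f ∷ F) → τ ≡ plug F (var x · f) → isƛ (unfold E x) ≡
      true →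
        hop E x ≡ env E′ → State-of u′ τ E′ → OfStep E τ u′

rename-collapse : ∀ {n m} {r : Fin m → Fin (suc n)} (b : Term plain (suc m))
    (s : Term plain (suc n)) →
  rename (ext r) b ≡ rename (ext suc) s → rename (zero ◂ r) b ≡ s
rename-collapse {r = r} b s eq =
  trans (rename-cong lem b) (trans (sym (rename-rename (zero ◂ id) (ext r) b))
    (trans (cong (rename (zero ◂ id)) eq) (trans (rename-rename (zero ◂ id) (ext suc) s)
      (trans (rename-cong lem′ s) (rename-id s)))))
  where
  lem : (zero ◂ r) ≗ (zero ◂ id) ∘ ext r
  lem zero    = refl
  lem (suc i) = refl
  lem′ : (zero ◂ id) ∘ ext suc ≗ id
  lem′ zero    = refl
  lem′ (suc i) = refl

ƛ-injective : ∀ {k n} {t u : Term k (suc n)} → _≡_ {A = Term k n} (ƛ t) (ƛ u) → t ≡ u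
ƛ-injective refl = refl

-- The new substitution needs a name outside the old scope. The rule is analysed twice, in the given
-- scope for the redex and in the weakened one, where `zero` is free to name the substitution;
-- uniqueness of the redex identifies the two analyses.
om-step : ∀ {n m l} {E : Env n} {r : Fin 0 → Fin n} (S : Shallow 0 m) (L : Substitution m l)
    {t u τ zs} →
  Useful (S ∘ˢ (□ ·ˡ u)) → Flat r (⌊ S ⌋ ⟨ (⌊ L ⌋ˡ ⟨ ƛ t ⟩) · u ⟩) τ zs → Matches E zs →
  OfStep E τ (⌊ S ⌋ ⟨ ⌊ L ⌋ˡ ⟨ t [← rename (inside ⌊ L ⌋ˡ) u ] ⟩ ⟩)
om-step {E = E} {r} S L {zs = zs} us f (e , c) with contract-om {E = E} S L us f e
... | contracted {F} {r₁} {s} {a} ev refl _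
  with contract-om {E = E ▷ a} S L us (Flat-weaken {r′ = suc ∘ r} (λ _ → refl) f)
      (Entries-weaken E a e)
... | contracted {F′} {r₂} {s′} {a′} ev′ eq′ con′
  with redex-unique ev′ (ƛ rename (ext r₂) s′) refl (Evald-rename {F = left a ∷ F} ev)
      (ƛ rename (ext suc) (rename (ext r₁) s)) refl
         (trans (sym eq′) (plug-rename suc F _)) | con′ zero
... | eq | zs′ , f′ , p with cong proj₁ eq | ƛ-injective (cong proj₂ eq)
... | refl | eqb = om ev refl (suc ∘ r , zs′ , transport
    (λ t → Flat _ _ (plug (mapᶠ (rename suc) F) t) zs′) (rename-collapse s′ _ eqb) f′ ,
  Matches-↭ (↭-sym p) (is refl ∷ Entries-weaken E a e ,
    λ { zero    → cong suc (occurs-weaken-zero zs)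
      ; (suc i) → trans (occurs-weaken-suc i zs) (c i) }))

replaced : ∀ {n m l k} {r : Fin m → Fin n} {x} {W : Weak (suc m) k} {r₁ w xs}
    (L : Substitution m l) {r₂ ls v v̂} →
  FlatW (x ◂ r) W r₁ w xs → FlatW r ⌊ L ⌋ˡ r₂ (main []) ls → Flat r₂ v v̂ [] →
  ∃[ zs ] Flat r (⌊ L ⌋ˡ ⟨ replace W L v ⟩) (main-term w v̂) zs × zs ↭ hole-binding w v̂ ++
      ((x , v̂) ∷ ls ++ xs)
replaced {x = x} {w = w} {xs} L {ls = ls} {v̂ = v̂} fw fl fv
  with renameʷ-Flat (ext (inside ⌊ L ⌋ˡ)) (◂-ext (inside-naming fl)) fw
... | r′ , fw′ with plugʷ fw′ (Flat-rename _ (λ i → inside-naming fw′ (suc i)) fv)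
... | zs , f , p with plugʷ fl (f [← fv ])
... | zs′ , f′ , p′ = zs′ , f′ , ↭-trans p′ (↭-trans (++⁺ˡ ls (prep (x , v̂) (++⁺ʳ [] p)))
  (solve 4 (λ a h ls xs → ls ⊞ (a ⊞ ((h ⊞ (xs ⊞ ∅)) ⊞ ∅)) ⊜ h ⊞ (a ⊞ (ls ⊞ xs))) ↭-refl
      ((x , v̂) ∷ []) (hole-binding w v̂) ls xs))

-- A shallow context has its hole in the main term, so the bag of bindings stays as it is and only
-- the head variable changes.
oes-step : ∀ {n m k l} {E : Env n} {r : Fin 0 → Fin n} (S : Shallow 0 m) (S′ : Shallow (suc m) k)
    (L : Substitution m l) {t τ zs} →
  let v = ƛ t in
  Useful (S ∘ˢ (S′ [← ⌊ L ⌋ˡ ⟨ v ⟩ ])) → Flat r (⌊ S ⌋ ⟨ ⌊ S′ ⌋ ⟨x⟩ [← ⌊ L ⌋ˡ ⟨ v ⟩ ] ⟩) τ zs →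
      Matches E zs →
  OfStep E τ (⌊ S ⌋ ⟨ ⌊ L ⌋ˡ ⟨ replace ⌊ S′ ⌋ L v ⟩ ⟩)
oes-step {E = E} {r} S S′ L {zs = zs} us f m@(e , c) with splitˢ S f
... | r₁ , F , xs , _ , _ , fw , (_[←_] {x = x} {as} {bs} fS fv) , refl , p with splitˢ S′ fS |
    splitˡ L fv
... | r₂ , G , cs , _ , ds , fw₂ , fx , refl , p₂ | r₃ , ls , [] , fl , fλ@(abs s refl refl) , q
    with hole-name fw₂ fx
... | refl , refl with All-resp-↭ p e
... | e′ with ++⁻ʳ xs e′
... | is ex ∷ e″ with All-resp-↭ p₂ (++⁻ˡ as e″)
... | ec with compose-entries S (S′ [← _ ]) fw (fw₂ [← fv ]) (++⁻ˡ xs e′)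
    (is ex ∷ ++⁺ (++⁻ʳ as e″) (++⁻ˡ cs ec))
... | vs , fw′ , ev with useful-frames us fw′ ev
... | g , H , eq , evald with replaced L fw₂ fl fλ
... | zs′ , f′ , p′ with plugʷ fw f′
... | zs″ , f″ , p″ = oes evald
  (trans (sym (plug-++ G F (var x))) (cong (λ F → plug F (var x)) eq)) (entry-head E x ex)
  (r , zs″ , transport (λ τ → Flat r _ τ zs″) (trans (sym (plug-++ G F _))
      (cong (λ F → plug F _) eq)) f″ ,
   Matches-↭ (↭-trans p (↭-trans (++⁺ˡ xs (prep _
     (↭-trans (↭-++ p₂ q) (solve 2 (λ cs ls → (cs ⊞ ∅) ⊞ (ls ⊞ ∅) ⊜ ls ⊞ cs) ↭-refl cs ls))))
     (↭-sym (↭-trans p″ (++⁺ˡ xs p′))))) m)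

equal-refl : ∀ {n} (i : Fin n) → equal i i ≡ 1
equal-refl zero    = refl
equal-refl (suc i) = equal-refl i

Entries-update : ∀ {n} {E E′ : Env n} {z c} → Updated E E′ z c → ∀ {xs} → occurs z xs ≡ 0 → Entries
    E xs → Entries E′ xs
Entries-update u {[]}           eq []         = []
Entries-update {z = z} u {(x , _) ∷ xs} eq (is p ∷ ps) =
  is (trans (Updated.other u x (trans (equal-sym x z) (m+n≡0⇒m≡0 (equal z x) eq))) p)
  ∷ Entries-update u (m+n≡0⇒n≡0 (equal z x) eq) ps
  where
  open import Data.Nat.Properties using (m+n≡0⇒m≡0; m+n≡0⇒n≡0)
  equal-sym : ∀ {n} (i j : Fin n) → equal i j ≡ equal j i
  equal-sym zero    zero    = refl
  equal-sym zero    (suc j) = refl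
  equal-sym (suc i) zero    = refl
  equal-sym (suc i) (suc j) = equal-sym i j

Matches-update : ∀ {n} {E E′ : Env n} {z c c′ xs} → Updated E E′ z c′ → Matches E ((z , c) ∷ xs) →
    Matches E′ ((z , c′) ∷ xs)
Matches-update {z = z} {xs = xs} u (_ ∷ e , c) = is (Updated.new u) ∷ Entries-update u z∉xs e , c
  where
  z∉xs : occurs z xs ≡ 0
  z∉xs with trans (cong (_+ occurs z xs) (sym (equal-refl z))) (c z)
  ... | eq = suc-injective eq
    where open import Data.Nat.Properties using (suc-injective)

-- A chain context has its hole in the content of a substitution: the main term stays, and the
-- single binding that changes is the one that `hop` updates.
oec-step : ∀ {n m k l} {E : Env n} {r : Fin 0 → Fin n} (S : Shallow 0 m) (C : Chain (suc m) k)
    (L : Substitution m l) {t τ zs} →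
  let v = ƛ t in
  Useful (S ∘ˢ (proj₂ (start C (inside ⌊ C ⌋ᶜ zero)) [← ⌊ L ⌋ˡ ⟨ v ⟩ ])) →
  Flat r (⌊ S ⌋ ⟨ ⌊ C ⌋ᶜ ⟨x⟩ [← ⌊ L ⌋ˡ ⟨ v ⟩ ] ⟩) τ zs → Matches E zs →
  OfStep E τ (⌊ S ⌋ ⟨ ⌊ L ⌋ˡ ⟨ replace ⌊ C ⌋ᶜ L v ⟩ ⟩)
oec-step {E = E} {r} S C L {zs = zs} us f m@(e , c) with splitˢ S f
... | r₁ , F , xs , _ , _ , fw , (_[←_] {x = x} {as} {bs} fC fv) , refl , p with splitʷ ⌊ C ⌋ᶜ fC |
    splitˡ L fv
... | split {r₂} {w} {cs} fw₂ fx refl p₂ | r₃ , ls , [] , fl , fλ@(abs s refl refl) , q with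
    hole-name fw₂ fx
... | refl , refl with All-resp-↭ p e
... | e′ with ++⁻ʳ xs e′
... | is ex ∷ e″ with hole-entries w (var x) cs (++⁻ˡ as e″) p₂
... | ew with chain C (inside ⌊ C ⌋ᶜ zero) fw₂
                (transport (λ i → Entries E (hole-binding w (var i) ++ cs))
                    (sym (inside-naming fw₂ zero)) ew)
... | chained {z} {y} {G} refl path st en with ew
... | is ez ∷ _ with path-hop path ez ex
... | E′ , hopped , up with compose-entries S (proj₂ (start C (inside ⌊ C ⌋ᶜ zero)) [← _ ]) fw
    (st [← fv ]) (++⁻ˡ xs e′) (is ex ∷ ++⁺ (++⁻ʳ as e″) en)
... | vs , fw′ , ev with useful-frames us fw′ ev
... | g , H , eq , evald with replaced L fw₂ fl fλ
... | zs′ , f′ , p′ with plugʷ fw f′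
... | zs″ , f″ , p″ = oec evald
  (trans (sym (plug-++ G F (var y))) (cong (λ F → plug F (var y)) eq))
  (path-value path (trans (cong isƛ (trans (unfold-entry E z) (cong (subst (unfold E)) ez)))
                          (cong isƛ (trans (unfold-entry E x) (cong (subst (unfold E)) ex)))))
  hopped
  (r , zs″ , f″ ,
   Matches-↭ (↭-trans (solve 5 (λ b a ls xs cs → b ⊞ (a ⊞ (ls ⊞ (xs ⊞ cs))) ⊜ xs ⊞
       (b ⊞ (a ⊞ (ls ⊞ cs)))) ↭-refl ((z , _) ∷ []) ((x , _) ∷ []) ls xs cs)
       (↭-sym (↭-trans p″ (++⁺ˡ xs p′))))
     (Matches-update up (Matches-↭ (↭-trans p (↭-trans (++⁺ˡ xs (prep _ (↭-++ p₂ q)))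
       (solve 5 (λ b a ls xs cs → xs ⊞ (a ⊞ ((b ⊞ (cs ⊞ ∅)) ⊞ (ls ⊞ ∅))) ⊜ b ⊞
           (a ⊞ (ls ⊞ (xs ⊞ cs)))) ↭-refl ((z , _) ∷ []) ((x , _) ∷ []) ls xs cs))) m)))

of-step : ∀ {n} {E : Env n} {τ u u′} → u ⊸of u′ → State-of u τ E → OfStep E τ u′
of-step (om S L us)    (r , zs , f , m) = om-step S L us f m
of-step (oes S S′ L us) (r , zs , f , m) = oes-step S S′ L us f m
of-step (oec S C L us) (r , zs , f , m) = oec-step S C L us f m

-- Canonical forms up to structural equivalence

≅-refl : ∀ {n} {t : Term shared n} → t ≅ t
≅-refl = Eq.reflexive _⋈ʷ_

≅-sym : ∀ {n} {t u : Term shared n} → t ≅ u → u ≅ t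
≅-sym = Eq.symmetric _⋈ʷ_

≅-trans : ∀ {n} {t u v : Term shared n} → t ≅ u → u ≅ v → t ≅ v
≅-trans = Eq.transitive _⋈ʷ_

≅-reflexive : ∀ {n} {t u : Term shared n} → t ≡ u → t ≅ u
≅-reflexive refl = ≅-refl

axiom : ∀ {n} {t u : Term shared n} → t ⋈ u → t ≅ u
axiom p = Eq.return (ctx □ p)

≅-·ʳ : ∀ {n} (t : Term shared n) {u v} → u ≅ v → t · u ≅ t · v
≅-·ʳ t = Eq.gmap (t ·_) λ { (ctx W p) → ctx (t ·ʳ W) p }

≅-·ˡ : ∀ {n} (t : Term shared n) {u v} → u ≅ v → u · t ≅ v · t
≅-·ˡ t = Eq.gmap (_· t) λ { (ctx W p) → ctx (W ·ˡ t) p }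

≅-[←] : ∀ {n} (t : Term shared n) {u v} → u ≅ v → u [← t ] ≅ v [← t ]
≅-[←] t = Eq.gmap _[← t ] λ { (ctx W p) → ctx (W [← t ]) p }

≅-[←]ʳ : ∀ {n} (t : Term shared (suc n)) {u v} → u ≅ v → t [← u ] ≅ t [← v ]
≅-[←]ʳ t = Eq.gmap (t [←_]) λ { (ctx W p) → ctx (t [← W ]ʳ) p }

-- Telescopes of k explicit substitutions with plain contents, outermost first
data Tel : ℕ → ℕ → ℕ → Set where
  []  : ∀ {m} → Tel 0 m m
  _∷_ : ∀ {k m l} → Term plain m → Tel k (suc m) l → Tel (suc k) m l

infix 6 _⟪_⟫
_⟪_⟫ : ∀ {k m l} → Tel k m l → Term shared l → Term shared m
[]      ⟪ b ⟫ = b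
(c ∷ T) ⟪ b ⟫ = (T ⟪ b ⟫) [← embed c ]

≅-⟪⟫ : ∀ {k m l} (T : Tel k m l) {t u} → t ≅ u → T ⟪ t ⟫ ≅ T ⟪ u ⟫
≅-⟪⟫ []      p = p
≅-⟪⟫ (c ∷ T) p = ≅-[←] (embed c) (≅-⟪⟫ T p)

lift : ∀ {k m l} → Tel k m l → Fin m → Fin l
lift []      i = i
lift (c ∷ T) i = lift T (suc i)

renameᵗ : ∀ {k m l m′} → (Fin m → Fin m′) → Tel k m l → ∃ (Tel k m′)
renameᵗ ρ []      = _ , []
renameᵗ ρ (c ∷ T) = let _ , T′ = renameᵗ (ext ρ) T in _ , rename ρ c ∷ T′

under-tel : ∀ {k m l m′} (ρ : Fin m → Fin m′) (T : Tel k m l) → Fin l → Fin (proj₁ (renameᵗ ρ T))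
under-tel ρ []      = ρ
under-tel ρ (c ∷ T) = under-tel (ext ρ) T

rename-⟪⟫ : ∀ {k m l m′} (ρ : Fin m → Fin m′) (T : Tel k m l) b →
            rename ρ (T ⟪ b ⟫) ≡ (proj₂ (renameᵗ ρ T) ⟪ rename (under-tel ρ T) b ⟫)
rename-⟪⟫ ρ []      b = refl
rename-⟪⟫ ρ (c ∷ T) b = cong₂ _[←_] (rename-⟪⟫ (ext ρ) T b) (rename-embed ρ c)

_⊹_ : ∀ {k j m l o} → Tel k m l → Tel j l o → Tel (k + j) m o
[]      ⊹ U = U
(c ∷ T) ⊹ U = c ∷ (T ⊹ U)

⊹-⟪⟫ : ∀ {k j m l o} (T : Tel k m l) (U : Tel j l o) b → ((T ⊹ U) ⟪ b ⟫) ≡ (T ⟪ U ⟪ b ⟫ ⟫)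
⊹-⟪⟫ []      U b = refl
⊹-⟪⟫ (c ∷ T) U b = cong _[← embed c ] (⊹-⟪⟫ T U b)

float-·ʳ : ∀ {k m l} (a : Term shared m) (T : Tel k m l) b → a · (T ⟪ b ⟫) ≅ T ⟪ rename (lift T) a
    · b ⟫
float-·ʳ a []      b = ≅-reflexive (cong (_· b) (sym (rename-id a)))
float-·ʳ a (c ∷ T) b = ≅-trans (≅-sym (axiom ·r)) (≅-[←] (embed c)
  (≅-trans (float-·ʳ (rename suc a) T b) (≅-⟪⟫ T (≅-reflexive
      (cong (_· b) (rename-rename (lift T) suc a))))))

float-·ˡ : ∀ {k m l} (a : Term shared m) (T : Tel k m l) b → (T ⟪ b ⟫) · a ≅ T ⟪ b · rename
    (lift T) a ⟫
float-·ˡ a []      b = ≅-reflexive (cong (b ·_) (sym (rename-id a)))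
float-·ˡ a (c ∷ T) b = ≅-trans (≅-sym (axiom ·l)) (≅-[←] (embed c)
  (≅-trans (float-·ˡ (rename suc a) T b) (≅-⟪⟫ T (≅-reflexive
      (cong (b ·_) (rename-rename (lift T) suc a))))))

float-[←] : ∀ {k m l} (a : Term shared (suc m)) (T : Tel k m l) b →
            a [← T ⟪ b ⟫ ] ≅ T ⟪ rename (ext (lift T)) a [← b ] ⟫
float-[←] a []      b = ≅-reflexive (cong _[← b ] (sym (trans (rename-cong ext-id a)
    (rename-id a))))
float-[←] a (c ∷ T) b = ≅-trans (≅-sym (axiom nest)) (≅-[←] (embed c)
  (≅-trans (float-[←] (rename (ext suc) a) T b) (≅-⟪⟫ T (≅-reflexive (cong _[← b ]
    (trans (rename-rename (ext (lift T)) (ext suc) a) (rename-cong (ext-∘ (lift T) suc) a)))))))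

data FlatT {n} : ∀ {k m l} → (Fin m → Fin n) → Tel k m l → (Fin l → Fin n) → Bindings n → Set where
  []  : ∀ {m} {r : Fin m → Fin n} → FlatT r [] r []
  _∷_ : ∀ {k m l} {r : Fin m → Fin n} {c υ x} {T : Tel k (suc m) l} {r′ xs} →
        υ ≡ rename r c → FlatT (x ◂ r) T r′ xs → FlatT r (c ∷ T) r′ ((x , υ) ∷ xs)

lift-naming : ∀ {n k m l} {r : Fin m → Fin n} {T : Tel k m l} {r′ xs} → FlatT r T r′ xs → r′ ∘ lift
    T ≗ r
lift-naming []      i = refl
lift-naming (_ ∷ f) i = lift-naming f (suc i)

FlatT-rename : ∀ {n k m l m′} {r : Fin m′ → Fin n} (ρ : Fin m → Fin m′) {r₀ : Fin m → Fin n}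
    {T : Tel k m l} {r′ xs} →
  r ∘ ρ ≗ r₀ → FlatT r₀ T r′ xs → ∃[ r″ ] FlatT r (proj₂ (renameᵗ ρ T)) r″ xs × r″ ∘ under-tel ρ T
      ≗ r′
FlatT-rename {r = r} ρ e [] = r , [] , e
FlatT-rename {r = r} ρ e (_∷_ {c = c} eq f) with FlatT-rename (ext ρ) (◂-ext e) f
... | r″ , f′ , e′ = r″ , trans eq (sym (trans (rename-rename r ρ c) (rename-cong e c))) ∷ f′ , e′

FlatT-⊹ : ∀ {n k j m l o} {r : Fin m → Fin n} {T : Tel k m l} {r′ xs} {U : Tel j l o} {r″ ys} →
          FlatT r T r′ xs → FlatT r′ U r″ ys → FlatT r (T ⊹ U) r″ (xs ++ ys)
FlatT-⊹ []       g = g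
FlatT-⊹ (eq ∷ f) g = eq ∷ FlatT-⊹ f g

record Floated {n m} (r : Fin m → Fin n) (t : Term shared m) (τ : Term plain n) (xs : Bindings n) :
    Set where
  constructor floated
  field
    {size inner} : ℕ
    {naming}     : Fin inner → Fin n
    {bindings}   : Bindings n
    tel          : Tel size m inner
    body         : Term plain inner
    equiv        : t ≅ tel ⟪ embed body ⟫
    flat         : FlatT r tel naming bindings
    whole        : τ ≡ rename naming body
    parts        : bindings ↭ xs

-- In an application the telescope of the argument is floated outside that of the function, which is
-- renamed into its scope. The same holds for the content and the body of a substitution; hence the
-- exchange in the bag of bindings.
float : ∀ {n m} {r : Fin m → Fin n} {t τ xs} → Flat r t τ xs → Floated r t τ xs
float (var {i = i} refl) = floated [] (var i) ≅-refl [] refl ↭-refl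
float (con {a = a})      = floated [] (con a) ≅-refl [] refl ↭-refl
float (abs s refl refl)  = floated [] (ƛ s) ≅-refl [] refl ↭-refl
float (_·_ {t = t} {u} {xs = xs} {ys} f g) with float f | float g
... | floated T a p fT refl q | floated {naming = r′} U b p′ fU refl q′
  with FlatT-rename (lift U) (lift-naming fU) fT
... | r″ , fT′ , e = floated (U ⊹ T′) (rename (under-tel (lift U) T) a · rename (lift T′) b)
  (≅-trans (≅-·ˡ u p) (≅-trans (≅-·ʳ (T ⟪ embed a ⟫) p′)
    (≅-trans (float-·ʳ (T ⟪ embed a ⟫) U (embed b))
      (≅-trans (≅-⟪⟫ U (≅-trans (≅-reflexive (cong (_· embed b) (rename-⟪⟫ (lift U) T (embed a))))
                          (≅-trans (float-·ˡ (embed b) T′ (rename (under-tel (lift U) T) (embed a)))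
                            (≅-⟪⟫ T′ (≅-reflexive (cong₂ _·_ (rename-embed _ a)
                                (rename-embed _ b)))))))
        (≅-reflexive (sym (⊹-⟪⟫ U T′ _)))))))
  (FlatT-⊹ fU fT′)
  (cong₂ _·_ (sym (trans (rename-rename r″ _ a) (rename-cong e a)))
             (sym (trans (rename-rename r″ _ b) (rename-cong (lift-naming fT′) b))))
  (↭-trans (↭-++ q′ q) (++-comm ys xs))
  where T′ = proj₂ (renameᵗ (lift U) T)
float (_[←_] {t = t} {u} {x = x} {xs} {ys} f g) with float f | float g
... | floated T a p fT refl q | floated {naming = r′} U b p′ fU refl q′
  with FlatT-rename (ext (lift U)) (◂-ext (lift-naming fU)) fT
... | r″ , fT′ , e = floated (U ⊹ (b ∷ T′)) (rename (under-tel (ext (lift U)) T) a)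
  (≅-trans (≅-[←] u p) (≅-trans (≅-[←]ʳ (T ⟪ embed a ⟫) p′)
    (≅-trans (float-[←] (T ⟪ embed a ⟫) U (embed b))
      (≅-trans (≅-⟪⟫ U (≅-reflexive (cong _[← embed b ]
          (trans (rename-⟪⟫ (ext (lift U)) T (embed a))
                 (cong (T′ ⟪_⟫) (rename-embed _ a))))))
        (≅-reflexive (sym (⊹-⟪⟫ U (b ∷ T′) _)))))))
  (FlatT-⊹ fU (refl ∷ fT′))
  (sym (trans (rename-rename r″ _ a) (rename-cong e a)))
  (↭-trans (↭-++ q′ (prep _ q)) (++-comm ys (_ ∷ xs)))
  where T′ = proj₂ (renameᵗ (ext (lift U)) T)

var-injective : ∀ {k n} {i j : Fin n} → _≡_ {A = Term k n} (var i) (var j) → i ≡ j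
var-injective refl = refl

·-injective : ∀ {k n} {t u t′ u′ : Term k n} → t · u ≡ t′ · u′ → t ≡ t′ × u ≡ u′
·-injective refl = refl , refl

-- A pullback property of renamings: a term that two renamings identify with another uses only
-- variables on which their images meet. It serves to show that a content does not mention a given
-- variable.
factor : ∀ {n m l o} (ρ : Fin n → Fin l) (κ : Fin m → Fin l) (θ : Fin o → Fin n) →
         (∀ i j → ρ i ≡ κ j → ∃[ i′ ] i ≡ θ i′) →
         (t : Term plain n) (u : Term plain m) → rename ρ t ≡ rename κ u → ∃[ t′ ] t ≡ rename θ t′
factor ρ κ θ h (var i) (var j) eq = let i′ , e = h i j (var-injective eq) in var i′ , cong var e
factor ρ κ θ h (con a) (con b) eq = con a , refl
factor ρ κ θ h (ƛ t)   (ƛ u)   eq =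
  let t′ , e = factor (ext ρ) (ext κ) (ext θ) h′ t u (ƛ-injective eq) in (ƛ t′) , cong ƛ_ e
  where
  h′ : ∀ i j → ext ρ i ≡ ext κ j → ∃[ i′ ] i ≡ ext θ i′
  h′ zero    zero    e = zero , refl
  h′ zero    (suc j) ()
  h′ (suc i) zero    ()
  h′ (suc i) (suc j) e = let i′ , e′ = h i j (sucᶠ-injective e) in suc i′ , cong suc e′
factor ρ κ θ h (t · s) (u · v) eq =
  let e₁ , e₂ = ·-injective eq
      t′ , p = factor ρ κ θ h t u e₁
      s′ , q = factor ρ κ θ h s v e₂
  in t′ · s′ , cong₂ _·_ p q
factor ρ κ θ h (var _) (con _) ()
factor ρ κ θ h (var _) (ƛ _)   ()
factor ρ κ θ h (var _) (_ · _) ()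
factor ρ κ θ h (con _) (var _) ()
factor ρ κ θ h (con _) (ƛ _)   ()
factor ρ κ θ h (con _) (_ · _) ()
factor ρ κ θ h (ƛ _)   (var _) ()
factor ρ κ θ h (ƛ _)   (con _) ()
factor ρ κ θ h (ƛ _)   (_ · _) ()
factor ρ κ θ h (_ · _) (var _) ()
factor ρ κ θ h (_ · _) (con _) ()
factor ρ κ θ h (_ · _) (ƛ _)   ()

rename-injective : ∀ {n m} (ρ : Fin n → Fin m) → (∀ i j → ρ i ≡ ρ j → i ≡ j) →
                   (t u : Term plain n) → rename ρ t ≡ rename ρ u → t ≡ u
ext-injective : ∀ {n m} (ρ : Fin n → Fin m) → (∀ i j → ρ i ≡ ρ j → i ≡ j) → ∀ i j → ext ρ i ≡ ext ρ
    j → i ≡ j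
ext-injective ρ h zero    zero    e = refl
ext-injective ρ h (suc i) (suc j) e = cong suc (h i j (sucᶠ-injective e))
rename-injective ρ h (var i) (var j) eq = cong var (h i j (var-injective eq))
rename-injective ρ h (con a) (con b) refl = refl
rename-injective ρ h (ƛ t)   (ƛ u)   eq = cong ƛ_ (rename-injective (ext ρ) (ext-injective ρ h) t u
    (ƛ-injective eq))
rename-injective ρ h (t · s) (u · v) eq =
  let e₁ , e₂ = ·-injective eq in cong₂ _·_ (rename-injective ρ h t u e₁)
          (rename-injective ρ h s v e₂)

rename-suc-injective : ∀ {n} (t u : Term plain n) → rename suc t ≡ rename suc u → t ≡ u
rename-suc-injective = rename-injective suc (λ i j → sucᶠ-injective)

-- The substitution on zero commutes with those inside it, whose contents do not mention it.
record Sunk {n k m l} (r₀ : Fin m → Fin n) (T : Tel k (suc m) l) (d : Term plain m)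
    (r′ : Fin l → Fin (suc n))
            (xs : Bindings (suc n)) : Set where
  constructor sunk
  field
    {inner}    : ℕ
    {naming}   : Fin inner → Fin n
    {bindings} : Bindings n
    tel        : Tel k m inner
    renaming′  : Fin l → Fin (suc inner)
    equiv      : ∀ b → (T ⟪ b ⟫) [← embed d ] ≅ tel ⟪ rename renaming′ b [← embed
        (rename (lift tel) d) ] ⟫
    flat       : FlatT r₀ tel naming bindings
    names      : ext naming ∘ renaming′ ≗ r′
    parts      : xs ≡ map weaken-binding bindings

sink : ∀ {n} {E : Env n} {c} {k m l} (T : Tel k (suc m) l) (d : Term plain m)
    {r : Fin (suc m) → Fin (suc n)}
       {r₀ : Fin m → Fin n} {r′ xs} → (zero ◂ suc ∘ r₀) ≗ r → FlatT r T r′ xs → occurs zero xs ≡ 0 →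
       Entries (E ▷ c) xs → Sunk r₀ T d r′ xs
sink [] d {r₀ = r₀} e [] _ _ =
  sunk [] id (λ b → ≅-reflexive (cong₂ _[←_] (sym (rename-id b)) (cong embed (sym (rename-id d)))))
      [] lem refl
  where
  lem : ext r₀ ≗ _
  lem zero    = e zero
  lem (suc i) = e (suc i)
sink (f ∷ T) d e (_∷_ {x = zero} eq fl) () en
sink {n} {E} (f ∷ T) d {r} {r₀} e (_∷_ {x = suc y} refl fl) o (is p ∷ en)
  -- The entry of `suc y` is weakened, so `f` does not mention the variable that is being moved
  -- inwards: the freshness condition of `com`.
  with factor r suc suc lem f (entry E y) (sym p)
  where
  lem : ∀ i j → r i ≡ suc j → ∃[ i′ ] i ≡ suc i′
  lem zero    j q with trans (e zero) q
  ... | ()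
  lem (suc i) j q = i , refl
... | f′ , refl with FlatT-rename {r = zero ◂ suc ∘ (y ◂ r₀)} swap lem fl
  where
  lem : (zero ◂ suc ∘ (y ◂ r₀)) ∘ swap ≗ (suc y ◂ r)
  lem zero          = refl
  lem (suc zero)    = e zero
  lem (suc (suc i)) = e (suc i)
... | r″ , fl′ , e′ with sink (proj₂ (renameᵗ swap T)) (rename suc d) (λ _ → refl) fl′ o en
... | sunk {naming = r₁} {bs} U π eqv fU nm refl = sunk (f′ ∷ U) (π ∘ under-tel swap T)
  (λ b → ≅-trans (≅-[←] (embed d) (≅-[←]ʳ (T ⟪ b ⟫) (≅-reflexive (sym (rename-embed suc f′)))))
    (≅-trans (axiom com)
    (≅-trans (≅-[←] (embed f′) (≅-reflexive (cong₂ _[←_] (rename-⟪⟫ swap T b)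
        (rename-embed suc d))))
    (≅-trans (≅-[←] (embed f′) (eqv (rename (under-tel swap T) b)))
      (≅-reflexive (cong₂ (λ t u → (U ⟪ t [← embed u ] ⟫) [← embed f′ ])
        (rename-rename π (under-tel swap T) b) (rename-rename (lift U) suc d)))))))
  (refl ∷ fU)
  (λ i → trans (nm (under-tel swap T i)) (e′ i))
  (cong (λ t → (suc y , t) ∷ map weaken-binding bs) (trans (rename-rename r suc f′)
    (trans (rename-cong (λ i → sym (e (suc i))) f′) (sym (rename-rename suc r₀ f′)))))

record Extracted {n k m l} (c : Term plain n) (r₀ : Fin m → Fin n) (T : Tel (suc k) m l)
    (r′ : Fin l → Fin (suc n))
                 (xs : Bindings (suc n)) : Set where
  constructor extracted
  field
    {inner}    : ℕ
    {naming}   : Fin inner → Fin n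
    {bindings} : Bindings n
    tel        : Tel k m inner
    content    : Term plain inner
    renaming′  : Fin l → Fin (suc inner)
    equiv      : ∀ b → T ⟪ b ⟫ ≅ tel ⟪ rename renaming′ b [← embed content ] ⟫
    flat       : FlatT r₀ tel naming bindings
    names      : ext naming ∘ renaming′ ≗ r′
    named      : rename naming content ≡ c
    parts      : xs ↭ (zero , rename suc c) ∷ map weaken-binding bindings

-- `zero` names the newest entry, which no other content mentions, so its substitution can move from
-- any position to the innermost one.
extract : ∀ {n} {E : Env n} {c} {k m l} (T : Tel (suc k) m l) {r : Fin m → Fin (suc n)}
          {r₀ : Fin m → Fin n} {r′ xs} → suc ∘ r₀ ≗ r → FlatT r T r′ xs → occurs zero xs ≡ 1 →
          Entries (E ▷ c) xs → Extracted c r₀ T r′ xs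
extract {c = c} (d ∷ T) {r} {r₀} e (_∷_ {x = zero} refl fl) o (is p ∷ en)
  with sink T d lem fl (suc-injective o) en
  where
  import Data.Nat.Properties
  lem : (zero ◂ suc ∘ r₀) ≗ (zero ◂ r)
  lem zero    = refl
  lem (suc i) = e i
... | sunk {naming = r₁} U π eqv fU nm refl = extracted U (rename (lift U) d) π eqv fU nm
  (trans (rename-rename r₁ (lift U) d) (trans (rename-cong (lift-naming fU) d)
    (rename-suc-injective (rename r₀ d) c (trans (rename-rename suc r₀ d)
        (trans (rename-cong e d) (sym p))))))
  (↭-reflexive (cong (λ t → (zero , t) ∷ map weaken-binding _) (sym p)))
extract {E = E} {k = zero}  (d ∷ []) e (_∷_ {x = suc y} refl []) () en
extract {E = E} {c} {k = suc k} (d ∷ T) {r} {r₀} e (_∷_ {x = suc y} refl fl) o (is p ∷ en)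
  with extract T {r₀ = y ◂ r₀} lem fl o en
  where
  lem : suc ∘ (y ◂ r₀) ≗ (suc y ◂ r)
  lem zero    = refl
  lem (suc i) = e i
... | extracted U d′ π eqv fU nm named q = extracted (d ∷ U) d′ π (λ b → ≅-[←] (embed d) (eqv b))
    (refl ∷ fU) nm named
  (↭-trans (Perm.prep _ q) (↭-trans (Perm.swap _ _ ↭-refl)
      (Perm.prep _ (↭-reflexive (cong (λ t → (suc y , t) ∷ map weaken-binding _)
    (trans (sym (rename-cong e d)) (sym (rename-rename suc r₀ d))))))))

Entries-strengthen : ∀ {n} {E : Env n} {c} xs → Entries (E ▷ c) (map weaken-binding xs) → Entries E
    xs
Entries-strengthen []             []         = []
Entries-strengthen {E = E} ((x , υ) ∷ xs) (is p ∷ ps) = is (rename-suc-injective (entry E x) υ p) ∷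
    Entries-strengthen xs ps

-- Selection sort: the newest entry is made innermost, where `wrap` expects it, and the others form
-- a telescope for the smaller environment.
sort : ∀ {n} (E : Env n) {k l} (T : Tel k 0 l) {r : Fin 0 → Fin n} {r′ xs} → FlatT r T r′ xs →
    Matches E xs →
       ∀ b → T ⟪ b ⟫ ≅ wrap E (rename r′ b)
sort []      []      []                   m b = ≅-reflexive
    (sym (trans (rename-cong (λ ()) b) (rename-id b)))
sort []      (_ ∷ _) (_∷_ {x = ()} _ _) m b
sort (E ▷ c) []      []                   (_ , m) b with m zero
... | ()
sort (E ▷ c) (d ∷ T) {r} f (e , m) b with extract {E = E} (d ∷ T) {r₀ = λ ()} (λ ()) f (m zero) e
... | extracted {naming = r₁} {bs} U d′ π eqv fU nm named q with All-resp-↭ q e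
  where open import Data.List.Relation.Binary.Permutation.Propositional.Properties using
          (All-resp-↭)
... | _ ∷ e′ = ≅-trans (eqv b)
  (≅-trans (sort E U fU (Entries-strengthen bs e′ , λ i → trans (sym (occurs-weaken-suc i bs))
      (trans (sym (occurs-↭ (suc i) q)) (m (suc i)))) _)
    (≅-reflexive (cong (wrap E) (cong₂ _[←_] (trans (rename-rename (ext r₁) π b) (rename-cong nm b))
      (trans (rename-embed r₁ d′) (cong embed named))))))

canonical : ∀ {n} {E : Env n} {r : Fin 0 → Fin n} {u τ xs} → Flat r u τ xs → Matches E xs → u ≅
    wrap E (embed τ)
canonical {E = E} f m with float f
... | floated {naming = r′} T b eqv fT refl p =
  ≅-trans eqv (≅-trans (sort E T fT (Matches-↭ (↭-sym p) m) (embed b))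
    (≅-reflexive (cong (wrap E) (rename-embed r′ b))))

-- Simulation of the Unchaining Fireball Calculus

Of-state : Term shared 0 → ℕ → ∀ {n} → Term plain n → Env n → Set
Of-state u b τ E = ∃[ u′ ] Σ (Star _⊸of_ u′ u) λ d → length d ≡ b × State-of u′ τ E

head-injective : ∀ {n} {v v′ : Term plain (suc n)} → _≡_ {A = Hop n} (head v) (head v′) → v ≡ v′
head-injective refl = refl

env-injective : ∀ {n} {E E′ : Env n} → env E ≡ env E′ → E ≡ E′
env-injective refl = refl

head-value : ∀ {n} (E : Env n) x {v} → hop E x ≡ head v → isƛ (unfold E x) ≡ true
head-value E x eq = cong isƛ (unfold-head E x eq)

-- The derivation is arbitrary, but its next step must act on the unique redex of the flat state.
-- The head of the redex tells contractions from replacements, and `hop` tells the two kinds of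
-- replacement apart, so the step is the one that the machine performs.
of-invariant : ∀ u → Invariant 1 (_≅ u) (Of-state u)
of-invariant u = record { done = done ; final = final ; beta = beta ; hop₁ = hop₁ ; hop₂ = hop₂ }
  where
  done : ∀ {n τ} {E : Env n} → Of-state u 0 τ E → wrap E (embed τ) ≅ u
  done (_ , ε , refl , _ , _ , f , m) = ≅-sym (canonical f m)
  final : ∀ {n b τ} {E : Env n} → Of-state u b τ E → Fireball (subst (unfold E) τ) → b ≡ 0
  final (_ , ε , refl , _) fb = refl
  final {E = E} (_ , s ◅ d , refl , st) fb with of-step s st
  ... | om {t = t} ev eq _          = ⊥-elim (fireball-normal ev (ƛ t) refl eq fb)
  ... | oes {x = x} ev eq h _       = ⊥-elim (fireball-normal ev (var x) (head-value E x h) eq fb)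
  ... | oec {x = x} ev eq isl h _   = ⊥-elim (fireball-normal ev (var x) isl eq fb)
  beta : ∀ {n b F t f} {E : Env n} → Of-state u (suc b) (plug F ((ƛ t) · f)) E → Evald (unfold E)
      (left f ∷ F) →
         Of-state u b (plug (mapᶠ (rename suc) F) t) (E ▷ f)
  beta {t = t} {E = E} (_ , s ◅ d , refl , st) ev with of-step s st
  ... | om {t = t′} ev′ eq st′ with redex-unique ev (ƛ t) refl ev′ (ƛ t′) refl eq
  ... | refl = _ , d , refl , st′
  beta {t = t} {E = E} (_ , s ◅ d , refl , st) ev | oes {x = x} ev′ eq h _
    with redex-unique ev (ƛ t) refl ev′ (var x) (head-value E x h) eq
  ... | ()
  beta {t = t} (_ , s ◅ d , refl , st) ev | oec {x = x} ev′ eq isl h _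
    with redex-unique ev (ƛ t) refl ev′ (var x) isl eq
  ... | ()
  hop₁ : ∀ {n b F x f v} {E : Env n} → Of-state u b (plug F (var x · f)) E → Evald (unfold E)
      (left f ∷ F) →
         hop E x ≡ head v → 1 ≤ b → Of-state u (b ∸ 1) (plug F ((ƛ v) · f)) E
  hop₁ {x = x} {E = E} (_ , s ◅ d , refl , st) ev h le with of-step s st
  ... | om {t = t} ev′ eq _ with redex-unique ev (var x) (head-value E x h) ev′ (ƛ t) refl eq
  ... | ()
  hop₁ {x = x} {E = E} (_ , s ◅ d , refl , st) ev h le | oes {x = y} ev′ eq h′ st′
    with redex-unique ev (var x) (head-value E x h) ev′ (var y) (head-value E y h′) eq
  ... | refl with head-injective (trans (sym h) h′)
  ... | refl = _ , d , refl , st′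
  hop₁ {x = x} {E = E} (_ , s ◅ d , refl , st) ev h le | oec {x = y} ev′ eq isl h′ _
    with redex-unique ev (var x) (head-value E x h) ev′ (var y) isl eq
  ... | refl with trans (sym h) h′
  ... | ()
  hop₂ : ∀ {n b F x f} {E E′ : Env n} → Of-state u b (plug F (var x · f)) E → Evald (unfold E)
      (left f ∷ F) →
         isƛ (unfold E x) ≡ true → hop E x ≡ env E′ → 1 ≤ b → Of-state u (b ∸ 1)
             (plug F (var x · f)) E′
  hop₂ {x = x} {E = E} (_ , s ◅ d , refl , st) ev isl h le with of-step s st
  ... | om {t = t} ev′ eq _ with redex-unique ev (var x) isl ev′ (ƛ t) refl eq
  ... | ()
  hop₂ {x = x} {E = E} (_ , s ◅ d , refl , st) ev isl h le | oes {x = y} ev′ eq h′ _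
    with redex-unique ev (var x) isl ev′ (var y) (head-value E y h′) eq
  ... | refl with trans (sym h) h′
  ... | ()
  hop₂ {x = x} {E = E} (_ , s ◅ d , refl , st) ev isl h le | oec {x = y} ev′ eq isl′ h′ st′
    with redex-unique ev (var x) isl ev′ (var y) isl′ eq
  ... | refl with env-injective (trans (sym h) h′)
  ... | refl = _ , d , refl , st′

theorem14 : Implementable embed _⊸of_ _≅_ (λ size len → (1 + len) * size)
    × Implementable id _→f_ (λ w u → w ↓ ≡ u) (λ size len → (1 + len) * size)
theorem14 =
  (_ , 576 , λ t u d s →
    -- Charge 1, since every replacement is a step of this calculus. The embedded initial term is
    -- flat in the empty environment.
    run-machine 1 ≤-refl (_≅ u) (Of-state u) (of-invariant u) t (length d) s
      (_ , d , refl , id , _ , transport (λ τ → Flat id (embed t) τ []) (rename-id t)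
          (Flat-embed id t) , [] , λ ())) ,
  (_ , 576 , λ t u d s →
    -- Charge 0, since only contractions are steps here.
    run-machine 0 z≤n (λ w → w ↓ ≡ u) (Fireball-state u) (fireball-invariant u) t (length d) s
      (transport (Steps u (length d)) (sym (trans (subst-cong (λ ()) t) (subst-var t))) (d , refl)))
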